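{- The following statements are equivalent: (1) $\mathsf{TotP} \subseteq \mathsf{UPSV_t}$. (2) $\mathsf{\#P} \subseteq \mathsf{UPSV_t}$. (3) $\mathsf{GapP}_{+} \subseteq \mathsf{UPSV_t}$. (4) $\mathsf{SpanP} \subseteq \mathsf{UPSV_t}$. (5) $\mathsf{PP} = \mathsf{UP}$.
   Context: NPTM means nondeterministic polynomial-time bounded Turing machine. For an NPTM $M$ and $x \in \Sigma^*$: $acc_M(x)$, $rej_M(x)$, $Total_M(x)$ are the numbers of accepting, rejecting and all computation paths of $M$ on $x$; $gap_M(x) = acc_M(x) - rej_M(x)$; $tot_M(x) = Total_M(x) - 1$; and, for $M$ with output, $span_M(x)$ is the number of distinct outputs on accepting paths of $M$ on $x$. The classes $\mathsf{\#P}$, $\mathsf{GapP}$, $\mathsf{TotP}$, $\mathsf{SpanP}$ consist of all functions $acc_M$, $gap_M$, $tot_M$, $span_M$, respectively, with $M$ an NPTM; $\mathsf{GapP}_{+}$ is the set of non-negative valued functions in $\mathsf{GapP}$. $\mathsf{FP}$ is the class of polynomial-time computable functions $\Sigma^* \to \mathbb{Z}$. $\mathsf{UPSV_t}$ is the class of total functions $f$ on $\Sigma^*$ for which there is an NPTM that on every input $x \in \Sigma^*$ has exactly one accepting path and outputs $f(x)$ on that path; here $\mathsf{UPSV_t}$ is assumed to contain only non-negative integer valued functions (values written in binary). $\mathsf{UP}$ is the class of languages $L$ for which there is $f \in \mathsf{\#P}$ with $f(x)=1$ if $x \in L$ and $f(x)=0$ if $x \notin L$. $\mathsf{PP}$ is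 the class of languages $L$ for which there are $f \in \mathsf{\#P}$ and $g \in \mathsf{FP}$ with $x \in L \Leftrightarrow f(x) > g(x)$ for all $x \in \Sigma^*$. -}

module Defs where

open import Data.Bool.Base using (Bool; true; false; not)
open import Data.Digit using (Bit; fromDigits)
open import Data.Fin.Base using (Fin; zero; suc)
import Data.Fin.Properties as Fin
open import Data.Integer.Base as ℤ using (ℤ; +_; _◃_; 0ℤ; 1ℤ)
open import Data.List.Base
  using (List; []; _∷_; [_]; _++_; map; concatMap; foldr; length; reverse;
         filterᵇ; deduplicate; fromMaybe)
import Data.List.Properties as List
open import Data.List.Relation.Unary.All using (All)
open import Data.Maybe.Base using (Maybe)
open import Data.Nat.Base using (ℕ; zero; suc; _+_; _*_; _≤_)
open import Data.Product.Base using (∃; ∃-syntax; Σ-syntax; _×_; _,_)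
import Data.Sign.Base as Sign
open import Data.Vec.Base as Vec using (Vec; _∷_; replicate; zipWith)
open import Function.Base using (_∘_)
open import Function.Bundles using (_↔_; _⇔_)
open import Level using (0ℓ) renaming (suc to lsuc)
open import Relation.Binary.PropositionalEquality using (_≡_)
open import Relation.Unary using (Pred; _∩_)

------------------------------------------------------------------------
-- Words and numbers

-- Σ* for Σ = {0,1}.
Word : Set
Word = List Bit

-- Most significant bit first; leading zeros are harmless and the empty
-- word denotes 0.
valueℕ : Word → ℕ
valueℕ = fromDigits ∘ reverse

-- Sign bit (1, that is suc zero, for negative) followed by the magnitude in binary.
valueℤ : Word → ℤ
valueℤ []             = 0ℤ
valueℤ (zero     ∷ w) = Sign.+ ◃ valueℕ w
valueℤ (suc zero ∷ w) = Sign.- ◃ valueℕ w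

-- A polynomial is its list of coefficients, constant term first.
Polynomial : Set
Polynomial = List ℕ

eval : Polynomial → ℕ → ℕ
eval p n = foldr (λ a r → a + n * r) 0 p

------------------------------------------------------------------------
-- Nondeterministic multi-tape Turing machines with a write-only output

Finite : Set → Set
Finite A = ∃[ n ] (A ↔ Fin n)

data Symbol (Γ : Set) : Set where
  blank : Symbol Γ
  bit   : Bit → Symbol Γ
  aux   : Γ → Symbol Γ

data Direction : Set where
  left stay right : Direction

record Move (Q Γ : Set) (k : ℕ) : Set where
  field
    target  : Q
    actions : Vec (Symbol Γ × Direction) k
    emitted : Maybe Bit

-- The list δ q s holds the alternatives available in state q when the
-- heads scan s.  The machine halts exactly when there are none.
record Machine : Set₁ where
  field
    State     : Set
    Aux       : Set
    State-fin : Finite State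
    Aux-fin   : Finite Aux
    extra     : ℕ                        -- work tapes besides the input tape
    start     : State
    accepting : State → Bool
    δ         : State → Vec (Symbol Aux) (suc extra) →
                List (Move State Aux (suc extra))

-- A two-way infinite tape.  Both lists start at the cell adjacent to the
-- head, and all cells beyond their ends are blank.
record Tape (Γ : Set) : Set where
  constructor tape
  field
    lefts  : List (Symbol Γ)
    head   : Symbol Γ
    rights : List (Symbol Γ)

module _ {Γ : Set} where

  emptyTape : Tape Γ
  emptyTape = tape [] blank []

  inputTape : Word → Tape Γ
  inputTape []      = emptyTape
  inputTape (b ∷ w) = tape [] (bit b) (map bit w)

  shift : Direction → Tape Γ → Tape Γ
  shift stay  t                  = t
  shift left  (tape []      a r) = tape [] blank (a ∷ r)
  shift left  (tape (b ∷ l) a r) = tape l b (a ∷ r)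
  shift right (tape l a [])      = tape (a ∷ l) blank []
  shift right (tape l a (b ∷ r)) = tape (a ∷ l) b r

  act : Symbol Γ × Direction → Tape Γ → Tape Γ
  act (a , d) (tape l _ r) = shift d (tape l a r)

module Run (M : Machine) where
  open Machine M

  record Config : Set where
    constructor config
    field
      state  : State
      tapes  : Vec (Tape Aux) (suc extra)
      output : Word

  open Config public

  initial : Word → Config
  initial x = config start (inputTape x ∷ replicate extra emptyTape) []

  apply : Config → Move State Aux (suc extra) → Config
  apply (config _ ts w) m =
    config target (zipWith act actions ts) (w ++ fromMaybe emitted)
    where open Move m

  successors : Config → List Config
  successors c =
    map (apply c) (δ (state c) (Vec.map Tape.head (tapes c)))

  HaltsWithin : ℕ → Config → Set
  HaltsWithin zero    c = successors c ≡ []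
  HaltsWithin (suc n) c = All (HaltsWithin n) (successors c)

  -- The final configurations of all computation paths from c, listed once
  -- per path.  This is the intended list only if HaltsWithin n c, and then
  -- it does not depend on n.
  mutual
    leaves : ℕ → Config → List Config
    leaves zero    c = [ c ]
    leaves (suc n) c = branch n c (successors c)

    branch : ℕ → Config → List Config → List Config
    branch n c []         = [ c ]
    branch n c cs@(_ ∷ _) = concatMap (leaves n) cs

  isAccepting : Config → Bool
  isAccepting = accepting ∘ state

Deterministic : Machine → Set
Deterministic M = ∀ q s → length (δ q s) ≤ 1
  where open Machine M

record NPTM : Set₁ where
  field
    machine : Machine
    bound   : Polynomial

  open Run machine

  field
    halts : ∀ x → HaltsWithin (eval bound (length x)) (initial x)

  paths : Word → List Config
  paths x = leaves (eval bound (length x)) (initial x)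

  acceptingPaths rejectingPaths : Word → List Config
  acceptingPaths = filterᵇ isAccepting ∘ paths
  rejectingPaths = filterᵇ (not ∘ isAccepting) ∘ paths

  -- With multiplicity: one entry per accepting path.
  acceptedOutputs : Word → List Word
  acceptedOutputs = map output ∘ acceptingPaths

  -- One entry per path, accepting or not.
  allOutputs : Word → List Word
  allOutputs = map output ∘ paths

  acc rej Total span : Word → ℕ
  acc   = length ∘ acceptingPaths
  rej   = length ∘ rejectingPaths
  Total = length ∘ paths
  span  = length ∘ deduplicate (List.≡-dec Fin._≟_) ∘ acceptedOutputs

  gap tot : Word → ℤ
  gap x = + acc x ℤ.- + rej x
  tot x = + Total x ℤ.- 1ℤ

------------------------------------------------------------------------
-- Function classes

FunctionClass : Set₂
FunctionClass = Pred (Word → ℤ) (lsuc 0ℓ)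

♯P GapP TotP SpanP : FunctionClass
♯P    f = Σ[ M ∈ NPTM ] ∀ x → f x ≡ + NPTM.acc M x
GapP  f = Σ[ M ∈ NPTM ] ∀ x → f x ≡ NPTM.gap M x
TotP  f = Σ[ M ∈ NPTM ] ∀ x → f x ≡ NPTM.tot M x
SpanP f = Σ[ M ∈ NPTM ] ∀ x → f x ≡ + NPTM.span M x

NonNegative : Pred (Word → ℤ) 0ℓ
NonNegative f = ∀ x → 0ℤ ℤ.≤ f x

GapP₊ : FunctionClass
GapP₊ = GapP ∩ NonNegative

FP : FunctionClass
FP f = Σ[ M ∈ NPTM ] Deterministic (NPTM.machine M) ×
       (∀ x → ∃[ w ] (NPTM.allOutputs M x ≡ [ w ] × f x ≡ valueℤ w))

UPSVₜ : FunctionClass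
UPSVₜ f = Σ[ M ∈ NPTM ]
          (∀ x → ∃[ w ] (NPTM.acceptedOutputs M x ≡ [ w ] × f x ≡ + valueℕ w))

------------------------------------------------------------------------
-- Language classes

-- A language is given by its characteristic function: for an arbitrary
-- predicate L, membership of L in UP would constructively determine L only
-- up to double negation.
Language : Set
Language = Word → Bool

LanguageClass : Set₂
LanguageClass = Pred Language (lsuc 0ℓ)

UP PP : LanguageClass
UP L = Σ[ f ∈ (Word → ℤ) ] ♯P f ×
       (∀ x → (L x ≡ true → f x ≡ 1ℤ) × (L x ≡ false → f x ≡ 0ℤ))
PP L = Σ[ f ∈ (Word → ℤ) ] Σ[ g ∈ (Word → ℤ) ] ♯P f × FP g ×
       (∀ x → L x ≡ true ⇔ g x ℤ.< f x)

{-# OPTIONS --safe #-}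

-- A function is identified with the list of accepted outputs of a machine.
-- Two operations on machines carry the argument: composition, which feeds every
-- accepted output of T to N, and the graph x ↦ ⟨x,N(x)⟩.  Together with
-- finite-state transducers, a subtractor and a clock they yield all machines
-- that are needed.
--
-- ♯P functions are differences of TotP functions (double the accepting leaves
-- and subtract the total), GapP functions are differences of ♯P functions, and
-- UPSVₜ is closed under non-negative differences.  Emitting the choices made
-- turns paths into distinct outputs, so ♯P ⊆ SpanP.  If ♯P ⊆ UPSVₜ, a threshold
-- f > g is decided on a unique path by computing f.  Conversely, if PP = UP,
-- the value v = f(x) is guessed and f(x) + 1 > v and 2^k - f(x) > 2^k - 1 - v
-- are confirmed by UP machines; both are PP queries on ⟨x,v⟩, the second one
-- because M can be made to branch exactly k times, with binary choices.  In the
-- same way, span(x) is the number of the words w for which a UP machine confirms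
-- that M(x) has an output coded by w, so SpanP ⊆ ♯P.

module Submission where

open import Defs
open import Data.Bool.Base using (Bool; true; false; not; _∨_; _∧_; if_then_else_)
open import Data.Bool.Properties using (T?; T-≡)
open import Data.Digit using (Bit; fromDigits)
open import Data.Empty using (⊥)
open import Data.Fin.Base using (Fin; zero; suc; toℕ; fromℕ<)
open import Data.Fin.Properties using (0↔⊥; 1↔⊤; 2↔Bool; +↔⊎; *↔×; toℕ-fromℕ<)
import Data.Fin.Properties as Fin
open import Data.Integer.Base as ℤ using (0ℤ; 1ℤ)
import Data.Integer.Properties as ℤ
open import Data.List.Base as List using (null; List; []; _∷_; [_]; _++_; map; concatMap; length; filterᵇ; fromMaybe; reverse; reverseAcc; deduplicate)
open import Data.List.Properties using (≡-dec; ∷-injectiveʳ; unfold-reverse; filter-all; ++-cancelˡ; ++-identityʳ; ++-assoc; map-++; map-∘; map-cong; map-id; map-concatMap; concatMap-cong; concatMap-map; concatMap-++; length-++; length-reverse; length-map; length-replicate; reverse-++; reverse-involutive)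
open import Data.List.Relation.Unary.All as All using (All; []; _∷_; universal)
open import Data.List.Relation.Unary.All.Properties using (map⁺; ++⁺; filter⁺)
open import Data.List.Relation.Unary.Unique.Propositional using (Unique; []; _∷_)
import Data.List.Relation.Unary.Unique.Propositional.Properties as Unique
open import Data.List.Membership.Propositional using (_∈_)
open import Data.List.Membership.Propositional.Properties using (∈-map⁻; ∈-map⁺; ∈-++⁺ˡ; ∈-++⁺ʳ; ∈-filter⁺; ∈-filter⁻; ∈-deduplicate⁺; ∈-deduplicate⁻)
open import Data.List.Membership.Propositional.Properties.WithK using (unique∧set⇒bag)
open import Data.List.Relation.Binary.BagAndSetEquality using (∼bag⇒↭)
open import Data.List.Relation.Binary.Permutation.Propositional.Properties using (↭-length)
open import Data.List.Relation.Unary.Unique.DecPropositional.Properties using (deduplicate-!)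
open import Data.List.Relation.Unary.Any using (here; there)
open import Data.Maybe.Base using (Maybe; just; nothing)
open import Data.Nat.Base
open import Data.Nat.Properties
open import Data.Nat.Solver using (module +-*-Solver)
open import Data.Product.Base using (Σ-syntax; ∃-syntax; _×_; _,_; proj₁; proj₂; map₁; map₂)
open import Data.Sum.Base using (_⊎_; inj₁; inj₂)
import Data.Sum.Base as Sum
open import Data.Sum.Function.Propositional using (_⊎-↔_)
open import Data.Product.Function.NonDependent.Propositional using (_×-↔_)
open import Data.Unit.Base using (⊤; tt)
open import Data.Vec.Base as Vec using (Vec; []; _∷_; replicate; zipWith; take; drop)
import Data.Vec.Properties as Vec
open import Function.Base using (_∘_; id)
open import Function.Bundles using (_↔_; mk↔ₛ′; Inverse; _⇔_; mk⇔; Equivalence)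
open import Function.Properties.Inverse using (↔-sym; ↔-trans; ↔-refl)
open import Relation.Nullary using (Dec; does; yes; no; contradiction)
open import Relation.Nullary.Decidable using (dec-true; dec-false)
open import Relation.Binary.PropositionalEquality hiding ([_])
open import Relation.Unary using (_⊆_; _≐_)

-- Every class speaks of concrete multi-tape machines, so the labour lies in building machines
-- rather than in counting. Machines are therefore written as structured programs with a big-step
-- semantics, and one compilation theorem turns a derivation into an `NPTM` whose accepted outputs
-- are known. From then on only the lists `acceptedOutputs` are compared, in order and with
-- multiplicity.
--
-- The queries on ⟨x,v⟩ are arranged so that their thresholds need no arithmetic: v is the second
-- component of the pair, and 2^k - 1 - v is its bitwise complement, so both are finite-state
-- translations. Strictness in `PP` explains the summand 1 in f(x) + 1 > v. The second query bounds
-- f(x) from above: with exactly 2^k runs, few accepting runs mean many others. The length k is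
-- obtained without evaluating a polynomial, since repeated squaring of a length outgrows every
-- polynomial.
--
-- For the span, one word may be confirmed on several paths because outputs repeat; replacing the
-- confirming machine by a `UP` machine for "at least one path" is what removes this multiplicity.

private variable
  A B C : Set

-- Polynomials

infixl 6 _⊕_
infixl 7 _⊗_ _⊙_

_⊕_ : Polynomial → Polynomial → Polynomial
[]      ⊕ q       = q
(a ∷ p) ⊕ []      = a ∷ p
(a ∷ p) ⊕ (b ∷ q) = (a + b) ∷ (p ⊕ q)

_⊗_ : Polynomial → Polynomial → Polynomial
[]      ⊗ q = []
(a ∷ p) ⊗ q = map (a *_) q ⊕ (0 ∷ p ⊗ q)

_⊙_ : Polynomial → Polynomial → Polynomial
[]      ⊙ q = []
(a ∷ p) ⊙ q = (a ∷ []) ⊕ q ⊗ (p ⊙ q)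

eval-⊕ : ∀ p q n → eval (p ⊕ q) n ≡ eval p n + eval q n
eval-⊕ []      q       n = refl
eval-⊕ (a ∷ p) []      n = sym (+-identityʳ _)
eval-⊕ (a ∷ p) (b ∷ q) n rewrite eval-⊕ p q n =
  solve 5 (λ a b n p q → a :+ b :+ n :* (p :+ q) := a :+ n :* p :+ (b :+ n :* q)) refl
    a b n (eval p n) (eval q n)
  where open +-*-Solver

eval-suc : ∀ p n → eval ((1 ∷ []) ⊕ p) n ≡ suc (eval p n)
eval-suc p n = trans (eval-⊕ (1 ∷ []) p n) (cong (λ k → suc k + eval p n) (*-zeroʳ n))

eval-scale : ∀ a q n → eval (map (a *_) q) n ≡ a * eval q n
eval-scale a []      n = sym (*-zeroʳ a)
eval-scale a (b ∷ q) n rewrite eval-scale a q n =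
  solve 4 (λ a b n q → a :* b :+ n :* (a :* q) := a :* (b :+ n :* q)) refl a b n (eval q n)
  where open +-*-Solver

eval-⊗ : ∀ p q n → eval (p ⊗ q) n ≡ eval p n * eval q n
eval-⊗ []      q n = refl
eval-⊗ (a ∷ p) q n
  rewrite eval-⊕ (map (a *_) q) (0 ∷ p ⊗ q) n | eval-scale a q n | eval-⊗ p q n =
  solve 4 (λ a n p q → a :* q :+ n :* (p :* q) := (a :+ n :* p) :* q) refl
    a n (eval p n) (eval q n)
  where open +-*-Solver

eval-⊙ : ∀ p q n → eval (p ⊙ q) n ≡ eval p (eval q n)
eval-⊙ []      q n = refl
eval-⊙ (a ∷ p) q n
  rewrite eval-⊕ (a ∷ []) (q ⊗ (p ⊙ q)) n | eval-⊗ q (p ⊙ q) n | eval-⊙ p q n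
        | *-zeroʳ n | +-identityʳ a = refl

eval-mono : ∀ p {m n} → m ≤ n → eval p m ≤ eval p n
eval-mono []      m≤n = z≤n
eval-mono (a ∷ p) m≤n = +-monoʳ-≤ a (*-mono-≤ m≤n (eval-mono p m≤n))

-- Running times are kept as plain arithmetic functions, and a coefficient list appears only when an
-- `NPTM` demands one. A bound in place of an equation suffices because the height of a tree may
-- always be raised (`↠-mono`).
PolyBounded : (ℕ → ℕ) → Set
PolyBounded t = Σ[ p ∈ Polynomial ] ∀ n → t n ≤ eval p n

bounded-const : ∀ a → PolyBounded (λ _ → a)
bounded-const a = (a ∷ []) , λ n → m≤m+n a _

bounded-id : PolyBounded (λ n → n)
bounded-id = (0 ∷ 1 ∷ []) , λ n → ≤-reflexive
  (solve 1 (λ n → n := n :* (con 1 :+ n :* con 0)) refl n)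
  where open +-*-Solver

bounded-linear : ∀ a b → PolyBounded (λ n → a + b * n)
bounded-linear a b = (a ∷ b ∷ []) , λ n → ≤-reflexive (cong (a +_)
  (trans (*-comm b n) (cong (n *_) (trans (sym (+-identityʳ b)) (cong (b +_) (sym (*-zeroʳ n)))))))

double-step : ∀ n → 2 + suc (2 * n) ≤ suc (2 * suc n)
double-step n = ≤-reflexive (cong (2 +_) (sym (+-suc n (n + 0))))

triple-step : ∀ n → 3 + suc (3 * n) ≤ suc (3 * suc n)
triple-step n = ≤-reflexive (cong suc (sym (*-suc 3 n)))

bounded-+ : ∀ {t u} → PolyBounded t → PolyBounded u → PolyBounded (λ n → t n + u n)
bounded-+ (p , t≤) (q , u≤) = p ⊕ q , λ n →
  ≤-trans (+-mono-≤ (t≤ n) (u≤ n)) (≤-reflexive (sym (eval-⊕ p q n)))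

bounded-* : ∀ {t u} → PolyBounded t → PolyBounded u → PolyBounded (λ n → t n * u n)
bounded-* (p , t≤) (q , u≤) = p ⊗ q , λ n →
  ≤-trans (*-mono-≤ (t≤ n) (u≤ n)) (≤-reflexive (sym (eval-⊗ p q n)))

bounded-∘ : ∀ {t u} → PolyBounded t → PolyBounded u → PolyBounded (t ∘ u)
bounded-∘ (p , t≤) (q , u≤) = p ⊙ q , λ n → ≤-trans (t≤ _)
  (≤-trans (eval-mono p (u≤ n)) (≤-reflexive (sym (eval-⊙ p q n))))

-- Finite types

finite-⊥ : Finite ⊥
finite-⊥ = 0 , ↔-sym 0↔⊥

finite-⊤ : Finite ⊤
finite-⊤ = 1 , ↔-sym 1↔⊤

finite-Bool : Finite Bool
finite-Bool = 2 , ↔-sym 2↔Bool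

finite-Fin : ∀ {n} → Finite (Fin n)
finite-Fin {n} = n , ↔-refl

finite-⊎ : Finite A → Finite B → Finite (A ⊎ B)
finite-⊎ (m , f) (n , g) = m + n , ↔-trans (f ⊎-↔ g) (↔-sym +↔⊎)

finite-× : Finite A → Finite B → Finite (A × B)
finite-× (m , f) (n , g) = m * n , ↔-trans (f ×-↔ g) (↔-sym *↔×)

-- Computation trees

filter-++ᵇ : ∀ (P : A → Bool) xs ys → filterᵇ P (xs ++ ys) ≡ filterᵇ P xs ++ filterᵇ P ys
filter-++ᵇ P []       ys = refl
filter-++ᵇ P (x ∷ xs) ys with P x
... | true  = cong (x ∷_) (filter-++ᵇ P xs ys)
... | false = filter-++ᵇ P xs ys

filter-map : ∀ (P : A → Bool) (f : B → A) xs → filterᵇ P (map f xs) ≡ map f (filterᵇ (P ∘ f) xs)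
filter-map P f []       = refl
filter-map P f (x ∷ xs) with P (f x)
... | true  = cong (f x ∷_) (filter-map P f xs)
... | false = filter-map P f xs

filter-true : ∀ (xs : List A) → filterᵇ (λ _ → true) xs ≡ xs
filter-true []       = refl
filter-true (x ∷ xs) = cong (x ∷_) (filter-true xs)

-- c ↠[ n ] ls: the computation tree below c has height at most n, and ls
-- lists its good leaves from left to right.
module Tree {C : Set} (next : C → List C) (good : C → Bool) where

  mutual
    data _↠[_]_ (c : C) : ℕ → List C → Set where
      halt : ∀ {n ls} → next c ≡ [] → filterᵇ good [ c ] ≡ ls → c ↠[ n ] ls
      move : ∀ {n ls d ds} → next c ≡ d ∷ ds → (d ∷ ds) ↠*[ n ] ls → c ↠[ suc n ] ls

    data _↠*[_]_ : List C → ℕ → List C → Set where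
      []  : ∀ {n} → [] ↠*[ n ] []
      _∷_ : ∀ {n c cs ls ks} → c ↠[ n ] ls → cs ↠*[ n ] ks → (c ∷ cs) ↠*[ n ] (ls ++ ks)

  mutual
    ↠-mono : ∀ {m n c ls} → m ≤ n → c ↠[ m ] ls → c ↠[ n ] ls
    ↠-mono m≤n       (halt e f) = halt e f
    ↠-mono (s≤s m≤n) (move e r) = move e (↠*-mono m≤n r)

    ↠*-mono : ∀ {m n cs ls} → m ≤ n → cs ↠*[ m ] ls → cs ↠*[ n ] ls
    ↠*-mono m≤n []       = []
    ↠*-mono m≤n (r ∷ rs) = ↠-mono m≤n r ∷ ↠*-mono m≤n rs

  -- `move` demands a successor, whereas a failed `guard` leaves none. A configuration that is not
  -- good contributes no leaf of its own, so both situations can be treated alike.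
  expand : ∀ {n c cs ls} → good c ≡ false → next c ≡ cs → cs ↠*[ n ] ls → c ↠[ suc n ] ls
  expand {c = c} bad e [] = halt e lemma
    where
    lemma : filterᵇ good [ c ] ≡ []
    lemma rewrite bad = refl
  expand bad e (r ∷ rs) = move e (r ∷ rs)

  split : ∀ {n} xs {ys ls} → (xs ++ ys) ↠*[ n ] ls →
          ∃[ ls₁ ] ∃[ ls₂ ] (ls ≡ ls₁ ++ ls₂ × xs ↠*[ n ] ls₁ × ys ↠*[ n ] ls₂)
  split []       r        = [] , _ , refl , [] , r
  split (x ∷ xs) (_∷_ {ls = ls} r rs) with split xs rs
  ... | ls₁ , ls₂ , refl , rs₁ , rs₂ = ls ++ ls₁ , ls₂ , sym (++-assoc ls ls₁ ls₂) , r ∷ rs₁ , rs₂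

module Machines (M : Machine) (good : Run.Config M → Bool) where
  open Run M
  open Tree successors good

  mutual
    -- A single derivation supplies both the `halts` field of an `NPTM` and its list of paths; every
    -- machine below is thus analysed by exhibiting a tree.
    sound : ∀ {n c ls} → c ↠[ n ] ls → HaltsWithin n c × filterᵇ good (leaves n c) ≡ ls
    sound {zero}  (halt e f) = e , f
    sound {suc n} (halt e f) rewrite e = [] , f
    sound {suc n} {c} (move e r) rewrite e = sound* r

    sound* : ∀ {n cs ls} → cs ↠*[ n ] ls →
             All (HaltsWithin n) cs × filterᵇ good (concatMap (leaves n) cs) ≡ ls
    sound* []       = [] , refl
    sound* {n} {c ∷ cs} (r ∷ rs) with sound r | sound* rs
    ... | h , e | hs , es = h ∷ hs ,
      trans (filter-++ᵇ good (leaves n c) (concatMap (leaves n) cs)) (cong₂ _++_ e es)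

  mutual
    complete : ∀ n c → HaltsWithin n c → c ↠[ n ] filterᵇ good (leaves n c)
    complete zero    c h = halt h refl
    complete (suc n) c h with successors c in eq
    ... | []     = halt eq refl
    ... | d ∷ ds = move eq (complete* n (d ∷ ds) h)

    complete* : ∀ n cs → All (HaltsWithin n) cs →
                cs ↠*[ n ] filterᵇ good (concatMap (leaves n) cs)
    complete* n []       []       = []
    complete* n (c ∷ cs) (h ∷ hs)
      rewrite filter-++ᵇ good (leaves n c) (concatMap (leaves n) cs) =
      complete n c h ∷ complete* n cs hs

-- `α` is a functional bisimulation: it commutes with the successor lists, so trees transfer in both
-- directions with the same height. `backward` serves where the tree is known only for the image, as
-- for compiled programs, whose tapes are described only up to trailing blanks.
module Simulation
  {C C′ : Set} (next : C → List C) (next′ : C′ → List C′)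
  (good : C → Bool) (good′ : C′ → Bool) (α : C → C′)
  (next-α : ∀ c → next′ (α c) ≡ map α (next c))
  (good-α : ∀ c → good′ (α c) ≡ good c) where

  open Tree next good
  open Tree next′ good′ using () renaming (_↠[_]_ to _↠′[_]_; _↠*[_]_ to _↠′*[_]_)
  module T′ = Tree next′ good′

  filter-α : ∀ c → filterᵇ good′ [ α c ] ≡ map α (filterᵇ good [ c ])
  filter-α c rewrite good-α c with good c
  ... | true  = refl
  ... | false = refl

  mutual
    forward : ∀ {n c ls} → c ↠[ n ] ls → α c ↠′[ n ] map α ls
    forward {c = c} (halt e f) =
      T′.halt (trans (next-α c) (cong (map α) e)) (trans (filter-α c) (cong (map α) f))
    forward {c = c} (move e r) =
      T′.move (trans (next-α c) (cong (map α) e)) (forward* r)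

    forward* : ∀ {n cs ls} → cs ↠*[ n ] ls → map α cs ↠′*[ n ] map α ls
    forward* []       = T′.[]
    forward* (_∷_ {ls = ls} {ks} r rs) rewrite map-++ α ls ks = forward r T′.∷ forward* rs

  mutual
    backward : ∀ {n ls′} c → α c ↠′[ n ] ls′ → ∃[ ls ] (c ↠[ n ] ls × map α ls ≡ ls′)
    backward c (T′.halt e f) with next c in eq | trans (sym (next-α c)) e
    ... | [] | _ = _ , halt eq refl , trans (sym (filter-α c)) f
    backward c (T′.move e r) with next c in eq | trans (sym (next-α c)) e
    ... | d ∷ ds | refl with backward* (d ∷ ds) r
    ...   | ls , rs , q = ls , move eq rs , q

    backward* : ∀ {n ls′} cs → map α cs ↠′*[ n ] ls′ → ∃[ ls ] (cs ↠*[ n ] ls × map α ls ≡ ls′)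
    backward* []       T′.[]       = [] , [] , refl
    backward* (c ∷ cs) (r T′.∷ rs) with backward c r | backward* cs rs
    ... | ls , q , refl | ks , qs , refl = ls ++ ks , q ∷ qs , map-++ α ls ks

-- Tapes that differ only in trailing blanks behave alike; without trailing
-- blanks, a rewound tape is literally equal to a fresh input tape.

consᵗ : Symbol A → List (Symbol A) → List (Symbol A)
consᵗ blank   []      = []
consᵗ blank   (b ∷ l) = blank ∷ b ∷ l
consᵗ (bit b) l       = bit b ∷ l
consᵗ (aux g) l       = aux g ∷ l

shiftᵗ : Direction → Tape A → Tape A
shiftᵗ stay  t                  = t
shiftᵗ left  (tape []      a r) = tape [] blank (consᵗ a r)
shiftᵗ left  (tape (b ∷ l) a r) = tape l b (consᵗ a r)
shiftᵗ right (tape l a [])      = tape (consᵗ a l) blank []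
shiftᵗ right (tape l a (b ∷ r)) = tape (consᵗ a l) b r

actᵗ : Symbol A × Direction → Tape A → Tape A
actᵗ (a , d) (tape l _ r) = shiftᵗ d (tape l a r)

trim : (Symbol A → Symbol B) → List (Symbol A) → List (Symbol B)
trim f []      = []
trim f (a ∷ l) = consᵗ (f a) (trim f l)

-- Trimming and a change of alphabet in one map: `view id` only trims, while the decoders of
-- compiled machines also retype the symbols.
view : (Symbol A → Symbol B) → Tape A → Tape B
view f (tape l a r) = tape (trim f l) (f a) (trim f r)

shiftᵗ-left : ∀ b l a (r : List (Symbol A)) →
              shiftᵗ left (tape (consᵗ b l) a r) ≡ tape l b (consᵗ a r)
shiftᵗ-left blank   []      a r = refl
shiftᵗ-left blank   (_ ∷ _) a r = refl
shiftᵗ-left (bit _) l       a r = refl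
shiftᵗ-left (aux _) l       a r = refl

shiftᵗ-right : ∀ b l a (r : List (Symbol A)) →
               shiftᵗ right (tape l a (consᵗ b r)) ≡ tape (consᵗ a l) b r
shiftᵗ-right blank   l a []      = refl
shiftᵗ-right blank   l a (_ ∷ _) = refl
shiftᵗ-right (bit _) l a r       = refl
shiftᵗ-right (aux _) l a r       = refl

view-shift : ∀ (f : Symbol A → Symbol B) → f blank ≡ blank →
             ∀ d t → view f (shift d t) ≡ shiftᵗ d (view f t)
view-shift f e stay  t                  = refl
view-shift f e left  (tape []      a r) rewrite e = refl
view-shift f e left  (tape (b ∷ l) a r) = sym (shiftᵗ-left (f b) (trim f l) (f a) (trim f r))
view-shift f e right (tape l a [])      rewrite e = refl
view-shift f e right (tape l a (b ∷ r)) = sym (shiftᵗ-right (f b) (trim f l) (f a) (trim f r))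

view-act : ∀ (f : Symbol A → Symbol B) → f blank ≡ blank →
           ∀ a d t → view f (act (a , d) t) ≡ actᵗ (f a , d) (view f t)
view-act f e a d (tape l _ r) = view-shift f e d (tape l a r)

trim-bits : ∀ (f : Symbol A → Symbol B) → (∀ b → f (bit b) ≡ bit b) →
            ∀ w → trim f (map bit w) ≡ map bit w
trim-bits f e []      = refl
trim-bits f e (b ∷ w) rewrite e b = cong (bit b ∷_) (trim-bits f e w)

view-input : ∀ (f : Symbol A → Symbol B) → f blank ≡ blank → (∀ b → f (bit b) ≡ bit b) →
             ∀ w → view f (inputTape w) ≡ inputTape w
view-input f e e′ []      rewrite e = refl
view-input f e e′ (b ∷ w) rewrite e′ b = cong (tape [] (bit b)) (trim-bits f e′ w)

module Trimmed (M : Machine) where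
  open Machine M
  open Run M

  applyᵗ : Config → Move State Aux (suc extra) → Config
  applyᵗ (config _ ts w) m =
    config target (zipWith actᵗ actions ts) (w ++ fromMaybe emitted)
    where open Move m

  successorsᵗ : Config → List Config
  successorsᵗ c = map (applyᵗ c) (δ (state c) (Vec.map Tape.head (tapes c)))

  trimmed : Config → Config
  trimmed (config q ts w) = config q (Vec.map (view id) ts) w

  trimmed-apply : ∀ c m → applyᵗ (trimmed c) m ≡ trimmed (apply c m)
  trimmed-apply (config q ts w) m = cong (λ ts → config target ts (w ++ fromMaybe emitted)) (lemma actions ts)
    where
    open Move m
    lemma : ∀ {k} (as : Vec _ k) (ts : Vec (Tape Aux) k) →
            zipWith actᵗ as (Vec.map (view id) ts) ≡ Vec.map (view id) (zipWith act as ts)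
    lemma []             []       = refl
    lemma ((a , d) ∷ as) (t ∷ ts) = cong₂ _∷_ (sym (view-act id refl a d t)) (lemma as ts)

  heads-trimmed : ∀ {k} (ts : Vec (Tape Aux) k) →
                  Vec.map Tape.head (Vec.map (view id) ts) ≡ Vec.map Tape.head ts
  heads-trimmed []       = refl
  heads-trimmed (t ∷ ts) = cong (_ ∷_) (heads-trimmed ts)

  successors-trimmed : ∀ c → successorsᵗ (trimmed c) ≡ map trimmed (successors c)
  successors-trimmed c rewrite heads-trimmed (tapes c) =
    trans (map-cong (trimmed-apply c) (δ (state c) _)) (map-∘ (δ (state c) _))

  trimmed-initial : ∀ x → trimmed (initial x) ≡ initial x
  trimmed-initial x = cong (λ ts → config start ts []) (cong₂ _∷_ (view-input id refl (λ _ → refl) x)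
    (Vec.map-replicate (view id) emptyTape extra))

-- A language of structured programs

-- Two groups of tapes with separate alphabets, because the composition of two machines carries the
-- tapes of both. The input tape lies in the first group, hence `suc k₁`.
module Program (D Γ₁ Γ₂ : Set) (k₁ k₂ : ℕ) where

  record Store : Set where
    constructor store
    field
      register : D
      tapes₁   : Vec (Tape Γ₁) (suc k₁)
      tapes₂   : Vec (Tape Γ₂) k₂
      written  : Word
  open Store public

  record Effect : Set where
    constructor effect
    field
      register′ : D
      actions₁  : Vec (Symbol Γ₁ × Direction) (suc k₁)
      actions₂  : Vec (Symbol Γ₂ × Direction) k₂
      emission  : Maybe Bit
  open Effect public

  Scan : Set → Set
  Scan R = D → Vec (Symbol Γ₁) (suc k₁) → Vec (Symbol Γ₂) k₂ → R

  scan : ∀ {R} → Scan R → Store → R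
  scan f (store d ts us o) = f d (Vec.map Tape.head ts) (Vec.map Tape.head us)

  perform : Store → Effect → Store
  perform (store _ ts us o) (effect d as bs e) =
    store d (zipWith actᵗ as ts) (zipWith actᵗ bs us) (o ++ fromMaybe e)

  data Prog : Set where
    atom  : Scan (List Effect) → Prog
    _⨾_   : Prog → Prog → Prog
    while : Scan Bool → Prog → Prog

  infixr 5 _⨾_

  mutual
    -- Nondeterminism is a list of final stores, one per surviving run and in the order of the
    -- paths. The number bounds the duration of every run; runs of different duration share one
    -- bound by `relax`.
    data _⊢_⇓[_]_ : Prog → Store → ℕ → List Store → Set where
      atom  : ∀ {i s} → atom i ⊢ s ⇓[ 1 ] map (perform s) (scan i s)
      seq   : ∀ {p q s m n ss ts} → p ⊢ s ⇓[ m ] ss → q ⊢* ss ⇓[ n ] ts → (p ⨾ q) ⊢ s ⇓[ m + n ] ts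
      stop  : ∀ {t p s} → scan t s ≡ false → while t p ⊢ s ⇓[ 1 ] [ s ]
      loop  : ∀ {t p s m n ss ts} → scan t s ≡ true → p ⊢ s ⇓[ m ] ss → while t p ⊢* ss ⇓[ n ] ts →
              while t p ⊢ s ⇓[ suc (m + n) ] ts
      relax : ∀ {p s m n ss} → m ≤ n → p ⊢ s ⇓[ m ] ss → p ⊢ s ⇓[ n ] ss

    data _⊢*_⇓[_]_ : Prog → List Store → ℕ → List Store → Set where
      []  : ∀ {p n} → p ⊢* [] ⇓[ n ] []
      _∷_ : ∀ {p n s ss ts us} → p ⊢ s ⇓[ n ] ts → p ⊢* ss ⇓[ n ] us → p ⊢* (s ∷ ss) ⇓[ n ] (ts ++ us)

  idle : D → Vec (Symbol Γ₁) (suc k₁) → Vec (Symbol Γ₂) k₂ → Effect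
  idle d h g = effect d (Vec.map (_, stay) h) (Vec.map (_, stay) g) nothing

  PC : Prog → Set
  PC (atom _)    = ⊤
  PC (p ⨾ q)     = PC p ⊎ PC q
  PC (while _ p) = ⊤ ⊎ PC p

  -- inj₁ tt is the end of the program.
  Point : Prog → Set
  Point p = ⊤ ⊎ PC p

  entry : ∀ p → PC p
  entry (atom _)    = tt
  entry (p ⨾ q)     = inj₁ (entry p)
  entry (while _ p) = inj₁ tt

  finite-PC : ∀ p → Finite (PC p)
  finite-PC (atom _)    = finite-⊤
  finite-PC (p ⨾ q)     = finite-⊎ (finite-PC p) (finite-PC q)
  finite-PC (while _ p) = finite-⊎ finite-⊤ (finite-PC p)

  andThen : ∀ p q → Point p → Point (p ⨾ q)
  andThen p q = Sum.[ (λ _ → inj₂ (inj₂ (entry q))) , inj₂ ∘ inj₁ ]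

  again : ∀ t p → Point p → Point (while t p)
  again t p = Sum.[ (λ _ → inj₂ (inj₁ tt)) , inj₂ ∘ inj₂ ]

  step : ∀ p → PC p → Scan (List (Point p × Effect))
  step (atom i)    tt        d h g = map (inj₁ tt ,_) (i d h g)
  step (p ⨾ q)     (inj₁ c)  d h g = map (map₁ (andThen p q)) (step p c d h g)
  step (p ⨾ q)     (inj₂ c)  d h g = map (map₁ (Sum.map₂ inj₂)) (step q c d h g)
  step (while t p) (inj₁ tt) d h g =
    [ ((if t d h g then inj₂ (inj₂ (entry p)) else inj₁ tt) , idle d h g) ]
  step (while t p) (inj₂ c)  d h g = map (map₁ (again t p)) (step p c d h g)

  steps : ∀ p → Point p → Scan (List (Point p × Effect))
  steps p (inj₁ tt) d h g = []
  steps p (inj₂ c)  d h g = step p c d h g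

  finished : ∀ {p} → Point p × Store → Bool
  finished = Sum.[ (λ _ → true) , (λ _ → false) ] ∘ proj₁

  follow : ∀ {P : Set} → Store → P × Effect → P × Store
  follow s (c , e) = c , perform s e

  nexts : ∀ p → Point p × Store → List (Point p × Store)
  nexts p (c , s) = map (follow s) (scan (steps p c) s)

  keep-heads : ∀ {Γ k} (ts : Vec (Tape Γ) k) → zipWith actᵗ (Vec.map (_, stay) (Vec.map Tape.head ts)) ts ≡ ts
  keep-heads []       = refl
  keep-heads (t ∷ ts) = cong (t ∷_) (keep-heads ts)

  perform-idle : ∀ s → perform s (scan idle s) ≡ s
  perform-idle (store d ts us o)
    rewrite keep-heads ts | keep-heads us | ++-identityʳ o = refl

  module Correct (P : Prog) where
    open Tree (nexts P) (finished {P})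

    -- `κ` places the points of a subprogram among those of `P`; the end of the subprogram goes to
    -- the point where `P` resumes. By `running`, the interior of the subprogram never coincides
    -- with the end of `P`, so it contributes no leaves.
    record Context (p : Prog) (κ : Point p → Point P) : Set where
      field
        step-κ : ∀ c d h g → steps P (κ (inj₂ c)) d h g ≡ map (map₁ κ) (step p c d h g)
        running : ∀ c s → finished {P} (κ (inj₂ c) , s) ≡ false
    open Context

    nexts-κ : ∀ {p κ} → Context p κ → ∀ c s →
              nexts P (κ (inj₂ c) , s) ≡ map (follow s ∘ map₁ κ) (scan (step p c) s)
    nexts-κ {p} ctx c (store d ts us o) =
      trans (cong (map _) (step-κ ctx c d _ _)) (sym (map-∘ (step p c d _ _)))

    seq-first : ∀ {p q κ} → Context (p ⨾ q) κ → Context p (κ ∘ andThen p q)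
    seq-first {p} {q} {κ} ctx .step-κ c d h g = trans (step-κ ctx (inj₁ c) d h g) (sym (map-∘ (step p c d h g)))
    seq-first ctx .running c s = running ctx (inj₁ c) s

    seq-second : ∀ {p q κ} → Context (p ⨾ q) κ → Context q (κ ∘ Sum.map₂ inj₂)
    seq-second {p} {q} {κ} ctx .step-κ c d h g = trans (step-κ ctx (inj₂ c) d h g) (sym (map-∘ (step q c d h g)))
    seq-second ctx .running c s = running ctx (inj₂ c) s

    loop-body : ∀ {t p κ} → Context (while t p) κ → Context p (κ ∘ again t p)
    loop-body {t} {p} {κ} ctx .step-κ c d h g = trans (step-κ ctx (inj₂ c) d h g) (sym (map-∘ (step p c d h g)))
    loop-body ctx .running c s = running ctx (inj₂ c) s

    mutual
      -- Continuation-passing form: a tree below the final stores, placed at the resumption point,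
      -- extends to a tree below the entry with the same leaves. Sequencing and looping then become
      -- nested calls, and the times add up.
      run : ∀ {p s n ss m ls κ} → p ⊢ s ⇓[ n ] ss → Context p κ →
            map (κ (inj₁ tt) ,_) ss ↠*[ m ] ls → (κ (inj₂ (entry p)) , s) ↠[ n + m ] ls
      run {s = s} {κ = κ} (atom {i}) ctx k =
        expand (running ctx tt s)
          (trans (nexts-κ ctx tt s) (trans (sym (map-∘ (scan i s))) (map-∘ (scan i s)))) k
      run {m = k} {κ = κ} (seq {m = m} {n} r rs) ctx c rewrite +-assoc m n k =
        run r (seq-first ctx) (run* rs (seq-second ctx) c)
      run {s = s} {κ = κ} (stop {t} {p} e) ctx k = expand (running ctx (inj₁ tt) s)
        (trans (nexts-κ ctx (inj₁ tt) s) lemma) k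
        where
        lemma : map (follow s ∘ map₁ κ) (scan (step (while t p) (inj₁ tt)) s) ≡ [ (κ (inj₁ tt) , s) ]
        lemma rewrite e | perform-idle s = refl
      run {s = s} {m = k} {κ = κ} (loop {t} {p} {m = m} {n} e r rs) ctx c rewrite +-assoc m n k =
        expand (running ctx (inj₁ tt) s) (trans (nexts-κ ctx (inj₁ tt) s) lemma)
          (single (run r (loop-body ctx) (run* rs ctx c)))
        where
        lemma : map (follow s ∘ map₁ κ) (scan (step (while t p) (inj₁ tt)) s) ≡ [ (κ (inj₂ (inj₂ (entry p))) , s) ]
        lemma rewrite e | perform-idle s = refl
        single : ∀ {c n ls} → c ↠[ n ] ls → [ c ] ↠*[ n ] ls
        single {ls = ls} r = subst ([ _ ] ↠*[ _ ]_) (++-identityʳ ls) (r ∷ [])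
      run (relax m≤n r) ctx c = ↠-mono (+-monoˡ-≤ _ m≤n) (run r ctx c)

      run* : ∀ {p ss n ts m ls κ} → p ⊢* ss ⇓[ n ] ts → Context p κ →
             map (κ (inj₁ tt) ,_) ts ↠*[ m ] ls → map (κ (inj₂ (entry p)) ,_) ss ↠*[ n + m ] ls
      run* [] ctx [] = []
      run* {κ = κ} (_∷_ {ts = ts} {us} r rs) ctx c
        with split (map (κ (inj₁ tt) ,_) ts) (subst (_↠*[ _ ] _) (map-++ _ ts us) c)
      ... | _ , _ , refl , c₁ , c₂ = run r ctx c₁ ∷ run* rs ctx c₂

-- Determinism of programs

module Determinism (D Γ₁ Γ₂ : Set) (k₁ k₂ : ℕ) where
  open Program D Γ₁ Γ₂ k₁ k₂

  -- Tests and jumps never branch, so only the atoms matter.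
  Det : Prog → Set
  Det (atom i)    = ∀ d h g → length (i d h g) ≤ 1
  Det (p ⨾ q)     = Det p × Det q
  Det (while t p) = Det p

  map-≤ : ∀ {f : A → B} {n} xs → length xs ≤ n → length (map f xs) ≤ n
  map-≤ {f = f} xs = ≤-trans (≤-reflexive (length-map f xs))

  step-det : ∀ p → Det p → ∀ c d h g → length (step p c d h g) ≤ 1
  step-det (atom i)    h         tt        d a g = map-≤ (i d a g) (h d a g)
  step-det (p ⨾ q)     (hp , hq) (inj₁ c)  d a g = map-≤ (step p c d a g) (step-det p hp c d a g)
  step-det (p ⨾ q)     (hp , hq) (inj₂ c)  d a g = map-≤ (step q c d a g) (step-det q hq c d a g)
  step-det (while t p) h         (inj₁ tt) d a g = ≤-refl
  step-det (while t p) h         (inj₂ c)  d a g = map-≤ (step p c d a g) (step-det p h c d a g)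

  steps-det : ∀ p → Det p → ∀ c d h g → length (steps p c d h g) ≤ 1
  steps-det p h (inj₁ tt) d a g = z≤n
  steps-det p h (inj₂ c)  d a g = step-det p h c d a g

-- Compilation of programs to Turing machines

module Compile {D Γ₁ Γ₂ : Set} {k₁ k₂ : ℕ}
  (finite-D : Finite D) (finite-Γ₁ : Finite Γ₁) (finite-Γ₂ : Finite Γ₂) where

  open Program D Γ₁ Γ₂ k₁ k₂

  Γ : Set
  Γ = Γ₁ ⊎ Γ₂

  -- The value on symbols of the other group is arbitrary, since the encoders never write them on
  -- these tapes; only blanks and encoded symbols have to be decoded correctly.
  decode₁ : Symbol Γ → Symbol Γ₁
  decode₁ (aux (inj₁ g)) = aux g
  decode₁ (aux (inj₂ _)) = blank
  decode₁ (bit b)        = bit b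
  decode₁ blank          = blank

  decode₂ : Symbol Γ → Symbol Γ₂
  decode₂ (aux (inj₁ _)) = blank
  decode₂ (aux (inj₂ g)) = aux g
  decode₂ (bit b)        = bit b
  decode₂ blank          = blank

  encode₁ : Symbol Γ₁ → Symbol Γ
  encode₁ (aux g) = aux (inj₁ g)
  encode₁ (bit b) = bit b
  encode₁ blank   = blank

  encode₂ : Symbol Γ₂ → Symbol Γ
  encode₂ (aux g) = aux (inj₂ g)
  encode₂ (bit b) = bit b
  encode₂ blank   = blank

  decode₁-encode₁ : ∀ a → decode₁ (encode₁ a) ≡ a
  decode₁-encode₁ (aux g) = refl
  decode₁-encode₁ (bit b) = refl
  decode₁-encode₁ blank   = refl

  decode₂-encode₂ : ∀ a → decode₂ (encode₂ a) ≡ a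
  decode₂-encode₂ (aux g) = refl
  decode₂-encode₂ (bit b) = refl
  decode₂-encode₂ blank   = refl

  module _ (p : Prog) (d₀ : D) where

    toMove : Point p × Effect → Move (Point p × D) Γ (suc k₁ + k₂)
    toMove (c , effect d as bs e) = record
      { target  = c , d
      ; actions = Vec.map (map₁ encode₁) as Vec.++ Vec.map (map₁ encode₂) bs
      ; emitted = e
      }

    alternatives : Point p × D → Vec (Symbol Γ) (suc k₁ + k₂) → List (Point p × Effect)
    alternatives (c , d) h =
      steps p c d (Vec.map decode₁ (take (suc k₁) h)) (Vec.map decode₂ (drop (suc k₁) h))

    compile : Machine
    compile = record
      { State     = Point p × D
      ; Aux       = Γ
      ; State-fin = finite-× (finite-⊎ finite-⊤ (finite-PC p)) finite-D
      ; Aux-fin   = finite-⊎ finite-Γ₁ finite-Γ₂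
      ; extra     = k₁ + k₂
      ; start     = inj₂ (entry p) , d₀
      ; accepting = λ (c , d) → Sum.[ (λ _ → true) , (λ _ → false) ] c
      ; δ         = λ q h → map toMove (alternatives q h)
      }

    open Run compile

    decodeTapes₁ : Vec (Tape Γ) (suc k₁ + k₂) → Vec (Tape Γ₁) (suc k₁)
    decodeTapes₁ ts = Vec.map (view decode₁) (take (suc k₁) ts)

    decodeTapes₂ : Vec (Tape Γ) (suc k₁ + k₂) → Vec (Tape Γ₂) k₂
    decodeTapes₂ ts = Vec.map (view decode₂) (drop (suc k₁) ts)

    abstraction : Config → Point p × Store
    abstraction (config (c , d) ts o) = c , store d (decodeTapes₁ ts) (decodeTapes₂ ts) o

    act-decode : ∀ {Γ′ : Set} (dec : Symbol Γ → Symbol Γ′) (enc : Symbol Γ′ → Symbol Γ) →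
      dec blank ≡ blank → (∀ a → dec (enc a) ≡ a) → ∀ {k} (as : Vec (Symbol Γ′ × Direction) k) ts →
      Vec.map (view dec) (zipWith act (Vec.map (map₁ enc) as) ts) ≡ zipWith actᵗ as (Vec.map (view dec) ts)
    act-decode dec enc e f []             []       = refl
    act-decode dec enc e f ((a , m) ∷ as) (t ∷ ts) = cong₂ _∷_
      (trans (view-act dec e (enc a) m t) (cong (λ a → actᵗ (a , m) (view dec t)) (f a)))
      (act-decode dec enc e f as ts)

    take-++ : ∀ {m n} (xs : Vec A m) (ys : Vec A n) → take m (xs Vec.++ ys) ≡ xs
    take-++ []       ys = refl
    take-++ (x ∷ xs) ys = cong (x ∷_) (take-++ xs ys)

    drop-++ : ∀ {m n} (xs : Vec A m) (ys : Vec A n) → drop m (xs Vec.++ ys) ≡ ys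
    drop-++ []       ys = refl
    drop-++ (x ∷ xs) ys = drop-++ xs ys

    abstraction-apply : ∀ c ts o (s : Store) e → abstraction (config (c , register s) ts o) ≡ (c , s) →
      ∀ c′ → abstraction (apply (config (c , register s) ts o) (toMove (c′ , e))) ≡ (c′ , perform s e)
    abstraction-apply c ts o s (effect d as bs e) refl c′ =
      cong (c′ ,_) (cong₂ (λ ts us → store d ts us (o ++ fromMaybe e)) lemma₁ lemma₂)
      where
      both = Vec.map (map₁ encode₁) as Vec.++ Vec.map (map₁ encode₂) bs
      lemma₁ : decodeTapes₁ (zipWith act both ts) ≡ zipWith actᵗ as (decodeTapes₁ ts)
      lemma₁ rewrite Vec.take-zipWith {m = suc k₁} act both ts
                   | take-++ (Vec.map (map₁ encode₁) as) (Vec.map (map₁ encode₂) bs) =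
        act-decode decode₁ encode₁ refl decode₁-encode₁ as (take (suc k₁) ts)
      lemma₂ : decodeTapes₂ (zipWith act both ts) ≡ zipWith actᵗ bs (decodeTapes₂ ts)
      lemma₂ rewrite Vec.drop-zipWith {m = suc k₁} act both ts
                   | drop-++ (Vec.map (map₁ encode₁) as) (Vec.map (map₁ encode₂) bs) =
        act-decode decode₂ encode₂ refl decode₂-encode₂ bs (drop (suc k₁) ts)

    heads-view : ∀ {Γ′ : Set} (dec : Symbol Γ → Symbol Γ′) {k} (ts : Vec (Tape Γ) k) →
      Vec.map Tape.head (Vec.map (view dec) ts) ≡ Vec.map dec (Vec.map Tape.head ts)
    heads-view dec []       = refl
    heads-view dec (t ∷ ts) = cong (_ ∷_) (heads-view dec ts)

    nexts-abstraction : ∀ c → nexts p (abstraction c) ≡ map abstraction (successors c)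
    nexts-abstraction (config (c , d) ts o) =
      trans (cong₂ (λ h g → map (follow (store d (decodeTapes₁ ts) (decodeTapes₂ ts) o)) (steps p c d h g)) heads₁ heads₂)
        (trans (map-cong (λ (c′ , e) → sym (abstraction-apply c ts o (store d (decodeTapes₁ ts) (decodeTapes₂ ts) o) e refl c′)) as)
          (trans (map-∘ as) (map-∘ (map toMove as))))
      where
      as = alternatives (c , d) (Vec.map Tape.head ts)
      heads₁ : Vec.map Tape.head (decodeTapes₁ ts) ≡ Vec.map decode₁ (take (suc k₁) (Vec.map Tape.head ts))
      heads₁ = trans (heads-view decode₁ (take (suc k₁) ts))
        (cong (Vec.map decode₁) (sym (Vec.take-map Tape.head (suc k₁) ts)))
      heads₂ : Vec.map Tape.head (decodeTapes₂ ts) ≡ Vec.map decode₂ (drop (suc k₁) (Vec.map Tape.head ts))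
      heads₂ = trans (heads-view decode₂ (drop (suc k₁) ts))
        (cong (Vec.map decode₂) (sym (Vec.drop-map Tape.head (suc k₁) ts)))

    initialStore : Word → Store
    initialStore x = store d₀ (inputTape x ∷ replicate k₁ emptyTape) (replicate k₂ emptyTape) []

    abstraction-initial : ∀ x → abstraction (initial x) ≡ (inj₂ (entry p) , initialStore x)
    abstraction-initial x = cong (inj₂ (entry p) ,_) (cong₂ (λ ts us → store d₀ ts us [])
      (cong₂ _∷_ (view-input decode₁ refl (λ _ → refl) x) (lemma₁ k₁)) (lemma₂ k₁))
      where
      lemma₁ : ∀ k → Vec.map (view decode₁) (take k (replicate (k + k₂) emptyTape)) ≡ replicate k emptyTape
      lemma₁ zero    = refl
      lemma₁ (suc k) = cong (emptyTape ∷_) (lemma₁ k)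
      lemma₂ : ∀ k → Vec.map (view decode₂) (drop k (replicate (k + k₂) emptyTape)) ≡ replicate k₂ emptyTape
      lemma₂ zero    = Vec.map-replicate (view decode₂) emptyTape k₂
      lemma₂ (suc k) = lemma₂ k

    compile-deterministic : Determinism.Det D Γ₁ Γ₂ k₁ k₂ p → Deterministic compile
    compile-deterministic det (c , d) h = map-≤ (alternatives (c , d) h)
      (steps-det p det c d (Vec.map decode₁ (take (suc k₁) h)) (Vec.map decode₂ (drop (suc k₁) h)))
      where open Determinism D Γ₁ Γ₂ k₁ k₂

    open Correct p
    open Tree (nexts p) (finished {p}) using (_↠[_]_; _↠*[_]_; halt; []; _∷_)

    whole : Context p id
    whole = record
      { step-κ  = λ c d h g → sym (map-id (step p c d h g))
      ; running = λ c s → refl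
      }

    ends : ∀ ss → map (inj₁ tt ,_) ss ↠*[ 0 ] map (inj₁ tt ,_) ss
    ends []       = []
    ends (s ∷ ss) = halt refl refl ∷ ends ss

    module _ {t : ℕ → ℕ} (bounded : PolyBounded t) {results : Word → List Store}
      (evaluation : ∀ x → p ⊢ initialStore x ⇓[ t (length x) ] results x) where

      open Machines compile isAccepting using (sound)
      open Simulation successors (nexts p) isAccepting (finished {p}) abstraction
        nexts-abstraction (λ _ → refl) using (backward)
      open Tree successors isAccepting using (↠-mono) renaming (_↠[_]_ to _⇝[_]_)

      -- The derivation gives a tree of abstract configurations, which is pulled back along
      -- `abstraction`. The actual tapes are never described; only the outputs of the leaves are
      -- needed, and `abstraction` preserves them.
      tree : ∀ x → ∃[ ls ] (initial x ⇝[ eval (proj₁ bounded) (length x) ] ls ×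
                            map abstraction ls ≡ map (inj₁ tt ,_) (results x))
      tree x with backward (initial x) (subst (λ c → c ↠[ t (length x) + 0 ] map (inj₁ tt ,_) (results x)) (sym (abstraction-initial x))
                    (run (evaluation x) whole (ends (results x))))
      ... | ls , r , e = ls , ↠-mono (≤-trans (≤-reflexive (+-identityʳ _)) (proj₂ bounded (length x))) r , e

      compiled : NPTM
      compiled = record
        { machine = compile
        ; bound   = proj₁ bounded
        ; halts   = λ x → proj₁ (sound (proj₁ (proj₂ (tree x))))
        }

      compiled-outputs : ∀ x → NPTM.acceptedOutputs compiled x ≡ map written (results x)
      compiled-outputs x with tree x
      ... | ls , r , e = begin
        map output (filterᵇ isAccepting (NPTM.paths compiled x))  ≡⟨ cong (map output) (proj₂ (sound r)) ⟩
        map output ls  ≡⟨ map-∘ ls ⟩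
        map (written ∘ proj₂) (map abstraction ls)  ≡⟨ cong (map (written ∘ proj₂)) e ⟩
        map (written ∘ proj₂) (map (inj₁ tt ,_) (results x))  ≡⟨ map-∘ (results x) ⟨
        map written (results x)  ∎
        where open ≡-Reasoning

-- Evaluation rules for programs

module Rules (D Γ₁ Γ₂ : Set) (k₁ k₂ : ℕ) where

  open Program D Γ₁ Γ₂ k₁ k₂

  single : ∀ {p s n ts} → p ⊢ s ⇓[ n ] ts → p ⊢* [ s ] ⇓[ n ] ts
  single {ts = ts} r = subst (_ ⊢* _ ⇓[ _ ]_) (++-identityʳ ts) (r ∷ [])

  from : ∀ {p s s′ n ts} → s ≡ s′ → p ⊢ s ⇓[ n ] ts → p ⊢ s′ ⇓[ n ] ts
  from refl r = r

  into : ∀ {p s n ts ts′} → ts ≡ ts′ → p ⊢ s ⇓[ n ] ts → p ⊢ s ⇓[ n ] ts′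
  into refl r = r

  into₁ : ∀ {p s n t t′} → t ≡ t′ → p ⊢ s ⇓[ n ] [ t ] → p ⊢ s ⇓[ n ] [ t′ ]
  into₁ refl r = r

  infixr 5 _⨾₁_

  _⨾₁_ : ∀ {p q s s′ m n ts} → p ⊢ s ⇓[ m ] [ s′ ] → q ⊢ s′ ⇓[ n ] ts → (p ⨾ q) ⊢ s ⇓[ m + n ] ts
  r ⨾₁ r′ = seq r (single r′)

  loop₁ : ∀ {t p s s′ m n ts} → scan t s ≡ true → p ⊢ s ⇓[ m ] [ s′ ] → while t p ⊢ s′ ⇓[ n ] ts →
          while t p ⊢ s ⇓[ suc (m + n) ] ts
  loop₁ e r r′ = loop e r (single r′)

  each : ∀ {X : Set} {p n} {f : X → Store} {g : X → List Store} {xs} →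
         All (λ x → p ⊢ f x ⇓[ n ] g x) xs → p ⊢* map f xs ⇓[ n ] concatMap g xs
  each []       = []
  each (r ∷ rs) = r ∷ each rs

  split* : ∀ {p n} xs {ys us} → p ⊢* (xs ++ ys) ⇓[ n ] us →
           ∃[ us₁ ] ∃[ us₂ ] (us ≡ us₁ ++ us₂ × p ⊢* xs ⇓[ n ] us₁ × p ⊢* ys ⇓[ n ] us₂)
  split* []       r        = [] , _ , refl , [] , r
  split* (x ∷ xs) (_∷_ {ts = ts} r rs) with split* xs rs
  ... | us₁ , us₂ , refl , r₁ , r₂ = ts ++ us₁ , us₂ , sym (++-assoc ts us₁ us₂) , r ∷ r₁ , r₂

  seq* : ∀ {p q ss m n ts us} → p ⊢* ss ⇓[ m ] ts → q ⊢* ts ⇓[ n ] us → (p ⨾ q) ⊢* ss ⇓[ m + n ] us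
  seq* []                 []  = []
  seq* (_∷_ {ts = ts} r rs) r′ with split* ts r′
  ... | _ , _ , refl , r₁ , r₂ = seq r r₁ ∷ seq* rs r₂

  -- With a failed test the machine halts away from the end of the program and thus rejects, so the
  -- run vanishes from the list of final stores.
  guard : (D → Bool) → Prog
  guard P = atom λ d h g → if P d then [ idle d h g ] else []

  guard-⇓ : ∀ P ss → guard P ⊢* ss ⇓[ 1 ] filterᵇ (P ∘ register) ss
  guard-⇓ P []       = []
  guard-⇓ P (s ∷ ss) with P (register s) in eq
  ... | true  = subst (guard P ⊢ s ⇓[ 1 ]_) lemma atom ∷ guard-⇓ P ss
    where
    lemma : map (perform s) (if P (register s) then [ scan idle s ] else []) ≡ [ s ]
    lemma rewrite eq | perform-idle s = refl
  ... | false = subst (guard P ⊢ s ⇓[ 1 ]_) lemma atom ∷ guard-⇓ P ss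
    where
    lemma : map (perform s) (if P (register s) then [ scan idle s ] else []) ≡ []
    lemma rewrite eq = refl

  guard-map : ∀ {X : Set} P (f : X → Store) xs →
              guard P ⊢* map f xs ⇓[ 1 ] map f (filterᵇ (P ∘ register ∘ f) xs)
  guard-map P f xs = subst (guard P ⊢* map f xs ⇓[ 1 ]_) (filter-map (P ∘ register) f xs) (guard-⇓ P (map f xs))

  module Simulate {X : Set} (next : X → List X) (embed : X → Store)
    (test : Scan Bool) (body : Scan (List Effect))
    (test-embed : ∀ x → scan test (embed x) ≡ not (null (next x)))
    (body-embed : ∀ x → map (perform (embed x)) (scan body (embed x)) ≡ map embed (next x)) where

    open Tree next (λ _ → true)

    mutual
      -- Each simulated step costs one unit for the test and one for the body; the extra unit is the
      -- last, failing test.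
      simulate : ∀ {n x ls} → x ↠[ n ] ls → while test (atom body) ⊢ embed x ⇓[ suc (2 * n) ] map embed ls
      simulate {x = x} (halt e refl) = relax (s≤s z≤n) (stop (trans (test-embed x) (cong (not ∘ null) e)))
      simulate {suc n} {x} (move {d = d} {ds} e r) = relax (double-step n)
        (loop (trans (test-embed x) (cong (not ∘ null) e))
          (subst (atom body ⊢ embed x ⇓[ 1 ]_) (trans (body-embed x) (cong (map embed) e)) atom)
          (simulate* r))

      simulate* : ∀ {n xs ls} → xs ↠*[ n ] ls →
                  while test (atom body) ⊢* map embed xs ⇓[ suc (2 * n) ] map embed ls
      simulate* [] = []
      simulate* (_∷_ {ls = ls} {ks} r rs) rewrite map-++ embed ls ks = simulate r ∷ simulate* rs

-- Instructions that touch only the first tape of each group.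
module Focus (D Γ₁ Γ₂ : Set) (k₁ k₂ : ℕ) where

  open Program D Γ₁ Γ₂ k₁ (suc k₂) public
  open Rules D Γ₁ Γ₂ k₁ (suc k₂) public
  open Determinism D Γ₁ Γ₂ k₁ (suc k₂) public

  Step : Set
  Step = D × (Symbol Γ₁ × Direction) × (Symbol Γ₂ × Direction) × Maybe Bit

  widen : Vec (Symbol Γ₁) k₁ → Vec (Symbol Γ₂) k₂ → Step → Effect
  widen h g (d , a , b , e) = effect d (a ∷ Vec.map (_, stay) h) (b ∷ Vec.map (_, stay) g) e

  do′ : (D → Symbol Γ₁ → Symbol Γ₂ → List Step) → Prog
  do′ f = atom λ { d (a ∷ h) (b ∷ g) → map (widen h g) (f d a b) }

  do-det : ∀ f → (∀ d a b → length (f d a b) ≤ 1) → Det (do′ f)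
  do-det f f≤ d (a ∷ h) (b ∷ g) = map-≤ (f d a b) (f≤ d a b)

  while′ : (Symbol Γ₁ → Symbol Γ₂ → Bool) → Prog → Prog
  while′ t = while λ { d (a ∷ h) (b ∷ g) → t a b }

  after : Tape Γ₁ → Vec (Tape Γ₁) k₁ → Tape Γ₂ → Vec (Tape Γ₂) k₂ → Word → Step → Store
  after t ts u us o (d , a , b , e) = store d (actᵗ a t ∷ ts) (actᵗ b u ∷ us) (o ++ fromMaybe e)

  do-⇓ : ∀ f {d t ts u us o} →
         do′ f ⊢ store d (t ∷ ts) (u ∷ us) o ⇓[ 1 ] map (after t ts u us o) (f d (Tape.head t) (Tape.head u))
  do-⇓ f {d} {t} {ts} {u} {us} {o} = subst (do′ f ⊢ _ ⇓[ 1 ]_)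
    (trans (sym (map-∘ ss)) (map-cong lemma ss)) atom
    where
    ss = f d (Tape.head t) (Tape.head u)
    lemma : ∀ s → perform (store d (t ∷ ts) (u ∷ us) o)
      (widen (Vec.map Tape.head ts) (Vec.map Tape.head us) s) ≡ after t ts u us o s
    lemma (d′ , a , b , e) rewrite keep-heads ts | keep-heads us = refl

-- Running a given machine as part of a program

null-map : ∀ (f : A → B) xs → null (map f xs) ≡ null xs
null-map f []      = refl
null-map f (_ ∷ _) = refl

module Runs (M : NPTM) where
  open NPTM M
  open Run machine
  open Trimmed machine public

  leavesᵗ : Word → List Config
  leavesᵗ x = map trimmed (paths x)

  open Tree successorsᵗ (λ _ → true)

  leavesᵗ-tree : ∀ x → initial x ↠[ eval bound (length x) ] leavesᵗ x
  leavesᵗ-tree x = subst₂ (λ c ls → c ↠[ eval bound (length x) ] map trimmed ls)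
    (trimmed-initial x) (filter-true (paths x))
    (Simulation.forward successors successorsᵗ (λ _ → true) (λ _ → true) trimmed
      successors-trimmed (λ _ → refl)
      (Machines.complete machine (λ _ → true) _ (initial x) (halts x)))

  leavesᵗ-outputs : ∀ x → map output (filterᵇ isAccepting (leavesᵗ x)) ≡ acceptedOutputs x
  leavesᵗ-outputs x = trans (cong (map output) (filter-map isAccepting trimmed (paths x)))
    (sym (map-∘ (acceptingPaths x)))

  length-emit : ∀ (w : Word) e → length (w ++ fromMaybe e) ≤ suc (length w)
  length-emit w nothing  rewrite ++-identityʳ w = n≤1+n _
  length-emit w (just b) rewrite length-++ w {[ b ]} = ≤-reflexive (+-comm (length w) 1)

  mutual
    -- A step emits at most one bit, so outputs are no longer than the running time. This bounds the
    -- input of the second machine in a composition and the words that have to be guessed for the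
    -- span.
    output-bound : ∀ {n c ls} → c ↠[ n ] ls → All (λ l → length (output l) ≤ length (output c) + n) ls
    output-bound {c = c} (halt e refl) = m≤m+n (length (output c)) _ ∷ []
    output-bound {suc n} {c} (move e r) = output-bound* r
      (subst (All (λ d → length (output d) ≤ suc (length (output c)))) e
        (map⁺ (universal (λ m → length-emit (output c) (Move.emitted m)) _)))

    output-bound* : ∀ {n k cs ls} → cs ↠*[ n ] ls → All (λ d → length (output d) ≤ suc k) cs →
                    All (λ l → length (output l) ≤ k + suc n) ls
    output-bound* [] [] = []
    output-bound* {n} {k} (r ∷ rs) (h ∷ hs) = ++⁺
      (All.map (λ b → ≤-trans b (≤-trans (+-monoˡ-≤ n h) (≤-reflexive (sym (+-suc k n))))) (output-bound r))
      (output-bound* rs hs)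

  leavesᵗ-length : ∀ x → All (λ l → length (output l) ≤ eval bound (length x)) (leavesᵗ x)
  leavesᵗ-length x = output-bound (leavesᵗ-tree x)

nonblank : Symbol A → Bool
nonblank blank   = false
nonblank (bit _) = true
nonblank (aux _) = true

shiftᵗ-input : ∀ w → shiftᵗ right (tape [] blank (map bit w)) ≡ inputTape {A} w
shiftᵗ-input []      = refl
shiftᵗ-input (_ ∷ _) = refl

-- The position of a head that moves to the right over a word, respectively to the left.
rightward leftward : List (Symbol A) → List (Symbol A) → Tape A
rightward l []      = tape l blank []
rightward l (b ∷ r) = tape l b r
leftward []      r = tape [] blank r
leftward (b ∷ l) r = tape l b r

rightward-input : ∀ w → rightward [] (map bit w) ≡ inputTape {A} w
rightward-input []      = refl
rightward-input (_ ∷ _) = refl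

module Rewind (D Γ₁ Γ₂ : Set) (k₁ k₂ : ℕ) where
  open Focus D Γ₁ Γ₂ k₁ k₂

  move₂ : Direction → Prog
  move₂ m = do′ λ d a b → [ d , (a , stay) , (b , m) , nothing ]

  rewind : Prog
  rewind = move₂ left ⨾ while′ (λ a b → nonblank b) (move₂ left) ⨾ move₂ right

  rewind-loop : ∀ {d t ts us o} l r → while′ (λ a b → nonblank b) (move₂ left)
    ⊢ store d (t ∷ ts) (leftward (map bit l) (map bit r) ∷ us) o ⇓[ suc (2 * length l) ]
    [ store d (t ∷ ts) (tape [] blank (map bit (reverseAcc r l)) ∷ us) o ]
  rewind-loop {d} {t} {ts} {us} {o} [] r = stop refl
  rewind-loop {d} {t} {ts} {us} {o} (b ∷ l) r =
    relax (double-step (length l))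
      (loop₁ refl (do-⇓ _) (from (lemma l) (rewind-loop l (b ∷ r))))
    where
    lemma : ∀ l → store d (t ∷ ts) (leftward (map bit l) (map bit (b ∷ r)) ∷ us) o
                ≡ after t ts (tape (map bit l) (bit b) (map bit r)) us o (d , (Tape.head t , stay) , (bit b , left) , nothing)
    lemma []      rewrite ++-identityʳ o = refl
    lemma (_ ∷ l) rewrite ++-identityʳ o = refl

  -- The head visits the blank on either side of the word. Both blanks are dropped by `consᵗ`, so
  -- the result is the fresh input tape itself and not merely an equivalent one.
  rewind-⇓ : ∀ {d t ts us o} l → rewind
    ⊢ store d (t ∷ ts) (tape (map bit l) blank [] ∷ us) o ⇓[ 3 + 2 * length l ]
    [ store d (t ∷ ts) (inputTape (reverse l) ∷ us) o ]
  rewind-⇓ {d} {t} {ts} {us} {o} l = relax (≤-reflexive (cong (2 +_) (+-comm (2 * length l) 1)))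
    (into₁ (lemma₁ l) (do-⇓ _) ⨾₁ rewind-loop l [] ⨾₁
      into₁ (cong₂ (λ u o → store d (t ∷ ts) (u ∷ us) o) (shiftᵗ-input (reverse l)) (++-identityʳ o)) (do-⇓ _))
    where
    lemma₁ : ∀ l → after t ts (tape (map bit l) blank []) us o (d , (Tape.head t , stay) , (blank , left) , nothing)
                 ≡ store d (t ∷ ts) (leftward (map bit l) [] ∷ us) o
    lemma₁ []      rewrite ++-identityʳ o = refl
    lemma₁ (_ ∷ l) rewrite ++-identityʳ o = refl

-- `E` and the first group of tapes belong to the surrounding program and survive unchanged, and `o`
-- is what it has already written. The input of `N` is expected to the left of the head, as writing
-- it from left to right leaves it; hence the reversals.
module Exec (N : NPTM) (E Γ₁ : Set) (k₁ : ℕ) where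
  open NPTM N
  open Machine machine
  open Run machine
  open Runs N
  open Focus (E × State) Γ₁ Aux k₁ extra
  open Rewind (E × State) Γ₁ Aux k₁ extra using (rewind; rewind-⇓)

  test : Scan Bool
  test (e , q) h g = not (null (δ q g))

  body : Scan (List Effect)
  body (e , q) h g = map (λ m → effect (e , Move.target m) (Vec.map (_, stay) h) (Move.actions m) (Move.emitted m)) (δ q g)

  exec : Prog
  exec = rewind ⨾ while test (atom body) ⨾ guard (accepting ∘ proj₂)

  embed : E → Vec (Tape Γ₁) (suc k₁) → Word → Config → Store
  embed e ts o c = store (e , state c) ts (tapes c) (o ++ output c)

  finals : E → Vec (Tape Γ₁) (suc k₁) → Word → Word → List Store
  finals e ts o y = map (embed e ts o) (filterᵇ isAccepting (leavesᵗ y))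

  time : ℕ → ℕ
  time n = 3 + 2 * n + (suc (2 * eval bound n) + 1)

  time-mono : ∀ {m n} → m ≤ n → time m ≤ time n
  time-mono m≤n = +-mono-≤ (+-monoʳ-≤ 3 (*-monoʳ-≤ 2 m≤n))
    (+-monoˡ-≤ 1 (s≤s (*-monoʳ-≤ 2 (eval-mono bound m≤n))))

  time-bounded : PolyBounded time
  time-bounded = bounded-+ (bounded-linear 3 2)
    (bounded-+ (bounded-+ (bounded-const 1) (bounded-* (bounded-const 2) (bound , λ _ → ≤-refl))) (bounded-const 1))

  module _ (e : E) (ts : Vec (Tape Γ₁) (suc k₁)) (o : Word) where

    body-embed : ∀ c → map (perform (embed e ts o c)) (scan body (embed e ts o c))
                     ≡ map (embed e ts o) (successorsᵗ c)
    body-embed c@(config q us w) = trans (sym (map-∘ ms)) (trans (map-cong lemma ms) (map-∘ ms))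
      where
      ms = δ q (Vec.map Tape.head us)
      lemma : ∀ m → perform (embed e ts o c) (effect (e , Move.target m)
                (Vec.map (_, stay) (Vec.map Tape.head ts)) (Move.actions m) (Move.emitted m))
              ≡ embed e ts o (applyᵗ c m)
      lemma m rewrite keep-heads ts | ++-assoc o w (fromMaybe (Move.emitted m)) = refl

    open Simulate successorsᵗ (embed e ts o) test body
      (λ c → cong not (sym (null-map (applyᵗ c) (δ (state c) (Vec.map Tape.head (tapes c)))))) body-embed

    exec-⇓ : ∀ {t ts′} l → t ∷ ts′ ≡ ts →
      exec ⊢ store (e , start) ts (tape (map bit l) blank [] ∷ replicate extra emptyTape) o
        ⇓[ time (length l) ] finals e ts o (reverse l)
    exec-⇓ {t} {ts′} l refl = rewind-⇓ l ⨾₁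
      seq (subst₂ (λ n o′ → while test (atom body) ⊢ store (e , start) ts (inputTape y ∷ replicate extra emptyTape) o′
                      ⇓[ suc (2 * eval bound n) ] map (embed e ts o) (leavesᵗ y))
            (length-reverse l) (++-identityʳ o) (simulate (leavesᵗ-tree y)))
          (guard-map (accepting ∘ proj₂) (embed e ts o) (leavesᵗ y))
      where y = reverse l

  finals-outputs : ∀ e ts o y → map written (finals e ts o y) ≡ map (o ++_) (acceptedOutputs y)
  finals-outputs e ts o y = begin
    map written (finals e ts o y)  ≡⟨ map-∘ ls ⟨
    map ((o ++_) ∘ output) ls  ≡⟨ map-∘ ls ⟩
    map (o ++_) (map output ls)  ≡⟨ cong (map (o ++_)) (leavesᵗ-outputs y) ⟩
    map (o ++_) (acceptedOutputs y)  ∎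
    where
    open ≡-Reasoning
    ls = filterᵇ isAccepting (leavesᵗ y)

-- What `T` would emit is recorded on the first tape of `N`. The guard removes the rejecting paths
-- of `T` before `N` starts, so each accepting path of `T` continues with the paths of `N` on its
-- own output.
module Composition (T N : NPTM) where
  module T = NPTM T
  module N = NPTM N
  module TM = Machine T.machine
  module NM = Machine N.machine
  module TR = Run T.machine
  module RT = Runs T
  open Exec N TM.State TM.Aux TM.extra using (exec; exec-⇓; finals; finals-outputs; time; time-mono; time-bounded)
  open Focus (TM.State × NM.State) TM.Aux NM.Aux TM.extra NM.extra
  open Compile {TM.State × NM.State} {TM.Aux} {NM.Aux} {TM.extra} {suc NM.extra}
    (finite-× TM.State-fin NM.State-fin) TM.Aux-fin NM.Aux-fin

  test : Scan Bool
  test (q , r) h g = not (null (TM.δ q h))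

  record-emission : Maybe Bit → Symbol NM.Aux → Symbol NM.Aux × Direction
  record-emission nothing  g = g , stay
  record-emission (just b) g = bit b , right

  body : Scan (List Effect)
  body (q , r) h (g ∷ gs) = map (λ m → effect (Move.target m , r) (Move.actions m)
    (record-emission (Move.emitted m) g ∷ Vec.map (_, stay) gs) nothing) (TM.δ q h)

  prog : Prog
  prog = while test (atom body) ⨾ guard (TM.accepting ∘ proj₁) ⨾ exec

  embed : TR.Config → Store
  embed c = store (TR.state c , NM.start) (TR.tapes c)
    (tape (map bit (reverse (TR.output c))) blank [] ∷ replicate NM.extra emptyTape) []

  record-act : ∀ w e → actᵗ (record-emission e blank) (tape (map bit (reverse w)) blank [])
                     ≡ tape (map bit (reverse (w ++ fromMaybe e))) blank []
  record-act w nothing  rewrite ++-identityʳ w = refl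
  record-act w (just b) rewrite reverse-++ w [ b ] = refl

  body-embed : ∀ c → map (perform (embed c)) (scan body (embed c)) ≡ map embed (RT.successorsᵗ c)
  body-embed c@(TR.config q ts w) = trans (sym (map-∘ ms)) (trans (map-cong lemma ms) (map-∘ ms))
    where
    ms = TM.δ q (Vec.map Tape.head ts)
    lemma : ∀ m → perform (embed c) (effect (Move.target m , NM.start) (Move.actions m)
              (record-emission (Move.emitted m) blank ∷ Vec.map (_, stay) (Vec.map Tape.head (replicate NM.extra emptyTape))) nothing)
            ≡ embed (RT.applyᵗ c m)
    lemma m rewrite keep-heads {NM.Aux} (replicate NM.extra emptyTape) | record-act w (Move.emitted m) = refl

  open Simulate RT.successorsᵗ embed test body
    (λ c → cong not (sym (null-map (RT.applyᵗ c) (TM.δ (TR.state c) (Vec.map Tape.head (TR.tapes c)))))) body-embed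

  results : TR.Config → List Store
  results c = finals (TR.state c) (TR.tapes c) [] (reverse (reverse (TR.output c)))

  bound′ : ℕ → ℕ
  bound′ n = suc (2 * eval T.bound n) + (1 + time (eval T.bound n))

  exec-embed : ∀ n c → length (TR.output c) ≤ n → exec ⊢ embed c ⇓[ time n ] results c
  exec-embed n c@(TR.config q (t ∷ ts) w) h = relax (time-mono (≤-trans (≤-reflexive (length-reverse w)) h))
    (exec-⇓ q (t ∷ ts) [] (reverse w) refl)

  leaves : Word → List TR.Config
  leaves x = filterᵇ TR.isAccepting (RT.leavesᵗ x)

  prog-⇓ : ∀ x → prog ⊢ embed (TR.initial x) ⇓[ bound′ (length x) ] concatMap results (leaves x)
  prog-⇓ x = seq (simulate (RT.leavesᵗ-tree x))
    (seq* (guard-map (TM.accepting ∘ proj₁) embed (RT.leavesᵗ x))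
          (each (All.map (λ {c} → exec-embed _ c) (filterᵇ⁺ (RT.leavesᵗ-length x)))))
    where
    filterᵇ⁺ : ∀ {P : TR.Config → Set} {xs} → All P xs → All P (filterᵇ TR.isAccepting xs)
    filterᵇ⁺ []       = []
    filterᵇ⁺ (_∷_ {x} p ps) with TR.isAccepting x
    ... | true  = p ∷ filterᵇ⁺ ps
    ... | false = filterᵇ⁺ ps

  composite-bounded : PolyBounded bound′
  composite-bounded = bounded-+ (bounded-+ (bounded-const 1) (bounded-* (bounded-const 2) b))
    (bounded-+ (bounded-const 1) (bounded-∘ time-bounded b))
    where
    b : PolyBounded (eval T.bound)
    b = T.bound , λ _ → ≤-refl

  composite : NPTM
  composite = compiled prog (TM.start , NM.start) composite-bounded prog-⇓

  composite-outputs : ∀ x → NPTM.acceptedOutputs composite x ≡ concatMap N.acceptedOutputs (T.acceptedOutputs x)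
  composite-outputs x = begin
    NPTM.acceptedOutputs composite x  ≡⟨ compiled-outputs prog (TM.start , NM.start) composite-bounded prog-⇓ x ⟩
    map written (concatMap results ls)  ≡⟨ map-concatMap written results ls ⟩
    concatMap (map written ∘ results) ls  ≡⟨ concatMap-cong lemma ls ⟩
    concatMap (N.acceptedOutputs ∘ TR.output) ls  ≡⟨ concatMap-map N.acceptedOutputs TR.output ls ⟨
    concatMap N.acceptedOutputs (map TR.output ls)  ≡⟨ cong (concatMap N.acceptedOutputs) (RT.leavesᵗ-outputs x) ⟩
    concatMap N.acceptedOutputs (T.acceptedOutputs x)  ∎
    where
    open ≡-Reasoning
    ls = leaves x
    lemma : ∀ c → map written (results c) ≡ N.acceptedOutputs (TR.output c)
    lemma c rewrite finals-outputs (TR.state c) (TR.tapes c) [] (reverse (reverse (TR.output c)))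
                  | reverse-involutive (TR.output c) = map-id _

-- ⟨x,w⟩ is encoded as 1x₁1x₂…1xₙ0w.
pair : Word → Word → Word
pair []      w = zero ∷ w
pair (b ∷ x) w = suc zero ∷ b ∷ pair x w

-- One pass over the input both emits its tagged form and copies it to the first tape of `N`. The
-- second component of a pair is not delimited, so the output of `N` completes the pair as it
-- stands.
module Graph (N : NPTM) where
  open NPTM N
  open Machine machine
  open Exec N ⊤ ⊥ 0 using (exec; exec-⇓; finals; finals-outputs; time; time-mono; time-bounded)
  open Focus (⊤ × State) ⊥ Aux 0 extra
  open Compile {⊤ × State} {⊥} {Aux} {0} {suc extra} (finite-× finite-⊤ State-fin) finite-⊥ Aux-fin

  put : Bit → Prog
  put b = do′ λ d a g → [ d , (a , stay) , (g , stay) , just b ]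

  copyBit : ⊤ × State → Symbol ⊥ → Symbol Aux → List Step
  copyBit d (bit b) g = [ d , (bit b , right) , (bit b , right) , just b ]
  copyBit d _       g = []

  copy : Prog
  copy = while′ (λ a g → nonblank a) (put (suc zero) ⨾ do′ copyBit)

  tags : Word → Word
  tags []      = []
  tags (b ∷ w) = suc zero ∷ b ∷ tags w

  tags-pair : ∀ x w → (tags x ++ [ zero ]) ++ w ≡ pair x w
  tags-pair []      w = refl
  tags-pair (b ∷ x) w = cong (λ u → suc zero ∷ b ∷ u) (tags-pair x w)

  copy-⇓ : ∀ {d us} l w o →
    copy ⊢ store d (rightward (map bit l) (map bit w) ∷ []) (tape (map bit l) blank [] ∷ us) o
      ⇓[ suc (3 * length w) ]
      [ store d (tape (map bit (reverseAcc l w)) blank [] ∷ []) (tape (map bit (reverseAcc l w)) blank [] ∷ us) (o ++ tags w) ]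
  copy-⇓ l []      o rewrite ++-identityʳ o = stop refl
  copy-⇓ {d} {us} l (b ∷ w) o = relax (triple-step (length w))
    (loop₁ refl (do-⇓ _ ⨾₁ do-⇓ copyBit)
      (from (lemma w) (into₁ (cong (store d _ _) (++-assoc o (suc zero ∷ b ∷ []) (tags w)))
        (copy-⇓ {d} {us} (b ∷ l) w (o ++ suc zero ∷ b ∷ [])))))
    where
    lemma : ∀ w → store d (rightward (map bit (b ∷ l)) (map bit w) ∷ []) (tape (map bit (b ∷ l)) blank [] ∷ us) (o ++ suc zero ∷ b ∷ [])
              ≡ after (tape (map bit l) (bit b) (map bit w)) [] (tape (map bit l) blank []) us (o ++ [ suc zero ])
                  (d , (bit b , right) , (bit b , right) , just b)
    lemma []      rewrite ++-assoc o [ suc zero ] [ b ] = refl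
    lemma (_ ∷ w) rewrite ++-assoc o [ suc zero ] [ b ] = refl

  prog : Prog
  prog = copy ⨾ put zero ⨾ exec

  bound′ : ℕ → ℕ
  bound′ n = suc (3 * n) + (1 + time n)

  results : Word → List Store
  results x = finals tt (tape (map bit (reverse x)) blank [] ∷ []) (tags x ++ [ zero ]) (reverse (reverse x))

  prog-⇓ : ∀ x → prog ⊢ initialStore prog (tt , start) x ⇓[ bound′ (length x) ] results x
  prog-⇓ x = from (cong (λ t → store (tt , start) (t ∷ []) (replicate (suc extra) emptyTape) []) (rightward-input x))
    (copy-⇓ [] x [] ⨾₁ do-⇓ _ ⨾₁ relax (time-mono (≤-reflexive (length-reverse x)))
      (exec-⇓ tt (tape (map bit (reverse x)) blank [] ∷ []) (tags x ++ [ zero ]) (reverse x) refl))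

  graph-bounded : PolyBounded bound′
  graph-bounded = bounded-+ (bounded-linear 1 3)
    (bounded-+ (bounded-const 1) time-bounded)

  graph : NPTM
  graph = compiled prog (tt , start) graph-bounded prog-⇓

  graph-outputs : ∀ x → NPTM.acceptedOutputs graph x ≡ map (pair x) (acceptedOutputs x)
  graph-outputs x = begin
    NPTM.acceptedOutputs graph x  ≡⟨ compiled-outputs prog (tt , start) graph-bounded prog-⇓ x ⟩
    map written (results x)  ≡⟨ finals-outputs tt _ (tags x ++ [ zero ]) (reverse (reverse x)) ⟩
    map ((tags x ++ [ zero ]) ++_) (acceptedOutputs (reverse (reverse x)))
        ≡⟨ cong (map ((tags x ++ [ zero ]) ++_) ∘ acceptedOutputs) (reverse-involutive x) ⟩
    map ((tags x ++ [ zero ]) ++_) (acceptedOutputs x)  ≡⟨ map-cong (tags-pair x) (acceptedOutputs x) ⟩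
    map (pair x) (acceptedOutputs x)  ∎
    where open ≡-Reasoning

-- Finite-state transducers

finite-Maybe : Finite A → Finite (Maybe A)
finite-Maybe {A} f with finite-⊎ finite-⊤ f
... | n , g = n , ↔-trans (mk↔ₛ′ to back to-back back-to) g
  where
  to : Maybe A → ⊤ ⊎ A
  to nothing  = inj₁ tt
  to (just a) = inj₂ a
  back : ⊤ ⊎ A → Maybe A
  back (inj₁ tt) = nothing
  back (inj₂ a)  = just a
  to-back : ∀ a → to (back a) ≡ a
  to-back (inj₁ tt) = refl
  to-back (inj₂ a)  = refl
  back-to : ∀ a → back (to a) ≡ a
  back-to nothing  = refl
  back-to (just a) = refl

concatMap-[] : ∀ (f : A → B) xs → concatMap (λ x → [ f x ]) xs ≡ map f xs
concatMap-[] f []       = refl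
concatMap-[] f (x ∷ xs) = cong (f x ∷_) (concatMap-[] f xs)

-- Two bits are as many as the translations below ever emit at once. A machine step emits only one,
-- so the second waits in the state until `flush`.
Emission : Set
Emission = Maybe Bit × Maybe Bit

emitted : Emission → Word
emitted (a , c) = fromMaybe a ++ fromMaybe c

record Transducer : Set₁ where
  field
    State     : Set
    State-fin : Finite State
    first     : State
    read      : State → Bit → List (State × Emission)
    finish    : State → List Emission

  transduce : State → Word → List Word
  transduce s []      = map emitted (finish s)
  transduce s (b ∷ w) = concatMap (λ (s′ , e) → map (emitted e ++_) (transduce s′ w)) (read s b)

module Transduction (S : Transducer) where
  open Transducer S
  open Focus (State × Maybe Bit) ⊥ ⊥ 0 0
  open Compile {State × Maybe Bit} {⊥} {⊥} {0} {1} (finite-× State-fin (finite-Maybe finite-Fin)) finite-⊥ finite-⊥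

  readStep : State × Maybe Bit → Symbol ⊥ → Symbol ⊥ → List Step
  readStep (s , _) (bit b) g = map (λ (s′ , a , c) → (s′ , c) , (blank , right) , (g , stay) , a) (read s b)
  readStep _       _       _ = []

  flush : State × Maybe Bit → Symbol ⊥ → Symbol ⊥ → List Step
  flush (s , c) a g = [ (s , nothing) , (a , stay) , (g , stay) , c ]

  finishStep : State × Maybe Bit → Symbol ⊥ → Symbol ⊥ → List Step
  finishStep (s , _) a g = map (λ (e , c) → (s , c) , (a , stay) , (g , stay) , e) (finish s)

  reading : Prog
  reading = while′ (λ a g → nonblank a) (do′ readStep ⨾ do′ flush)

  prog : Prog
  prog = reading ⨾ do′ finishStep ⨾ do′ flush

  at : Word → State × Word → Store
  at w (s , o) = store (s , nothing) (inputTape w ∷ []) (emptyTape ∷ []) o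

  -- The states in which the input can be exhausted, with the output so far.
  exhausted : State → Word → List (State × Word)
  exhausted s []      = [ s , [] ]
  exhausted s (b ∷ w) = concatMap (λ (s′ , e) → map (map₂ (emitted e ++_)) (exhausted s′ w)) (read s b)

  reading-⇓ : ∀ w s o → reading ⊢ at w (s , o) ⇓[ suc (3 * length w) ]
                map (λ (s′ , u) → at [] (s′ , o ++ u)) (exhausted s w)
  reading-⇓ []      s o = into₁ (cong (λ o → at [] (s , o)) (sym (++-identityʳ o))) (stop refl)
  reading-⇓ (b ∷ w) s o = relax (triple-step (length w))
    (into results-≡ (loop refl body-⇓ (each (universal next-⇓ (read s b)))))
    where
    next : State × Emission → State × Word
    next (s′ , e) = s′ , o ++ emitted e

    half : State × Emission → Store
    half (s′ , a , c) = after (tape [] (bit b) (map bit w)) [] emptyTape [] o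
      ((s′ , c) , (blank , right) , (blank , stay) , a)

    flush-⇓ : ∀ x → do′ flush ⊢ half x ⇓[ 1 ] [ at w (next x) ]
    flush-⇓ (s′ , a , c) = into₁
      (cong₂ (λ t o → store (s′ , nothing) (t ∷ []) (emptyTape ∷ []) o) (shiftᵗ-input w) (++-assoc o (fromMaybe a) (fromMaybe c)))
      (do-⇓ flush)

    body-⇓ : (do′ readStep ⨾ do′ flush) ⊢ at (b ∷ w) (s , o) ⇓[ 2 ] map (at w ∘ next) (read s b)
    body-⇓ = into (concatMap-[] _ (read s b))
      (seq (into (sym (map-∘ (read s b))) (do-⇓ readStep)) (each (universal flush-⇓ (read s b))))

    next-⇓ : ∀ x → reading ⊢ at w (next x) ⇓[ suc (3 * length w) ]
               map (λ (s′ , u) → at [] (s′ , proj₂ (next x) ++ u)) (exhausted (proj₁ x) w)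
    next-⇓ (s′ , e) = reading-⇓ w s′ (o ++ emitted e)

    results-≡ : concatMap (λ x → map (λ (s′ , u) → at [] (s′ , proj₂ (next x) ++ u)) (exhausted (proj₁ x) w)) (read s b)
              ≡ map (λ (s′ , u) → at [] (s′ , o ++ u)) (exhausted s (b ∷ w))
    results-≡ = sym (trans (map-concatMap _ _ (read s b)) (concatMap-cong lemma (read s b)))
      where
      lemma : ∀ x → map (λ (s′ , u) → at [] (s′ , o ++ u)) (map (map₂ (emitted (proj₂ x) ++_)) (exhausted (proj₁ x) w))
                  ≡ map (λ (s′ , u) → at [] (s′ , proj₂ (next x) ++ u)) (exhausted (proj₁ x) w)
      lemma (s′ , e) = trans (sym (map-∘ (exhausted s′ w)))
        (map-cong (λ (s″ , u) → cong (λ o → at [] (s″ , o)) (sym (++-assoc o (emitted e) u))) (exhausted s′ w))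

  finishing-⇓ : ∀ s o → (do′ finishStep ⨾ do′ flush) ⊢ at [] (s , o) ⇓[ 2 ] map (λ e → at [] (s , o ++ emitted e)) (finish s)
  finishing-⇓ s o = into (concatMap-[] _ (finish s))
    (seq (into (sym (map-∘ (finish s))) (do-⇓ finishStep)) (each (universal flush-⇓ (finish s))))
    where
    flush-⇓ : ∀ e → do′ flush ⊢ after emptyTape [] emptyTape [] o ((s , proj₂ e) , (blank , stay) , (blank , stay) , proj₁ e)
                ⇓[ 1 ] [ at [] (s , o ++ emitted e) ]
    flush-⇓ (a , c) = into₁ (cong (λ o → at [] (s , o)) (++-assoc o (fromMaybe a) (fromMaybe c))) (do-⇓ flush)

  results : Word → List Store
  results x = concatMap (λ (s , o) → map (λ e → at [] (s , o ++ emitted e)) (finish s)) (exhausted first x)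

  transducer-time : ℕ → ℕ
  transducer-time n = suc (3 * n) + 2

  prog-⇓ : ∀ x → prog ⊢ initialStore prog (first , nothing) x ⇓[ transducer-time (length x) ] results x
  prog-⇓ x = seq (reading-⇓ x first []) (each (universal (λ (s , o) → finishing-⇓ s o) (exhausted first x)))

  transducer-bounded : PolyBounded transducer-time
  transducer-bounded = bounded-+ (bounded-linear 1 3) (bounded-const 2)

  transducer : NPTM
  transducer = compiled prog (first , nothing) transducer-bounded prog-⇓

  transducer-deterministic : (∀ s b → length (read s b) ≤ 1) → (∀ s → length (finish s) ≤ 1) →
                             Deterministic (NPTM.machine transducer)
  transducer-deterministic read≤ finish≤ = compile-deterministic prog (first , nothing)
    ((do-det readStep read-det , do-det flush (λ _ _ _ → ≤-refl)) ,
     do-det finishStep (λ d a g → map-≤ (finish (proj₁ d)) (finish≤ (proj₁ d))) , do-det flush (λ _ _ _ → ≤-refl))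
    where
    read-det : ∀ d a g → length (readStep d a g) ≤ 1
    read-det d (bit b) g = map-≤ (read (proj₁ d) b) (read≤ (proj₁ d) b)
    read-det d blank   g = z≤n

  finish-exhausted : ∀ s w → concatMap (λ (s′ , o) → map (λ e → o ++ emitted e) (finish s′)) (exhausted s w) ≡ transduce s w
  finish-exhausted s []      = ++-identityʳ _
  finish-exhausted s (b ∷ w) = trans (concatMap-concatMap (read s b)) (concatMap-cong lemma (read s b))
    where
    collect : State × Word → List Word
    collect (s′ , o) = map (λ e → o ++ emitted e) (finish s′)
    concatMap-concatMap : ∀ xs → concatMap collect (concatMap (λ (s′ , e) → map (map₂ (emitted e ++_)) (exhausted s′ w)) xs)
      ≡ concatMap (λ (s′ , e) → concatMap collect (map (map₂ (emitted e ++_)) (exhausted s′ w))) xs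
    concatMap-concatMap []       = refl
    concatMap-concatMap (x ∷ xs) = trans (concatMap-++ collect (map _ (exhausted (proj₁ x) w)) _)
      (cong (_ ++_) (concatMap-concatMap xs))
    lemma : ∀ x → concatMap collect (map (map₂ (emitted (proj₂ x) ++_)) (exhausted (proj₁ x) w))
                ≡ map (emitted (proj₂ x) ++_) (transduce (proj₁ x) w)
    lemma (s′ , e) = begin
      concatMap collect (map (map₂ (emitted e ++_)) es)  ≡⟨ concatMap-map collect _ es ⟩
      concatMap (collect ∘ map₂ (emitted e ++_)) es  ≡⟨ concatMap-cong
        (λ (s″ , o) → trans (map-cong (λ f → ++-assoc (emitted e) o (emitted f)) (finish s″)) (map-∘ (finish s″))) es ⟩
      concatMap (map (emitted e ++_) ∘ collect) es  ≡⟨ map-concatMap (emitted e ++_) collect es ⟨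
      map (emitted e ++_) (concatMap collect es)  ≡⟨ cong (map (emitted e ++_)) (finish-exhausted s′ w) ⟩
      map (emitted e ++_) (transduce s′ w)  ∎
      where
      open ≡-Reasoning
      es = exhausted s′ w

  transducer-outputs : ∀ x → NPTM.acceptedOutputs transducer x ≡ transduce first x
  transducer-outputs x = begin
    NPTM.acceptedOutputs transducer x  ≡⟨ compiled-outputs prog (first , nothing) transducer-bounded prog-⇓ x ⟩
    map written (results x)  ≡⟨ map-concatMap written _ (exhausted first x) ⟩
    concatMap (λ (s , o) → map written (map (λ e → at [] (s , o ++ emitted e)) (finish s))) (exhausted first x)
        ≡⟨ concatMap-cong (λ (s , o) → sym (map-∘ (finish s))) (exhausted first x) ⟩
    concatMap (λ (s , o) → map (λ e → o ++ emitted e) (finish s)) (exhausted first x)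
        ≡⟨ finish-exhausted first x ⟩
    transduce first x  ∎
    where open ≡-Reasoning

-- Loading the first component of a pair

-- Ill-formed words receive default values: the machines must halt on every input, so their
-- evaluation is stated for all words and not only for pairs.
parse : Word → Word × Word
parse []               = [] , []
parse (zero ∷ u)       = [] , u
parse (suc zero ∷ [])  = [] , []
parse (suc zero ∷ b ∷ u) = map₁ (b ∷_) (parse u)

parse-pair : ∀ x w → parse (pair x w) ≡ (x , w)
parse-pair []      w = refl
parse-pair (b ∷ x) w = cong (map₁ (b ∷_)) (parse-pair x w)

parse-length : ∀ u → length (proj₁ (parse u)) + length (proj₂ (parse u)) ≤ length u
parse-length []                   = z≤n
parse-length (zero ∷ u)           = n≤1+n _
parse-length (suc zero ∷ [])      = z≤n
parse-length (suc zero ∷ b ∷ u)   = s≤s (m≤n⇒m≤1+n (parse-length u))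

module Load (D Γ₂ : Set) (k₂ : ℕ) where
  open Focus D ⊥ Γ₂ 0 k₂

  isOne : Symbol ⊥ → Bool
  isOne (bit (suc zero)) = true
  isOne _                = false

  erase : D → Symbol ⊥ → Symbol Γ₂ → List Step
  erase d a g = [ d , (blank , right) , (g , stay) , nothing ]

  copyBit : D → Symbol ⊥ → Symbol Γ₂ → List Step
  copyBit d (bit b) g = [ d , (blank , right) , (bit b , right) , nothing ]
  copyBit d _       g = [ d , (blank , stay) , (g , stay) , nothing ]

  copying load : Prog
  copying = while′ (λ a g → isOne a) (do′ erase ⨾ do′ copyBit)
  load    = copying ⨾ do′ erase

  erase-⇓ : ∀ {d b w u us o} → do′ erase ⊢ store d (tape [] b (map bit w) ∷ []) (u ∷ us) o ⇓[ 1 ]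
              [ store d (inputTape w ∷ []) (u ∷ us) o ]
  erase-⇓ {d} {b} {w} {u} {us} {o} =
    into₁ (cong₂ (λ t o → store d (t ∷ []) (u ∷ us) o) (shiftᵗ-input w) (++-identityʳ o)) (do-⇓ erase)

  copying-⇓ : ∀ {d us o} l u → ∃[ a ] copying
    ⊢ store d (inputTape u ∷ []) (tape (map bit l) blank [] ∷ us) o ⇓[ suc (3 * length u) ]
    [ store d (tape [] a (map bit (proj₂ (parse u))) ∷ [])
              (tape (map bit (reverseAcc l (proj₁ (parse u)))) blank [] ∷ us) o ]
  copying-⇓ l []             = blank , stop refl
  copying-⇓ l (zero ∷ u)     = bit zero , relax (s≤s z≤n) (stop refl)
  copying-⇓ {d} {us} {o} l (suc zero ∷ []) = blank , loop₁ refl (erase-⇓ {w = []} ⨾₁ into₁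
    (cong (store d (emptyTape ∷ []) (tape (map bit l) blank [] ∷ us)) (++-identityʳ o)) (do-⇓ copyBit)) (stop refl)
  copying-⇓ {d} {us} {o} l (suc zero ∷ b ∷ u) with copying-⇓ {d} {us} {o} (b ∷ l) u
  ... | a , r = a , relax (s≤s (≤-trans (+-monoˡ-≤ (3 * length u) (m≤m+n 3 3)) (≤-reflexive (sym (*-distribˡ-+ 3 2 (length u))))))
    (loop₁ refl (erase-⇓ {w = b ∷ u} ⨾₁ into₁
      (cong₂ (λ t o → store d (t ∷ []) (tape (map bit (b ∷ l)) blank [] ∷ us) o) (shiftᵗ-input u) (++-identityʳ o))
      (do-⇓ copyBit)) r)

  load-⇓ : ∀ {d us o} l u → load
    ⊢ store d (inputTape u ∷ []) (tape (map bit l) blank [] ∷ us) o ⇓[ 2 + 3 * length u ]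
    [ store d (inputTape (proj₂ (parse u)) ∷ []) (tape (map bit (reverseAcc l (proj₁ (parse u)))) blank [] ∷ us) o ]
  load-⇓ l u = relax (≤-reflexive (+-comm (suc (3 * length u)) 1))
    (proj₂ (copying-⇓ l u) ⨾₁ erase-⇓ {w = proj₂ (parse u)})

-- Subtraction

minus : Bit → Bit → Bool → Bit × Bool
minus zero       zero       false = zero     , false
minus zero       zero       true  = suc zero , true
minus zero       (suc zero) false = suc zero , true
minus zero       (suc zero) true  = zero     , true
minus (suc zero) zero       false = suc zero , false
minus (suc zero) zero       true  = zero     , false
minus (suc zero) (suc zero) false = zero     , false
minus (suc zero) (suc zero) true  = suc zero , true

-- Least significant bit first, with the borrow in and the borrow out.
subtract : Bool → List Bit → List Bit → Bool × List Bit
subtract c []       []       = c , []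
subtract c (a ∷ as) []       = map₂ (proj₁ (minus a zero c) ∷_) (subtract (proj₂ (minus a zero c)) as [])
subtract c []       (b ∷ bs) = map₂ (proj₁ (minus zero b c) ∷_) (subtract (proj₂ (minus zero b c)) [] bs)
subtract c (a ∷ as) (b ∷ bs) = map₂ (proj₁ (minus a b c) ∷_) (subtract (proj₂ (minus a b c)) as bs)

subtract-length : ∀ c as bs → length (proj₂ (subtract c as bs)) ≤ length as + length bs
subtract-length c []       []       = z≤n
subtract-length c (a ∷ as) []       = s≤s (subtract-length _ as [])
subtract-length c []       (b ∷ bs) = s≤s (subtract-length _ [] bs)
subtract-length c (a ∷ as) (b ∷ bs) = s≤s (≤-trans (subtract-length _ as bs) (+-monoʳ-≤ (length as) (n≤1+n _)))

module Subtraction where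
  open Focus Bool ⊥ ⊥ 0 0
  open Load Bool ⊥ 0 using (load; load-⇓)
  open Compile {Bool} {⊥} {⊥} {0} {1} finite-Bool finite-⊥ finite-⊥

  -- Blanks beyond the shorter number count as its leading zeros.
  digit : Symbol ⊥ → Bit
  digit (bit b) = b
  digit _       = zero

  skip : Bool → Symbol ⊥ → Symbol ⊥ → List Step
  skip c a g = [ c , (a , right) , (g , stay) , nothing ]

  turn : Bool → Symbol ⊥ → Symbol ⊥ → List Step
  turn c a g = [ c , (a , left) , (g , left) , nothing ]

  subStep : Bool → Symbol ⊥ → Symbol ⊥ → List Step
  subStep c a g = [ proj₂ (minus (digit g) (digit a) c) , (blank , left) , (bit (proj₁ (minus (digit g) (digit a) c)) , left) , nothing ]

  return : Bool → Symbol ⊥ → Symbol ⊥ → List Step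
  return c a g = [ c , (a , stay) , (g , right) , nothing ]

  emit : Bool → Symbol ⊥ → Symbol ⊥ → List Step
  emit c a g = [ c , (a , stay) , (blank , right) , just (digit g) ]

  -- `load` puts the minuend on the second tape. After `turn` both heads stand on the least
  -- significant bits, and the difference overwrites the minuend from right to left. A borrow left
  -- at the end means a negative difference, and the guard lets the run reject.
  skipping subtracting emitting prog : Prog
  skipping    = while′ (λ a g → nonblank a) (do′ skip)
  subtracting = while′ (λ a g → nonblank a ∨ nonblank g) (do′ subStep)
  emitting    = while′ (λ a g → nonblank g) (do′ emit)
  prog = load ⨾ skipping ⨾ do′ turn ⨾ subtracting ⨾ guard not ⨾ do′ return ⨾ emitting

  skipping-⇓ : ∀ {c u o} l w → skipping
    ⊢ store c (rightward (map bit l) (map bit w) ∷ []) (u ∷ []) o ⇓[ suc (2 * length w) ]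
    [ store c (tape (map bit (reverseAcc l w)) blank [] ∷ []) (u ∷ []) o ]
  skipping-⇓ l []      = stop refl
  skipping-⇓ {c} {u} {o} l (b ∷ w) =
    relax (double-step (length w))
      (loop₁ refl (into₁ (lemma w) (do-⇓ skip)) (skipping-⇓ (b ∷ l) w))
    where
    lemma : ∀ w → after (tape (map bit l) (bit b) (map bit w)) [] u [] o (c , (bit b , right) , (Tape.head u , stay) , nothing)
                ≡ store c (rightward (map bit (b ∷ l)) (map bit w) ∷ []) (u ∷ []) o
    lemma []      rewrite ++-identityʳ o = refl
    lemma (_ ∷ _) rewrite ++-identityʳ o = refl

  shift-leftward : ∀ (a : Symbol ⊥) l r → shiftᵗ left (tape (map bit l) a r) ≡ leftward (map bit l) (consᵗ a r)
  shift-leftward a []      r = refl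
  shift-leftward a (_ ∷ _) r = refl

  subtracting-⇓ : ∀ {o} c as bs r → subtracting
    ⊢ store c (leftward (map bit bs) [] ∷ []) (leftward (map bit as) (map bit r) ∷ []) o ⇓[ suc (2 * (length as + length bs)) ]
    [ store (proj₁ (subtract c as bs)) (emptyTape ∷ []) (tape [] blank (map bit (reverseAcc r (proj₂ (subtract c as bs)))) ∷ []) o ]
  subtracting-⇓ c []       []       r = stop refl
  subtracting-⇓ {o} c (a ∷ as) []       r =
    relax (double-step (length as + 0))
    (loop₁ refl (into₁ (cong₂ (λ t → store _ (emptyTape ∷ []) (t ∷ [])) (shift-leftward _ as (map bit r)) (++-identityʳ o)) (do-⇓ subStep))
      (subtracting-⇓ _ as [] _))
  subtracting-⇓ {o} c []       (b ∷ bs) r =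
    relax (double-step (length bs))
    (loop₁ refl (into₁ (cong₂ (λ t → store _ (t ∷ []) _) (shift-leftward _ bs []) (++-identityʳ o)) (do-⇓ subStep))
      (subtracting-⇓ _ [] bs _))
  subtracting-⇓ {o} c (a ∷ as) (b ∷ bs) r = relax
    (s≤s (≤-trans (≤-reflexive (sym (*-suc 2 (length as + length bs)))) (*-monoʳ-≤ 2 (s≤s (+-monoʳ-≤ (length as) (n≤1+n _))))))
    (loop₁ refl (into₁ (trans (cong₂ (λ t u → store _ (t ∷ []) (u ∷ []) (o ++ [])) (shift-leftward _ bs []) (shift-leftward _ as (map bit r)))
        (cong (store _ _ _) (++-identityʳ o))) (do-⇓ subStep))
      (subtracting-⇓ _ as bs _))

  emitting-⇓ : ∀ {c t} w o → emitting
    ⊢ store c (t ∷ []) (inputTape w ∷ []) o ⇓[ suc (2 * length w) ] [ store c (t ∷ []) (emptyTape ∷ []) (o ++ w) ]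
  emitting-⇓ {c} {t} []      o = into₁ (cong (store c (t ∷ []) (emptyTape ∷ [])) (sym (++-identityʳ o))) (stop refl)
  emitting-⇓ {c} {t} (b ∷ w) o =
    relax (double-step (length w))
      (loop₁ refl (into₁ (cong (λ u → store c (t ∷ []) (u ∷ []) (o ++ [ b ])) (shiftᵗ-input w)) (do-⇓ emit))
        (into₁ (cong (store c (t ∷ []) (emptyTape ∷ [])) (++-assoc o [ b ] w)) (emitting-⇓ w (o ++ [ b ]))))

  difference : Word → Bool × List Bit
  difference u = subtract false (reverse (proj₁ (parse u))) (reverse (proj₂ (parse u)))

  results : Word → List Store
  results u = if proj₁ (difference u) then []
    else [ store false (emptyTape ∷ []) (emptyTape ∷ []) (reverse (proj₂ (difference u))) ]

  sub-time : ℕ → ℕ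
  sub-time n = 2 + 3 * n + (suc (2 * n) + (1 + (suc (2 * n) + (1 + (1 + suc (2 * n))))))

  prog-⇓ : ∀ u → prog ⊢ initialStore prog false u ⇓[ sub-time (length u) ] results u
  prog-⇓ u = load-⇓ [] u ⨾₁
      relax (s≤s (*-monoʳ-≤ 2 w≤)) (from (cong (λ t → store false (t ∷ []) (tape (map bit as) blank [] ∷ []) []) (rightward-input w)) (skipping-⇓ [] w)) ⨾₁
      into₁ (cong₂ (λ t t′ → store false (t ∷ []) (t′ ∷ []) []) (shift-leftward blank (reverse w) []) (shift-leftward blank (reverse x) [])) (do-⇓ turn) ⨾₁
      relax (s≤s (*-monoʳ-≤ 2 as+bs≤)) (subtracting-⇓ false as bs []) ⨾₁ ending
    where
    x = proj₁ (parse u)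
    w = proj₂ (parse u)
    as = reverse x
    bs = reverse w
    w≤ : length w ≤ length u
    w≤ = ≤-trans (m≤n+m _ (length x)) (parse-length u)
    as+bs≤ : length as + length bs ≤ length u
    as+bs≤ = ≤-trans (≤-reflexive (cong₂ _+_ (length-reverse x) (length-reverse w))) (parse-length u)
    d = reverse (proj₂ (difference u))
    d≤ : length d ≤ length u
    d≤ = ≤-trans (≤-reflexive (length-reverse (proj₂ (difference u)))) (≤-trans (subtract-length false as bs) as+bs≤)
    ending : (guard not ⨾ do′ return ⨾ emitting)
      ⊢ store (proj₁ (difference u)) (emptyTape ∷ []) (tape [] blank (map bit d) ∷ []) [] ⇓[ 1 + (1 + suc (2 * length u)) ] results u
    ending with proj₁ (difference u)
    ... | true  = seq atom []
    ... | false = atom ⨾₁ into₁ (cong (λ t → store false (emptyTape ∷ []) (t ∷ []) []) (shiftᵗ-input d)) (do-⇓ return) ⨾₁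
                  relax (s≤s (*-monoʳ-≤ 2 d≤)) (emitting-⇓ d [])

  sub-bounded : PolyBounded sub-time
  sub-bounded = bounded-+ (bounded-linear 2 3)
    (bounded-+ linear (bounded-+ (bounded-const 1) (bounded-+ linear
      (bounded-+ (bounded-const 1) (bounded-+ (bounded-const 1) linear)))))
    where
    linear : PolyBounded (λ n → suc (2 * n))
    linear = bounded-linear 1 2

  subtractor : NPTM
  subtractor = compiled prog false sub-bounded prog-⇓

  outcome : Bool × List Bit → List Word
  outcome (c , d) = if c then [] else [ reverse d ]

  subtractor-outputs : ∀ x y → NPTM.acceptedOutputs subtractor (pair x y)
                             ≡ outcome (subtract false (reverse x) (reverse y))
  subtractor-outputs x y = trans (compiled-outputs prog false sub-bounded prog-⇓ (pair x y))
    (trans (lemma (difference (pair x y)))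
      (cong (λ (x , y) → outcome (subtract false (reverse x) (reverse y))) (parse-pair x y)))
    where
    lemma : ∀ d → map written (if proj₁ d then []
              else [ store false (emptyTape ∷ []) (emptyTape ∷ []) (reverse (proj₂ d)) ]) ≡ outcome d
    lemma (true  , _) = refl
    lemma (false , _) = refl

-- A clock: squaring the length

module Squaring where
  open Focus ⊤ ⊥ ⊥ 0 0
  open Compile {⊤} {⊥} {⊥} {0} {1} finite-⊤ finite-⊥ finite-⊥

  mark : ⊤ → Symbol ⊥ → Symbol ⊥ → List Step
  mark d a g = [ d , (blank , right) , (bit (suc zero) , stay) , nothing ]

  sweep : Direction → ⊤ → Symbol ⊥ → Symbol ⊥ → List Step
  sweep m d a g = [ d , (a , stay) , (g , m) , just (suc zero) ]

  return : ⊤ → Symbol ⊥ → Symbol ⊥ → List Step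
  return d a g = [ d , (a , stay) , (g , right) , nothing ]

  sweeping : Direction → Prog
  sweeping m = while′ (λ a g → nonblank g) (do′ (sweep m))

  round prog : Prog
  round = do′ mark ⨾ sweeping left ⨾ do′ return ⨾ sweeping right
  prog  = while′ (λ a g → nonblank a) round

  ones : ℕ → Word
  ones n = List.replicate n (suc zero)

  ones-+ : ∀ m n → ones (m + n) ≡ ones m ++ ones n
  ones-+ zero    n = refl
  ones-+ (suc m) n = cong (suc zero ∷_) (ones-+ m n)

  emit-one : ∀ o n → (o ++ [ suc zero ]) ++ ones n ≡ o ++ ones (suc n)
  emit-one o n = ++-assoc o [ suc zero ] (ones n)

  sweepLeft-⇓ : ∀ {t} i j o → sweeping left
    ⊢ store tt (t ∷ []) (leftward (map bit (ones i)) (map bit (ones j)) ∷ []) o ⇓[ suc (2 * i) ]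
    [ store tt (t ∷ []) (tape [] blank (map bit (ones (i + j))) ∷ []) (o ++ ones i) ]
  sweepLeft-⇓ {t} zero    j o = into₁ (cong (store tt (t ∷ []) _) (sym (++-identityʳ o))) (stop refl)
  sweepLeft-⇓ {t} (suc i) j o = relax (double-step i) (loop₁ refl (into₁ (lemma i) (do-⇓ (sweep left)))
    (into₁ (cong₂ (λ n o → store tt (t ∷ []) (tape [] blank (map bit (ones n)) ∷ []) o) (+-suc i j) (emit-one o i))
      (sweepLeft-⇓ i (suc j) (o ++ [ suc zero ]))))
    where
    lemma : ∀ i → after t [] (tape (map bit (ones i)) (bit (suc zero)) (map bit (ones j))) [] o
                    (tt , (Tape.head t , stay) , (bit (suc zero) , left) , just (suc zero))
                ≡ store tt (t ∷ []) (leftward (map bit (ones i)) (map bit (ones (suc j))) ∷ []) (o ++ [ suc zero ])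
    lemma zero    = refl
    lemma (suc _) = refl

  sweepRight-⇓ : ∀ {t} i j o → sweeping right
    ⊢ store tt (t ∷ []) (rightward (map bit (ones j)) (map bit (ones i)) ∷ []) o ⇓[ suc (2 * i) ]
    [ store tt (t ∷ []) (tape (map bit (ones (i + j))) blank [] ∷ []) (o ++ ones i) ]
  sweepRight-⇓ {t} zero    j o = into₁ (cong (store tt (t ∷ []) _) (sym (++-identityʳ o))) (stop refl)
  sweepRight-⇓ {t} (suc i) j o = relax (double-step i) (loop₁ refl (into₁ (lemma i) (do-⇓ (sweep right)))
    (into₁ (cong₂ (λ n o → store tt (t ∷ []) (tape (map bit (ones n)) blank [] ∷ []) o) (+-suc i j) (emit-one o i))
      (sweepRight-⇓ i (suc j) (o ++ [ suc zero ]))))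
    where
    lemma : ∀ i → after t [] (tape (map bit (ones j)) (bit (suc zero)) (map bit (ones i))) [] o
                    (tt , (Tape.head t , stay) , (bit (suc zero) , right) , just (suc zero))
                ≡ store tt (t ∷ []) (rightward (map bit (ones (suc j))) (map bit (ones i)) ∷ []) (o ++ [ suc zero ])
    lemma zero    = refl
    lemma (suc _) = refl

  at : Word → ℕ → Word → Store
  at w i o = store tt (inputTape w ∷ []) (tape (map bit (ones i)) blank [] ∷ []) o

  round-⇓ : ∀ b w i o → round ⊢ at (b ∷ w) i o ⇓[ 1 + (suc (2 * suc i) + (1 + suc (2 * suc i))) ]
              [ at w (suc i) ((o ++ ones (suc i)) ++ ones (suc i)) ]
  round-⇓ b w i o =
    into₁ (cong₂ (λ t o → store tt (t ∷ []) (tape (map bit (ones i)) (bit (suc zero)) [] ∷ []) o) (shiftᵗ-input w) (++-identityʳ o)) (do-⇓ mark) ⨾₁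
    into₁ (cong (λ n → store tt (inputTape w ∷ []) (tape [] blank (map bit (ones n)) ∷ []) (o ++ ones (suc i))) (+-identityʳ (suc i)))
      (sweepLeft-⇓ (suc i) 0 o) ⨾₁
    into₁ (cong (store tt (inputTape w ∷ []) (rightward [] (map bit (ones (suc i))) ∷ [])) (++-identityʳ (o ++ ones (suc i)))) (do-⇓ return) ⨾₁
    into₁ (cong (λ n → at w n ((o ++ ones (suc i)) ++ ones (suc i))) (+-identityʳ (suc i)))
      (sweepRight-⇓ (suc i) 0 (o ++ ones (suc i)))

  -- Each input bit adds one mark, and the sweeps to the left and to the right emit one bit per
  -- mark. Starting without marks, this makes 2 (1 + ... + n) = n (n + 1) bits, which is at least
  -- n².
  total : ℕ → ℕ → ℕ
  total i zero    = 0
  total i (suc n) = suc i + (suc i + total (suc i) n)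

  round-time : ℕ → ℕ
  round-time k = 1 + (suc (2 * k) + (1 + suc (2 * k)))

  round-time-mono : ∀ {i k} → i ≤ k → round-time i ≤ round-time k
  round-time-mono i≤k = +-monoʳ-≤ 1 (+-mono-≤ (s≤s (*-monoʳ-≤ 2 i≤k)) (+-monoʳ-≤ 1 (s≤s (*-monoʳ-≤ 2 i≤k))))

  prog-⇓ : ∀ k w i o → i + length w ≤ k → prog ⊢ at w i o ⇓[ suc (length w * suc (round-time k)) ]
             [ at [] (i + length w) (o ++ ones (total i (length w))) ]
  prog-⇓ k []      i o h = into₁ (cong₂ (at []) (sym (+-identityʳ i)) (sym (++-identityʳ o))) (stop refl)
  prog-⇓ k (b ∷ w) i o h = relax (s≤s (≤-reflexive (lemma (round-time k) (length w * suc (round-time k)))))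
    (loop₁ refl (relax (round-time-mono i≤k) (round-⇓ b w i o))
      (into₁ (cong₂ (at []) (sym (+-suc i (length w))) outputs-≡) (prog-⇓ k w (suc i) _ h′)))
    where
    h′ : suc i + length w ≤ k
    h′ = ≤-trans (≤-reflexive (sym (+-suc i (length w)))) h
    i≤k : suc i ≤ k
    i≤k = ≤-trans (m≤m+n (suc i) (length w)) h′
    lemma : ∀ r m → r + suc m ≡ suc r + m
    lemma r m = +-suc r m
    outputs-≡ : ((o ++ ones (suc i)) ++ ones (suc i)) ++ ones (total (suc i) (length w))
              ≡ o ++ ones (total i (suc (length w)))
    outputs-≡ = begin
      ((o ++ ones (suc i)) ++ ones (suc i)) ++ t  ≡⟨ ++-assoc (o ++ ones (suc i)) (ones (suc i)) t ⟩
      (o ++ ones (suc i)) ++ ones (suc i) ++ t  ≡⟨ ++-assoc o (ones (suc i)) (ones (suc i) ++ t) ⟩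
      o ++ ones (suc i) ++ ones (suc i) ++ t  ≡⟨ cong (λ u → o ++ ones (suc i) ++ u) (ones-+ (suc i) _) ⟨
      o ++ ones (suc i) ++ ones (suc i + total (suc i) (length w))
        ≡⟨ cong (o ++_) (ones-+ (suc i) _) ⟨
      o ++ ones (total i (suc (length w)))  ∎
      where
      open ≡-Reasoning
      t = ones (total (suc i) (length w))

  square-time : ℕ → ℕ
  square-time n = suc (n * suc (round-time n))

  square-bounded : PolyBounded square-time
  square-bounded = bounded-+ (bounded-const 1) (bounded-* bounded-id (bounded-+ (bounded-const 1)
    (bounded-+ (bounded-const 1) (bounded-+ linear (bounded-+ (bounded-const 1) linear)))))
    where
    linear : PolyBounded (λ n → suc (2 * n))
    linear = bounded-linear 1 2

  evaluation : ∀ x → prog ⊢ initialStore prog tt x ⇓[ square-time (length x) ]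
                 [ at [] (length x) (ones (total 0 (length x))) ]
  evaluation x = prog-⇓ (length x) x 0 [] ≤-refl

  squarer : NPTM
  squarer = compiled prog tt square-bounded evaluation

  squarer-outputs : ∀ x → NPTM.acceptedOutputs squarer x ≡ [ ones (total 0 (length x)) ]
  squarer-outputs x = compiled-outputs prog tt square-bounded evaluation x

  total-≡ : ∀ i n → total i n ≡ n * (i + i + suc n)
  total-≡ i zero    = refl
  total-≡ i (suc n) rewrite total-≡ (suc i) n =
    solve 2 (λ i n → con 1 :+ i :+ (con 1 :+ i :+ n :* (con 1 :+ i :+ (con 1 :+ i) :+ (con 1 :+ n)))
      := (con 1 :+ n) :* (i :+ i :+ (con 1 :+ (con 1 :+ n)))) refl i n
    where open +-*-Solver

  squarer-length : ∀ n → n * n ≤ length (ones (total 0 n))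
  squarer-length n = ≤-trans (*-monoʳ-≤ n (n≤1+n n)) (≤-reflexive (sym (trans (length-replicate (total 0 n)) (total-≡ 0 n))))

-- On input ⟨x,w⟩ the machine makes exactly |w| binary choices and thereby
-- simulates M on x, so that 2^|w| runs split into those in which M accepts
-- and those that are accepted here.
module Complement (M : NPTM)
  (binary : ∀ q h → length (Machine.δ (NPTM.machine M) q h) ≤ 2) where
  open NPTM M
  open Machine machine
  open Run machine
  open Runs M
  open Focus (Maybe State) ⊥ Aux 0 extra
  open Load (Maybe State) Aux extra using (load; load-⇓)
  open Rewind (Maybe State) ⊥ Aux 0 extra using (rewind; rewind-⇓)
  open Compile {Maybe State} {⊥} {Aux} {0} {suc extra} (finite-Maybe State-fin) finite-⊥ Aux-fin
  open Tree successorsᵗ isAccepting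

  tickTo : Vec (Symbol ⊥) 1 → Move State Aux (suc extra) → Effect
  tickTo h m = effect (just (Move.target m)) ((blank , right) ∷ []) (Move.actions m) nothing

  tickStay : Maybe State → Vec (Symbol ⊥) 1 → Vec (Symbol Aux) (suc extra) → Effect
  tickStay d h g = effect d ((blank , right) ∷ []) (Vec.map (_, stay) g) nothing

  -- Every bit of the clock doubles the number of runs, whatever `M` does. Missing alternatives are
  -- supplied by dead runs (state `nothing`), which never count as successes of `M`. A halted
  -- configuration waits on one branch only, so that its leaf is counted once.
  choices : State → Vec (Symbol ⊥) 1 → Vec (Symbol Aux) (suc extra) → List (Move State Aux (suc extra)) → List Effect
  choices q h g []           = tickStay (just q) h g ∷ tickStay nothing h g ∷ []
  choices q h g (m ∷ [])     = tickTo h m ∷ tickStay nothing h g ∷ []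
  choices q h g (m ∷ m′ ∷ _) = tickTo h m ∷ tickTo h m′ ∷ []

  tick : Scan (List Effect)
  tick nothing  h g = tickStay nothing h g ∷ tickStay nothing h g ∷ []
  tick (just q) h g = choices q h g (δ q g)

  ticking : Prog
  ticking = while (λ { d (a ∷ h) g → nonblank a }) (atom tick)

  successful : Maybe State → Bool
  successful nothing  = false
  successful (just q) = accepting q

  prog : Prog
  prog = load ⨾ rewind ⨾ ticking ⨾ guard (not ∘ successful)

  at : Word → Maybe State → Vec (Tape Aux) (suc extra) → Store
  at w d us = store d (inputTape w ∷ []) us []

  embed : Word → Config → Store
  embed w c = at w (just (state c)) (tapes c)

  count : List Store → ℕ
  count ss = length (filterᵇ (successful ∘ register) ss)

  count-++ : ∀ ss ts → count (ss ++ ts) ≡ count ss + count ts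
  count-++ ss ts rewrite filter-++ᵇ (successful ∘ register) ss ts =
    length-++ (filterᵇ (successful ∘ register) ss)

  perform-stay : ∀ b w d d′ us → perform (at (b ∷ w) d us) (tickStay d′ (bit b ∷ []) (Vec.map Tape.head us)) ≡ at w d′ us
  perform-stay b w d d′ us rewrite shiftᵗ-input {⊥} w | keep-heads us = refl

  perform-to : ∀ b w c m → perform (embed (b ∷ w) c) (tickTo (bit b ∷ []) m) ≡ embed w (applyᵗ c m)
  perform-to b w c m = cong (λ t → store _ (t ∷ []) _ []) (shiftᵗ-input w)

  two : ∀ {b w d us s s′ ss ss′ n} → map (perform (at (b ∷ w) d us)) (scan tick (at (b ∷ w) d us)) ≡ s ∷ s′ ∷ [] →
        ticking ⊢ s ⇓[ n ] ss → ticking ⊢ s′ ⇓[ n ] ss′ → ticking ⊢ at (b ∷ w) d us ⇓[ 2 + n ] (ss ++ ss′)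
  two {ss′ = ss′} e r r′ = loop refl (into e atom) (subst (λ ts → ticking ⊢* _ ⇓[ _ ] (_ ++ ts)) (++-identityʳ ss′) (r ∷ r′ ∷ []))

  performed : ∀ b w c {ms} → δ (state c) (Vec.map Tape.head (tapes c)) ≡ ms →
    map (perform (embed (b ∷ w) c)) (scan tick (embed (b ∷ w) c))
    ≡ map (perform (embed (b ∷ w) c)) (choices (state c) (bit b ∷ []) (Vec.map Tape.head (tapes c)) ms)
  performed b w c refl = refl

  length-double : ∀ n (ss ss′ : List Store) → length ss ≡ 2 ^ n → length ss′ ≡ 2 ^ n → length (ss ++ ss′) ≡ 2 ^ suc n
  length-double n ss ss′ l l′ = trans (length-++ ss) (trans (cong₂ _+_ l l′) (cong (2 ^ n +_) (sym (+-identityʳ _))))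

  dead-⇓ : ∀ w us → ∃[ ss ] (ticking ⊢ at w nothing us ⇓[ suc (2 * length w) ] ss × length ss ≡ 2 ^ length w × count ss ≡ 0)
  dead-⇓ []      us = _ , stop refl , refl , refl
  dead-⇓ (b ∷ w) us with dead-⇓ w us
  ... | ss , r , l , e = ss ++ ss ,
    relax (double-step (length w))
      (two (cong₂ (λ s s′ → s ∷ s′ ∷ []) (perform-stay b w nothing nothing us) (perform-stay b w nothing nothing us)) r r) ,
    length-double (length w) ss ss l l ,
    trans (count-++ ss ss) (cong₂ _+_ e e)

  -- The machine has to halt on every pair, including those whose clock is too short for `M`. So the
  -- runs and their number 2^|w| are established unconditionally, and only the count of successes
  -- assumes that the tree of `M` fits into the remaining clock.
  Counted : Word → Config → List Store → Set
  Counted w c ss = ∀ {ls} → c ↠[ length w ] ls → count ss ≡ length ls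

  live-⇓ : ∀ w c → ∃[ ss ] (ticking ⊢ embed w c ⇓[ suc (2 * length w) ] ss × length ss ≡ 2 ^ length w × Counted w c ss)
  live-⇓ []      c = _ , stop refl , refl , counted
    where
    counted : Counted [] c [ embed [] c ]
    counted (halt _ refl) with isAccepting c
    ... | true  = refl
    ... | false = refl
  live-⇓ (b ∷ w) c with δ (state c) (Vec.map Tape.head (tapes c)) in eq | binary (state c) (Vec.map Tape.head (tapes c))
  ... | [] | _ with live-⇓ w c | dead-⇓ w (tapes c)
  ...   | ss , r , l , e | ss′ , r′ , l′ , e′ = ss ++ ss′ ,
    relax (double-step (length w))
      (two (trans (performed b w c eq)
        (cong₂ (λ s s′ → s ∷ s′ ∷ []) (perform-stay b w (just (state c)) (just (state c)) (tapes c)) (perform-stay b w (just (state c)) nothing (tapes c)))) r r′) ,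
    length-double (length w) ss ss′ l l′ ,
    counted
    where
    counted : Counted (b ∷ w) c (ss ++ ss′)
    counted (halt h f) = trans (count-++ ss ss′) (trans (cong₂ _+_ (e (halt h f)) e′) (+-identityʳ _))
    counted (move h _) with trans (sym h) (cong (map (applyᵗ c)) eq)
    ... | ()
  live-⇓ (b ∷ w) c | m ∷ [] | _ with live-⇓ w (applyᵗ c m) | dead-⇓ w (tapes c)
  ...   | ss , r , l , e | ss′ , r′ , l′ , e′ = ss ++ ss′ ,
    relax (double-step (length w))
      (two (trans (performed b w c eq)
        (cong₂ (λ s s′ → s ∷ s′ ∷ []) (perform-to b w c m) (perform-stay b w (just (state c)) nothing (tapes c)))) r r′) ,
    length-double (length w) ss ss′ l l′ ,
    counted
    where
    counted : Counted (b ∷ w) c (ss ++ ss′)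
    counted (halt h _) with trans (sym h) (cong (map (applyᵗ c)) eq)
    ... | ()
    counted (move h t) with trans (sym h) (cong (map (applyᵗ c)) eq)
    counted (move h (_∷_ {ls = ls} t [])) | refl = trans (count-++ ss ss′) (trans (cong₂ _+_ (e t) e′)
      (sym (length-++ ls)))
  live-⇓ (b ∷ w) c | m ∷ m′ ∷ [] | _ with live-⇓ w (applyᵗ c m) | live-⇓ w (applyᵗ c m′)
  ...   | ss , r , l , e | ss′ , r′ , l′ , e′ = ss ++ ss′ ,
    relax (double-step (length w))
      (two (trans (performed b w c eq)
        (cong₂ (λ s s′ → s ∷ s′ ∷ []) (perform-to b w c m) (perform-to b w c m′))) r r′) ,
    length-double (length w) ss ss′ l l′ ,
    counted
    where
    counted : Counted (b ∷ w) c (ss ++ ss′)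
    counted (halt h _) with trans (sym h) (cong (map (applyᵗ c)) eq)
    ... | ()
    counted (move h t) with trans (sym h) (cong (map (applyᵗ c)) eq)
    counted (move h (_∷_ {ls = ls} t (_∷_ {ls = ks} t′ []))) | refl = trans (count-++ ss ss′) (trans (cong₂ _+_ (e t) (e′ t′))
      (sym (trans (length-++ ls) (cong (length ls +_) (trans (length-++ ks) (+-identityʳ _))))))
  live-⇓ (b ∷ w) c | _ ∷ _ ∷ _ ∷ _ | s≤s (s≤s ())

  complement-time : ℕ → ℕ
  complement-time n = 2 + 3 * n + (3 + 2 * n + (suc (2 * n) + 1))

  outcomes : Word → List Store
  outcomes u = proj₁ (live-⇓ (proj₂ (parse u)) (initial (proj₁ (parse u))))

  results : Word → List Store
  results u = filterᵇ (not ∘ successful ∘ register) (outcomes u)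

  prog-⇓ : ∀ u → prog ⊢ initialStore prog (just start) u ⇓[ complement-time (length u) ] results u
  prog-⇓ u = load-⇓ [] u ⨾₁
    relax (+-monoʳ-≤ 3 (*-monoʳ-≤ 2 (≤-trans (≤-reflexive (length-reverse x)) x≤)))
      (into₁ (cong (λ y → store (just start) (inputTape w ∷ []) (inputTape y ∷ replicate extra emptyTape) []) (reverse-involutive x)) (rewind-⇓ (reverse x))) ⨾₁
    seq (relax (s≤s (*-monoʳ-≤ 2 w≤)) (proj₁ (proj₂ (live-⇓ w (initial x))))) (guard-⇓ (not ∘ successful) (outcomes u))
    where
    x = proj₁ (parse u)
    w = proj₂ (parse u)
    x≤ : length x ≤ length u
    x≤ = ≤-trans (m≤m+n _ _) (parse-length u)
    w≤ : length w ≤ length u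
    w≤ = ≤-trans (m≤n+m _ (length x)) (parse-length u)

  complement-bounded : PolyBounded complement-time
  complement-bounded = bounded-+ (bounded-linear 2 3)
    (bounded-+ (bounded-linear 3 2)
      (bounded-+ (bounded-linear 1 2) (bounded-const 1)))

  complement : NPTM
  complement = compiled prog (just start) complement-bounded prog-⇓

  filter-not : ∀ (P : A → Bool) xs → length (filterᵇ (not ∘ P) xs) + length (filterᵇ P xs) ≡ length xs
  filter-not P []       = refl
  filter-not P (x ∷ xs) with P x
  ... | true  = trans (+-suc _ _) (cong suc (filter-not P xs))
  ... | false = cong suc (filter-not P xs)

  complement-acc : ∀ x w → eval bound (length x) ≤ length w → NPTM.acc complement (pair x w) + acc x ≡ 2 ^ length w
  complement-acc x w b≤ = trans (cong₂ _+_ (acc-≡ (pair x w)) accM) (trans (filter-not (successful ∘ register) (outcomes (pair x w))) total)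
    where
    acc-≡ : ∀ u → NPTM.acc complement u ≡ length (results u)
    acc-≡ u = trans (sym (length-map _ (NPTM.acceptingPaths complement u)))
      (trans (cong length (compiled-outputs prog (just start) complement-bounded prog-⇓ u)) (length-map written (results u)))
    accepting-tree : initial x ↠[ length w ] map trimmed (acceptingPaths x)
    accepting-tree = ↠-mono b≤ (subst (λ c → c ↠[ eval bound (length x) ] map trimmed (acceptingPaths x)) (trimmed-initial x)
      (Simulation.forward successors successorsᵗ isAccepting isAccepting trimmed successors-trimmed (λ _ → refl)
        (Machines.complete machine isAccepting (eval bound (length x)) (initial x) (halts x))))
    accM : acc x ≡ count (outcomes (pair x w))
    accM rewrite parse-pair x w = sym (trans (proj₂ (proj₂ (proj₂ (live-⇓ w (initial x)))) accepting-tree) (length-map trimmed (acceptingPaths x)))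
    total : length (outcomes (pair x w)) ≡ 2 ^ length w
    total rewrite parse-pair x w = proj₁ (proj₂ (proj₂ (live-⇓ w (initial x))))

-- Local modifications of machines

keep-act : ∀ {k} (ts : Vec (Tape A) k) → zipWith act (Vec.map (_, stay) (Vec.map Tape.head ts)) ts ≡ ts
keep-act []       = refl
keep-act (t ∷ ts) = cong (t ∷_) (keep-act ts)

length-filter-split : ∀ (P : A → Bool) xs →
  length xs ≡ length (filterᵇ P xs) + length (filterᵇ (not ∘ P) xs)
length-filter-split P []       = refl
length-filter-split P (x ∷ xs) with P x
... | true  = cong suc (length-filter-split P xs)
... | false = trans (cong suc (length-filter-split P xs)) (sym (+-suc _ _))

-- Every leaf is replaced by one or several leaves, depending on whether it
-- accepts; the new leaves accept or reject as prescribed by e and es.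
module Extension (N : NPTM) (e : Bool → Bool) (es : Bool → List Bool) where
  open NPTM N
  module M = Machine machine
  module R = Run machine

  Heads OldMove NewMove : Set
  Heads   = Vec (Symbol M.Aux) (suc M.extra)
  OldMove = Move M.State M.Aux (suc M.extra)
  NewMove = Move (M.State ⊎ Bool) M.Aux (suc M.extra)

  goto : Heads → Bool → NewMove
  goto h b = record { target = inj₂ b ; actions = Vec.map (_, stay) h ; emitted = nothing }

  lift : OldMove → NewMove
  lift m = record { target = inj₁ (Move.target m) ; actions = Move.actions m ; emitted = Move.emitted m }

  -- `e` yields one new leaf in any case. With an empty list the old leaf would remain a leaf, and a
  -- rejecting one.
  alternatives : M.State → Heads → List (OldMove) →
                 List (NewMove)
  alternatives q h []         = map (goto h) (e (M.accepting q) ∷ es (M.accepting q))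
  alternatives q h ms@(_ ∷ _) = map lift ms

  extended : Machine
  extended = record
    { State     = M.State ⊎ Bool
    ; Aux       = M.Aux
    ; State-fin = finite-⊎ M.State-fin finite-Bool
    ; Aux-fin   = M.Aux-fin
    ; extra     = M.extra
    ; start     = inj₁ M.start
    ; accepting = Sum.[ (λ _ → false) , id ]
    ; δ         = λ { (inj₁ q) h → alternatives q h (M.δ q h) ; (inj₂ b) h → [] }
    }

  open Run extended using (Config; config; state; tapes; output; successors; initial; isAccepting; apply)
  open Tree R.successors (λ _ → true) using (halt; move; []; _∷_) renaming (_↠[_]_ to _⇝[_]_; _↠*[_]_ to _⇝*[_]_)
  module T = Tree successors (λ _ → true)
  open T using (_↠[_]_; _↠*[_]_)

  embed : R.Config → Config
  embed c = config (inj₁ (R.state c)) (R.tapes c) (R.output c)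

  final : R.Config → Bool → Config
  final c b = config (inj₂ b) (R.tapes c) (R.output c)

  finals : R.Config → List Config
  finals c = map (final c) (e (R.isAccepting c) ∷ es (R.isAccepting c))

  apply-goto : ∀ c b → apply (embed c) (goto (Vec.map Tape.head (R.tapes c)) b) ≡ final c b
  apply-goto (R.config q ts w) b = cong₂ (config (inj₂ b)) (keep-act ts) (++-identityʳ w)

  successors-leaf : ∀ c → R.successors c ≡ [] → successors (embed c) ≡ finals c
  successors-leaf c@(R.config q ts w) eq with M.δ q (Vec.map Tape.head ts)
  successors-leaf c@(R.config q ts w) eq | [] = cong₂ _∷_ (apply-goto c _)
    (trans (sym (map-∘ (es (M.accepting q)))) (map-cong (apply-goto c) (es (M.accepting q))))

  successors-inner : ∀ c {d ds} → R.successors c ≡ d ∷ ds → successors (embed c) ≡ map embed (d ∷ ds)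
  successors-inner c = lemma (M.δ (R.state c) (Vec.map Tape.head (R.tapes c)))
    where
    lemma : ∀ ms {d ds} → map (R.apply c) ms ≡ d ∷ ds →
            map (apply (embed c)) (alternatives (R.state c) (Vec.map Tape.head (R.tapes c)) ms) ≡ map embed (d ∷ ds)
    lemma (m ∷ ms) eq = trans (cong (_ ∷_) (trans (sym (map-∘ ms)) (map-∘ ms))) (cong (map embed) eq)

  stopped : ∀ c bs n → map (final c) bs ↠*[ n ] map (final c) bs
  stopped c []       n = T.[]
  stopped c (b ∷ bs) n = T.halt refl refl T.∷ stopped c bs n

  mutual
    extend : ∀ {n c ls} → c ⇝[ n ] ls → embed c ↠[ suc n ] concatMap finals ls
    extend {n} {c} (halt eq refl) = T.move (successors-leaf c eq)
      (subst (finals c ↠*[ n ]_) (sym (++-identityʳ (finals c))) (stopped c _ n))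
    extend {c = c} (move eq r) = T.move (successors-inner c eq) (extend* r)

    extend* : ∀ {n cs ls} → cs ⇝*[ n ] ls → map embed cs ↠*[ suc n ] concatMap finals ls
    extend* []       = T.[]
    extend* (_∷_ {ls = ls} {ks} r rs) rewrite concatMap-++ finals ls ks = extend r T.∷ extend* rs

  leaves-tree : ∀ x → initial x ↠[ eval ((1 ∷ []) ⊕ bound) (length x) ] concatMap finals (paths x)
  leaves-tree x = T.↠-mono (≤-reflexive (sym (eval-suc bound (length x)))) (subst (λ ls → initial x ↠[ suc (eval bound (length x)) ] concatMap finals ls)
    (filter-true (paths x)) (extend (Machines.complete machine (λ _ → true) (eval bound (length x)) (R.initial x) (halts x))))

  extension : NPTM
  extension = record
    { machine = extended
    ; bound   = (1 ∷ []) ⊕ bound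
    ; halts   = λ x → proj₁ (Machines.sound extended (λ _ → true) (leaves-tree x))
    }

  extension-paths : ∀ x → NPTM.paths extension x ≡ concatMap finals (paths x)
  extension-paths x = trans (sym (filter-true _)) (proj₂ (Machines.sound extended (λ _ → true) (leaves-tree x)))

  countᵇ : (Bool → Bool) → List Bool → ℕ
  countᵇ P bs = length (filterᵇ P bs)

  finals-count : ∀ P c → length (filterᵇ (P ∘ isAccepting) (finals c))
                       ≡ countᵇ P (e (R.isAccepting c) ∷ es (R.isAccepting c))
  finals-count P c = trans (cong length (filter-map (P ∘ isAccepting) (final c) bs)) (length-map (final c) (filterᵇ P bs))
    where bs = e (R.isAccepting c) ∷ es (R.isAccepting c)

  count-finals : ∀ P ls → length (filterᵇ (P ∘ isAccepting) (concatMap finals ls))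
    ≡ countᵇ P (e true ∷ es true) * length (filterᵇ R.isAccepting ls)
    + countᵇ P (e false ∷ es false) * length (filterᵇ (not ∘ R.isAccepting) ls)
  count-finals P []       = sym (cong₂ _+_ (*-zeroʳ (countᵇ P (e true ∷ es true))) (*-zeroʳ (countᵇ P (e false ∷ es false))))
  count-finals P (c ∷ ls) rewrite filter-++ᵇ (P ∘ isAccepting) (finals c) (concatMap finals ls)
    | length-++ (filterᵇ (P ∘ isAccepting) (finals c)) {filterᵇ (P ∘ isAccepting) (concatMap finals ls)}
    | finals-count P c | count-finals P ls with R.isAccepting c
  ... | true  = solve 4 (λ t a f r → t :+ (t :* a :+ f :* r) := t :* (con 1 :+ a) :+ f :* r) refl
                  (countᵇ P (e true ∷ es true)) (length (filterᵇ R.isAccepting ls))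
                  (countᵇ P (e false ∷ es false)) (length (filterᵇ (not ∘ R.isAccepting) ls))
    where open +-*-Solver
  ... | false = solve 4 (λ t a f r → f :+ (t :* a :+ f :* r) := t :* a :+ f :* (con 1 :+ r)) refl
                  (countᵇ P (e true ∷ es true)) (length (filterᵇ R.isAccepting ls))
                  (countᵇ P (e false ∷ es false)) (length (filterᵇ (not ∘ R.isAccepting) ls))
    where open +-*-Solver

  -- The predicate covers three counts at once: all leaves (constantly `true`), accepting ones
  -- (`id`) and rejecting ones (`not`).
  extension-count : ∀ P x → length (filterᵇ (P ∘ isAccepting) (NPTM.paths extension x))
                  ≡ countᵇ P (e true ∷ es true) * acc x + countᵇ P (e false ∷ es false) * rej x
  extension-count P x rewrite extension-paths x = count-finals P (paths x)

  all-accepted : (∀ b → e b ≡ true) → (∀ b → es b ≡ []) → ∀ x → NPTM.acceptedOutputs extension x ≡ allOutputs x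
  all-accepted e≡ es≡ x rewrite extension-paths x = lemma (paths x)
    where
    lemma : ∀ ls → map output (filterᵇ isAccepting (concatMap finals ls)) ≡ map R.output ls
    lemma []       = refl
    lemma (c ∷ ls) rewrite e≡ (R.isAccepting c) | es≡ (R.isAccepting c) = cong (R.output c ∷_) (lemma ls)

-- The flag survives only along first alternatives, hence on exactly one path, and this is the only
-- path that rejects. So `Total` minus one becomes a number of accepting paths.
module Leftmost (N : NPTM) where
  open NPTM N
  module M = Machine machine
  module R = Run machine

  OldMove NewMove : Set
  OldMove = Move M.State M.Aux (suc M.extra)
  NewMove = Move (M.State × Bool) M.Aux (suc M.extra)

  to : Bool → OldMove → NewMove
  to f m = record { target = Move.target m , f ; actions = Move.actions m ; emitted = Move.emitted m }

  mark : Bool → List (OldMove) → List (NewMove)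
  mark f []       = []
  mark f (m ∷ ms) = to f m ∷ map (to false) ms

  marked : Machine
  marked = record
    { State     = M.State × Bool
    ; Aux       = M.Aux
    ; State-fin = finite-× M.State-fin finite-Bool
    ; Aux-fin   = M.Aux-fin
    ; extra     = M.extra
    ; start     = M.start , true
    ; accepting = not ∘ proj₂
    ; δ         = λ { (q , f) h → mark f (M.δ q h) }
    }

  open Run marked using (Config; config; state; tapes; output; successors; initial; isAccepting; apply)
  open Tree successors (λ _ → true)

  forget : Config → R.Config
  forget c = R.config (proj₁ (state c)) (tapes c) (output c)

  leftmost : Config → Bool
  leftmost c = proj₂ (state c)

  successors-forget : ∀ c → R.successors (forget c) ≡ map forget (successors c)
  successors-forget (config (q , f) ts w) with M.δ q (Vec.map Tape.head ts)
  ... | []     = refl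
  ... | m ∷ ms = cong (_ ∷_) (trans (map-∘ ms) (map-∘ (map (to false) ms)))

  one-leftmost : Bool → ℕ
  one-leftmost f = if f then 1 else 0

  unmarked : ∀ {c} ms → All (λ d → leftmost d ≡ false) (map (apply c) (map (to false) ms))
  unmarked []           = []
  unmarked {c} (m ∷ ms) = refl ∷ unmarked {c} ms

  mutual
    leftmost-count : ∀ {n c ls} → c ↠[ n ] ls → length (filterᵇ leftmost ls) ≡ one-leftmost (leftmost c)
    leftmost-count {c = config (q , true)  ts w} (halt e refl) = refl
    leftmost-count {c = config (q , false) ts w} (halt e refl) = refl
    leftmost-count {c = config (q , f) ts w} (move e r) with M.δ q (Vec.map Tape.head ts)
    leftmost-count {c = c@(config (q , f) ts w)} (move refl (_∷_ {ls = ls} {ks} r rs)) | m ∷ ms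
      rewrite filter-++ᵇ leftmost ls ks | length-++ (filterᵇ leftmost ls) {filterᵇ leftmost ks}
            | leftmost-count r | no-leftmost rs (unmarked {c} ms) = +-identityʳ _

    no-leftmost : ∀ {n cs ls} → cs ↠*[ n ] ls → All (λ d → leftmost d ≡ false) cs → length (filterᵇ leftmost ls) ≡ 0
    no-leftmost []       []       = refl
    no-leftmost (_∷_ {ls = ls} {ks} r rs) (e ∷ es)
      rewrite filter-++ᵇ leftmost ls ks | length-++ (filterᵇ leftmost ls) {filterᵇ leftmost ks}
            | leftmost-count r | e | no-leftmost rs es = refl

  marked-tree : ∀ x → ∃[ ls ] (initial x ↠[ eval bound (length x) ] ls × map forget ls ≡ paths x)
  marked-tree x with Simulation.backward successors R.successors (λ _ → true) (λ _ → true) forget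
    successors-forget (λ _ → refl) (initial x)
    (Machines.complete machine (λ _ → true) (eval bound (length x)) (R.initial x) (halts x))
  ... | ls , r , e = ls , r , trans e (filter-true (paths x))

  butLeftmost : NPTM
  butLeftmost = record
    { machine = marked
    ; bound   = bound
    ; halts   = λ x → proj₁ (Machines.sound marked (λ _ → true) (proj₁ (proj₂ (marked-tree x))))
    }

  butLeftmost-acc : ∀ x → suc (NPTM.acc butLeftmost x) ≡ Total x
  butLeftmost-acc x with marked-tree x
  ... | ls , r , e = begin
    suc (length (filterᵇ isAccepting (NPTM.paths butLeftmost x)))  ≡⟨ cong (suc ∘ length ∘ filterᵇ isAccepting) paths-≡ ⟩
    1 + length (filterᵇ (not ∘ leftmost) ls)  ≡⟨ cong (_+ length (filterᵇ (not ∘ leftmost) ls)) (leftmost-count r) ⟨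
    length (filterᵇ leftmost ls) + length (filterᵇ (not ∘ leftmost) ls)  ≡⟨ length-filter-split leftmost ls ⟨
    length ls  ≡⟨ length-map forget ls ⟨
    length (map forget ls)  ≡⟨ cong length e ⟩
    Total x  ∎
    where
    open ≡-Reasoning
    paths-≡ : NPTM.paths butLeftmost x ≡ ls
    paths-≡ = trans (sym (filter-true _)) (proj₂ (Machines.sound marked (λ _ → true) r))

-- An accepting leaf is added beside the old root. As `PP` compares strictly, v ≤ f(x) is asked as v
-- < f(x) + 1; with the increment made by the machine, the threshold remains the guessed word
-- itself.
module OneMore (N : NPTM) where
  open NPTM N
  module M = Machine machine
  module R = Run machine

  Heads OldMove NewMove : Set
  Heads   = Vec (Symbol M.Aux) (suc M.extra)
  OldMove = Move M.State M.Aux (suc M.extra)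
  NewMove = Move (M.State ⊎ Bool) M.Aux (suc M.extra)

  goto : Heads → M.State ⊎ Bool → NewMove
  goto h q = record { target = q ; actions = Vec.map (_, stay) h ; emitted = nothing }

  lift : OldMove → NewMove
  lift m = record { target = inj₁ (Move.target m) ; actions = Move.actions m ; emitted = Move.emitted m }

  rooted : Machine
  rooted = record
    { State     = M.State ⊎ Bool
    ; Aux       = M.Aux
    ; State-fin = finite-⊎ M.State-fin finite-Bool
    ; Aux-fin   = M.Aux-fin
    ; extra     = M.extra
    ; start     = inj₂ false
    ; accepting = Sum.[ M.accepting , id ]
    ; δ         = λ { (inj₁ q)     h → map lift (M.δ q h)
                    ; (inj₂ false) h → goto h (inj₂ true) ∷ goto h (inj₁ M.start) ∷ []
                    ; (inj₂ true)  h → [] }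
    }

  open Run rooted using (Config; config; state; tapes; output; successors; initial; isAccepting)
  open Tree successors isAccepting

  embed : R.Config → Config
  embed c = config (inj₁ (R.state c)) (R.tapes c) (R.output c)

  successors-embed : ∀ c → successors (embed c) ≡ map embed (R.successors c)
  successors-embed (R.config q ts w) = trans (sym (map-∘ ms)) (map-∘ ms)
    where ms = M.δ q (Vec.map Tape.head ts)

  tapes₀ : Word → Vec (Tape M.Aux) (suc M.extra)
  tapes₀ x = inputTape x ∷ replicate M.extra emptyTape

  rooted-tree : ∀ x → initial x ↠[ eval ((1 ∷ []) ⊕ bound) (length x) ]
                  (config (inj₂ true) (tapes₀ x) [] ∷ map embed (acceptingPaths x))
  rooted-tree x = ↠-mono (≤-reflexive (sym (eval-suc bound (length x)))) (move successors-initial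
    (subst ((stopped ∷ embed (R.initial x) ∷ []) ↠*[ eval bound (length x) ]_)
      (cong (stopped ∷_) (++-identityʳ (map embed (acceptingPaths x)))) (halt {c = stopped} refl refl ∷
      (Simulation.forward R.successors successors R.isAccepting isAccepting embed successors-embed (λ _ → refl)
        (Machines.complete machine R.isAccepting (eval bound (length x)) (R.initial x) (halts x)) ∷ []))))
    where
    stopped : Config
    stopped = config (inj₂ true) (tapes₀ x) []
    successors-initial : successors (initial x) ≡ config (inj₂ true) (tapes₀ x) [] ∷ embed (R.initial x) ∷ []
    successors-initial = cong₂ (λ ts us → config (inj₂ true) ts [] ∷ config (inj₁ M.start) us [] ∷ [])
      (keep-act (tapes₀ x)) (keep-act (tapes₀ x))

  oneMore : NPTM
  oneMore = record
    { machine = rooted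
    ; bound   = (1 ∷ []) ⊕ bound
    ; halts   = λ x → proj₁ (Machines.sound rooted isAccepting (rooted-tree x))
    }

  oneMore-acc : ∀ x → NPTM.acc oneMore x ≡ suc (acc x)
  oneMore-acc x = trans (cong length (proj₂ (Machines.sound rooted isAccepting (rooted-tree x))))
    (cong suc (length-map embed (acceptingPaths x)))

-- Bounded branching

Bounded : Set → Set
Bounded A = ∀ (f : A → ℕ) → ∃[ b ] ∀ a → f a ≤ b

bounded-Fin : ∀ n → Bounded (Fin n)
bounded-Fin zero    f = 0 , λ ()
bounded-Fin (suc n) f with bounded-Fin n (f ∘ suc)
... | b , f≤ = f zero + b , λ { zero → m≤m+n (f zero) b ; (suc i) → ≤-trans (f≤ i) (m≤n+m b (f zero)) }

bounded-finite : Finite A → Bounded A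
bounded-finite (n , i) f with bounded-Fin n (f ∘ Inverse.from i)
... | b , f≤ = b , λ a → subst (λ a → f a ≤ b) (Inverse.strictlyInverseʳ i a) (f≤ (Inverse.to i a))

bounded-Symbol : Bounded A → Bounded (Symbol A)
bounded-Symbol B f with B (f ∘ aux)
... | b , f≤ = f blank + (f (bit zero) + (f (bit (suc zero)) + b)) , λ
  { blank            → m≤m+n (f blank) _
  ; (bit zero)       → ≤-trans (m≤m+n (f (bit zero)) _) (m≤n+m _ (f blank))
  ; (bit (suc zero)) → ≤-trans (≤-trans (m≤m+n (f (bit (suc zero))) _) (m≤n+m _ (f (bit zero)))) (m≤n+m _ (f blank))
  ; (aux a)          → ≤-trans (≤-trans (≤-trans (f≤ a) (m≤n+m b (f (bit (suc zero))))) (m≤n+m _ (f (bit zero)))) (m≤n+m _ (f blank)) }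

bounded-Vec : ∀ n → Bounded A → Bounded (Vec A n)
bounded-Vec zero    B f = f [] , λ { [] → ≤-refl }
bounded-Vec (suc n) B f with B (λ a → proj₁ (bounded-Vec n B (f ∘ (a ∷_))))
... | b , f≤ = b , λ { (a ∷ v) → ≤-trans (proj₂ (bounded-Vec n B (f ∘ (a ∷_))) v) (f≤ a) }

-- A machine may list any number of alternatives in a given situation, but there are only finitely
-- many states and tuples of scanned symbols.
branching : ∀ M → ∃[ b ] ∀ q h → length (Machine.δ M q h) ≤ b
branching M with bounded-finite State-fin (λ q → proj₁ (heads (λ h → length (δ q h))))
  where
  open Machine M
  heads : Bounded (Vec (Symbol Aux) (suc extra))
  heads = bounded-Vec (suc extra) (bounded-Symbol (bounded-finite Aux-fin))
... | b , ≤b = b , λ q h → ≤-trans (proj₂ (bounded-Vec (suc extra) (bounded-Symbol (bounded-finite Aux-fin)) (λ h → length (δ q h))) h) (≤b q)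
  where open Machine M

drop-suc : ∀ k (xs : List A) {y ys} → List.drop k xs ≡ y ∷ ys → List.drop (suc k) xs ≡ ys
drop-suc zero    (x ∷ xs) refl = refl
drop-suc (suc k) (x ∷ xs) e    = drop-suc k xs e

-- The alternatives of a state are tried one after the other, so that every
-- step chooses between taking the current alternative (which is recorded by
-- emitting 0) and passing on to the next one (recorded by 1).  Hence the
-- output identifies the computation path.
module Binary (N : NPTM) where
  open NPTM N
  module M = Machine machine
  module R = Run machine

  width : ℕ
  width = proj₁ (branching machine)

  -- The truncation is never felt: `branch` maintains that the index plus the number of remaining
  -- alternatives is at most `width`.
  clip : ℕ → Fin (suc width)
  clip k = fromℕ< (s≤s (m⊓n≤n k width))

  toℕ-clip : ∀ {k} → k ≤ width → toℕ (clip k) ≡ k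
  toℕ-clip k≤ = trans (toℕ-fromℕ< _) (m≤n⇒m⊓n≡m k≤)

  State : Set
  State = M.State × Fin (suc width)

  Heads OldMove NewMove : Set
  Heads   = Vec (Symbol M.Aux) (suc M.extra)
  OldMove = Move M.State M.Aux (suc M.extra)
  NewMove = Move State M.Aux (suc M.extra)

  take′ : OldMove → NewMove
  take′ m = record { target = Move.target m , zero ; actions = Move.actions m ; emitted = just zero }

  pass : M.State → Fin (suc width) → Heads → NewMove
  pass q i h = record { target = q , clip (suc (toℕ i)) ; actions = Vec.map (_, stay) h ; emitted = just (suc zero) }

  choose : M.State → Fin (suc width) → Heads →
           List (OldMove) → List (NewMove)
  choose q i h []          = []
  choose q i h (m ∷ [])    = [ take′ m ]
  choose q i h (m ∷ _ ∷ _) = take′ m ∷ pass q i h ∷ []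

  binarised : Machine
  binarised = record
    { State     = State
    ; Aux       = M.Aux
    ; State-fin = finite-× M.State-fin finite-Fin
    ; Aux-fin   = M.Aux-fin
    ; extra     = M.extra
    ; start     = M.start , zero
    ; accepting = M.accepting ∘ proj₁
    ; δ         = λ { (q , i) h → choose q i h (List.drop (toℕ i) (M.δ q h)) }
    }

  binary : ∀ q h → length (Machine.δ binarised q h) ≤ 2
  binary (q , i) h with List.drop (toℕ i) (M.δ q h)
  ... | []         = z≤n
  ... | _ ∷ []     = s≤s z≤n
  ... | _ ∷ _ ∷ _  = s≤s (s≤s z≤n)

  open Run binarised using (Config; config; state; tapes; output; successors; initial; isAccepting; apply)
  open Tree R.successors R.isAccepting using (halt; move; []; _∷_) renaming (_↠[_]_ to _⇝[_]_; _↠*[_]_ to _⇝*[_]_)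
  module T = Tree successors isAccepting
  open T using (_↠[_]_; _↠*[_]_)

  embed : Fin (suc width) → Word → R.Config → Config
  embed i o c = config (R.state c , i) (R.tapes c) o

  -- The common prefix `o` drives the induction: the bit after it is 0 in one subtree and 1 in the
  -- other, which makes their outputs disjoint.
  Distinct : Word → List Config → Set
  Distinct o ls = All (λ l → ∃[ u ] output l ≡ o ++ u) ls × Unique (map output ls)

  extend : ∀ {o} b {ls} → Distinct (o ++ [ b ]) ls → All (λ l → ∃[ u ] output l ≡ o ++ b ∷ u) ls
  extend {o} b (ps , _) = All.map (λ { (u , e) → u , trans e (++-assoc o [ b ] u) }) ps

  prefixed : ∀ {o b ls} → All (λ l → ∃[ u ] output l ≡ o ++ b ∷ u) ls → All (λ l → ∃[ u ] output l ≡ o ++ u) ls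
  prefixed {b = b} = All.map λ { (u , e) → b ∷ u , e }

  distinct-++ : ∀ {o ls ks} → Distinct (o ++ [ zero ]) ls → Distinct (o ++ [ suc zero ]) ks → Distinct o (ls ++ ks)
  distinct-++ {o} {ls} {ks} d@(_ , u) d′@(_ , u′) = ++⁺ (prefixed (extend zero d)) (prefixed (extend (suc zero) d′)) ,
    subst Unique (sym (map-++ output ls ks)) (Unique.++⁺ u u′ disjoint)
    where
    disjoint : ∀ {w} → w ∈ map output ls × w ∈ map output ks → ⊥
    disjoint (p , q) with ∈-map⁻ output p | ∈-map⁻ output q
    ... | l , l∈ , refl | k , k∈ , e with All.lookup (extend zero d) l∈ | All.lookup (extend (suc zero) d′) k∈
    ... | _ , e₁ | _ , e₂ with ++-cancelˡ o _ _ (trans (sym e₁) (trans e e₂))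
    ... | ()

  shorten : ∀ {o b ls} → Distinct (o ++ [ b ]) ls → Distinct o ls
  shorten {b = b} d = prefixed (extend b d) , proj₂ d

  Result : Fin (suc width) → Word → R.Config → ℕ → List R.Config → Set
  Result i o c n ls = ∃[ ks ] (embed i o c ↠[ n ] ks × length ks ≡ length ls × Distinct o ks)

  mutual
    -- One step among r alternatives becomes at most r binary steps, hence the factor `width` in the
    -- height.
    binarise : ∀ {n c ls} o → c ⇝[ n ] ls → Result zero o c (n * width) ls
    binarise {c = c} o (halt e refl) = _ , T.halt (halted c e) refl , length-≡ , distinct
      where
      halted : ∀ c → R.successors c ≡ [] → successors (embed zero o c) ≡ []
      halted (R.config q ts w) e with M.δ q (Vec.map Tape.head ts)
      ... | [] = refl
      length-≡ : length (filterᵇ isAccepting [ embed zero o c ]) ≡ length (filterᵇ R.isAccepting [ c ])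
      length-≡ with R.isAccepting c
      ... | true  = refl
      ... | false = refl
      distinct : Distinct o (filterᵇ isAccepting [ embed zero o c ])
      distinct with R.isAccepting c
      ... | true  = ([] , sym (++-identityʳ o)) ∷ [] , [] ∷ []
      ... | false = [] , []
    binarise {suc n} {c} {ls} o (move e r) =
      longer (branch zero refl ≤width (subst (_⇝*[ n ] ls) (sym e) r) (nonempty e))
      where
      ms = M.δ (R.state c) (Vec.map Tape.head (R.tapes c))
      ≤width : length ms ≤ width
      ≤width = proj₂ (branching machine) (R.state c) (Vec.map Tape.head (R.tapes c))
      longer : Result zero o c (length ms + n * width) ls → Result zero o c (suc n * width) ls
      longer (ks , t , p) = ks , T.↠-mono (+-monoˡ-≤ (n * width) ≤width) t , p
      nonempty : ∀ {d ds} → map (R.apply c) ms ≡ d ∷ ds → 0 < length ms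
      nonempty e with ms
      ... | _ ∷ _ = s≤s z≤n

    branch : ∀ {n c o ls ms} i → let h = Vec.map Tape.head (R.tapes c) in
      List.drop (toℕ i) (M.δ (R.state c) h) ≡ ms → toℕ i + length ms ≤ width →
      map (R.apply c) ms ⇝*[ n ] ls → 0 < length ms → Result i o c (length ms + n * width) ls
    branch {n} {c} {o} {ms = m ∷ []} i e _ (_∷_ {ls = ls} r []) _ with binarise (o ++ [ zero ]) r
    ... | ks , t , l , d = ks , T.move successors-≡ (subst (_ ↠*[ _ ]_) (++-identityʳ ks) (t T.∷ T.[])) ,
      trans l (cong length (sym (++-identityʳ ls))) , shorten d
      where
      successors-≡ : successors (embed i o c) ≡ [ embed zero (o ++ [ zero ]) (R.apply c m) ]
      successors-≡ rewrite e = refl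
    branch {n} {c} {o} {ms = m ∷ ms@(_ ∷ _)} i e h (_∷_ {ls = ls} {ls′} r rs) _
      with binarise (o ++ [ zero ]) r | branch {o = o ++ [ suc zero ]} (clip (suc (toℕ i)))
             (trans (cong (λ k → List.drop k (M.δ (R.state c) (Vec.map Tape.head (R.tapes c)))) i≡) (drop-suc (toℕ i) _ e))
             (≤-trans (≤-reflexive (trans (cong (_+ length ms) i≡) (sym (+-suc (toℕ i) (length ms))))) h) rs (s≤s z≤n)
      where
      i≡ : toℕ (clip (suc (toℕ i))) ≡ suc (toℕ i)
      i≡ = toℕ-clip (≤-trans (≤-trans (s≤s (m≤m+n (toℕ i) (length ms))) (≤-reflexive (sym (+-suc (toℕ i) (length ms))))) h)
    ... | ks , t , l , d | ks′ , t′ , l′ , d′ = ks ++ ks′ ,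
      T.move successors-≡ (T.↠-mono (m≤n+m _ (length ms)) t T.∷ subst (_ ↠*[ _ ]_) (++-identityʳ ks′) (t′ T.∷ T.[])) ,
      trans (length-++ ks) (trans (cong₂ _+_ l l′) (sym (length-++ ls))) , distinct-++ d d′
      where
      successors-≡ : successors (embed i o c) ≡ embed zero (o ++ [ zero ]) (R.apply c m) ∷ embed (clip (suc (toℕ i))) (o ++ [ suc zero ]) c ∷ []
      successors-≡ rewrite e = cong (λ ts → embed zero (o ++ [ zero ]) (R.apply c m) ∷ config _ ts _ ∷ []) (keep-act (R.tapes c))

  binary-tree : ∀ x → ∃[ ks ] (initial x ↠[ eval (bound ⊗ (width ∷ [])) (length x) ] ks × length ks ≡ acc x × Distinct [] ks)
  binary-tree x with binarise [] (Machines.complete machine R.isAccepting (eval bound (length x)) (R.initial x) (halts x))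
  ... | ks , t , l , d = ks , T.↠-mono (≤-reflexive (sym eval-≡)) t , l , d
    where
    eval-≡ : eval (bound ⊗ (width ∷ [])) (length x) ≡ eval bound (length x) * width
    eval-≡ = trans (eval-⊗ bound (width ∷ []) (length x))
      (cong (eval bound (length x) *_) (trans (cong (width +_) (*-zeroʳ (length x))) (+-identityʳ width)))

  binaryNPTM : NPTM
  binaryNPTM = record
    { machine = binarised
    ; bound   = bound ⊗ (width ∷ [])
    ; halts   = λ x → proj₁ (Machines.sound binarised isAccepting (proj₁ (proj₂ (binary-tree x))))
    }

  accepting-≡ : ∀ x → NPTM.acceptingPaths binaryNPTM x ≡ proj₁ (binary-tree x)
  accepting-≡ x = proj₂ (Machines.sound binarised isAccepting (proj₁ (proj₂ (binary-tree x))))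

  binary-acc : ∀ x → NPTM.acc binaryNPTM x ≡ acc x
  binary-acc x = trans (cong length (accepting-≡ x)) (proj₁ (proj₂ (proj₂ (binary-tree x))))

  binary-span : ∀ x → NPTM.span binaryNPTM x ≡ acc x
  binary-span x = trans (cong length (deduplicate-unique (subst (Unique ∘ map output) (sym (accepting-≡ x))
      (proj₂ (proj₂ (proj₂ (proj₂ (binary-tree x))))))))
    (trans (length-map output (NPTM.acceptingPaths binaryNPTM x)) (binary-acc x))
    where
    deduplicate-unique : ∀ {ws : List Word} → Unique ws → deduplicate (≡-dec Fin._≟_) ws ≡ ws
    deduplicate-unique []       = refl
    deduplicate-unique {w ∷ ws} (w∉ ∷ u) rewrite deduplicate-unique u = cong (w ∷_) (filter-all _ w∉)

-- Deterministic machines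

module _ (N : NPTM) (deterministic : Deterministic (NPTM.machine N)) where
  open NPTM N
  open Run machine

  one-leaf : ∀ n c → length (leaves n c) ≡ 1
  one-leaf zero    c = refl
  one-leaf (suc n) c with successors c in eq
  ... | []         = refl
  ... | d ∷ []     = trans (cong length (++-identityʳ (leaves n d))) (one-leaf n d)
  ... | _ ∷ _ ∷ _ with subst (_≤ 1) (trans (sym (length-map (apply c) (Machine.δ machine (state c) (Vec.map Tape.head (tapes c)))))
                         (cong length eq)) (deterministic (state c) (Vec.map Tape.head (tapes c)))
  ...   | s≤s ()

  -- `FP` refers to the outputs of all paths, whereas machines are analysed here through accepted
  -- outputs. A deterministic machine has a single path, so an accepted output is the only one.
  deterministic-outputs : ∀ {x w} → acceptedOutputs x ≡ [ w ] → allOutputs x ≡ [ w ]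
  deterministic-outputs {x} e = lemma (paths x) (one-leaf (eval bound (length x)) (initial x)) e
    where
    lemma : ∀ ls {w} → length ls ≡ 1 → map output (filterᵇ isAccepting ls) ≡ [ w ] → map output ls ≡ [ w ]
    lemma (c ∷ []) l e with isAccepting c
    ... | true = e

-- Machine operations as seen through accepted outputs

open NPTM using (acceptedOutputs; acc)

record Mealy : Set₁ where
  field
    State     : Set
    State-fin : Finite State
    first     : State
    read      : State → Bit → State × Emission
    finish    : State → Emission

  translate : State → Word → Word
  translate s []      = emitted (finish s)
  translate s (b ∷ w) = emitted (proj₂ (read s b)) ++ translate (proj₁ (read s b)) w

  mealy : Word → Word
  mealy = translate first

  transducer : Transducer
  transducer = record
    { State     = State
    ; State-fin = State-fin
    ; first     = first
    ; read      = λ s b → [ read s b ]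
    ; finish    = λ s → [ finish s ]
    }

-- Abstract, because unfolding the machines during type checking is too expensive.
abstract
  transducerNPTM : Transducer → NPTM
  transducerNPTM = Transduction.transducer

  transducerNPTM-outputs : ∀ S x → acceptedOutputs (transducerNPTM S) x ≡ Transducer.transduce S (Transducer.first S) x
  transducerNPTM-outputs = Transduction.transducer-outputs

  transducerNPTM-deterministic : ∀ S →
    (∀ s b → length (Transducer.read S s b) ≤ 1) → (∀ s → length (Transducer.finish S s) ≤ 1) →
    Deterministic (NPTM.machine (transducerNPTM S))
  transducerNPTM-deterministic = Transduction.transducer-deterministic

  infixl 5 _⟫_

  _⟫_ : NPTM → NPTM → NPTM
  _⟫_ = Composition.composite

  ⟫-outputs′ : ∀ T N x → acceptedOutputs (T ⟫ N) x ≡ concatMap (acceptedOutputs N) (acceptedOutputs T x)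
  ⟫-outputs′ = Composition.composite-outputs

  graph : NPTM → NPTM
  graph = Graph.graph

  graph-outputs : ∀ N x → acceptedOutputs (graph N) x ≡ map (pair x) (acceptedOutputs N x)
  graph-outputs = Graph.graph-outputs

  subtractor : NPTM
  subtractor = Subtraction.subtractor

  subtractor-outputs : ∀ x y → acceptedOutputs subtractor (pair x y) ≡ Subtraction.outcome (subtract false (reverse x) (reverse y))
  subtractor-outputs = Subtraction.subtractor-outputs

  squarer : NPTM
  squarer = Squaring.squarer

  squarer-outputs : ∀ x → ∃[ w ] (acceptedOutputs squarer x ≡ [ w ] × length x * length x ≤ length w)
  squarer-outputs x = _ , Squaring.squarer-outputs x , Squaring.squarer-length (length x)

module _ (S : Mealy) where
  open Mealy S

  mealyNPTM : NPTM
  mealyNPTM = transducerNPTM transducer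

  mealyNPTM-outputs : ∀ x → acceptedOutputs mealyNPTM x ≡ [ mealy x ]
  mealyNPTM-outputs x = trans (transducerNPTM-outputs transducer x) (lemma first x)
    where
    lemma : ∀ s w → Transducer.transduce transducer s w ≡ [ translate s w ]
    lemma s []      = refl
    lemma s (b ∷ w) rewrite lemma (proj₁ (read s b)) w = refl

  -- The source of all `FP` functions that have to be constructed: each threshold used in a query is
  -- a finite-state translation.
  mealy-FP : FP (valueℤ ∘ mealy)
  mealy-FP = mealyNPTM , deterministic , λ x →
    mealy x , deterministic-outputs mealyNPTM deterministic (mealyNPTM-outputs x) , refl
    where
    deterministic : Deterministic (NPTM.machine mealyNPTM)
    deterministic = transducerNPTM-deterministic transducer (λ _ _ → ≤-refl) (λ _ → ≤-refl)

open Mealy using (mealy)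

-- Translations between pairs

pattern 0s = zero
pattern 1s = suc zero
pattern 2s = suc (suc zero)
pattern 3s = suc (suc (suc zero))
pattern 4s = suc (suc (suc (suc zero)))

silent : Emission
silent = nothing , nothing

says : Bit → Emission
says b = just b , nothing

firstOf : Mealy
firstOf = record
  { State = Fin 3 ; State-fin = finite-Fin ; first = 0s ; read = read ; finish = λ _ → silent }
  where
  read : Fin 3 → Bit → Fin 3 × Emission
  read 0s 1s = 1s , silent
  read 0s 0s = 2s , silent
  read 1s b  = 0s , says b
  read 2s b  = 2s , silent

mealy-firstOf : ∀ x w → mealy firstOf (pair x w) ≡ x
mealy-firstOf []      w = lemma w
  where
  lemma : ∀ w → Mealy.translate firstOf 2s w ≡ []
  lemma []      = refl
  lemma (_ ∷ w) = lemma w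
mealy-firstOf (b ∷ x) w = cong (b ∷_) (mealy-firstOf x w)

-- The leading 0 makes the output denote the same number as a natural number
-- and, being the sign of a non-negative one, as an integer.
secondOf : (Bit → Bit) → Mealy
secondOf φ = record
  { State = Fin 3 ; State-fin = finite-Fin ; first = 0s ; read = read ; finish = λ _ → silent }
  where
  read : Fin 3 → Bit → Fin 3 × Emission
  read 0s 1s = 1s , silent
  read 0s 0s = 2s , says zero
  read 1s b  = 0s , silent
  read 2s b  = 2s , says (φ b)

mealy-secondOf : ∀ φ x w → mealy (secondOf φ) (pair x w) ≡ zero ∷ map φ w
mealy-secondOf φ []      w = cong (zero ∷_) (lemma w)
  where
  lemma : ∀ w → Mealy.translate (secondOf φ) 2s w ≡ map φ w
  lemma []      = refl
  lemma (b ∷ w) = cong (φ b ∷_) (lemma w)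
mealy-secondOf φ (b ∷ x) w = mealy-secondOf φ x w

dropFirst : Mealy
dropFirst = record
  { State = Fin 5 ; State-fin = finite-Fin ; first = 0s ; read = read ; finish = λ _ → silent }
  where
  read : Fin 5 → Bit → Fin 5 × Emission
  read 0s b  = 1s , silent
  read 1s 1s = 2s , silent
  read 1s 0s = 4s , silent
  read 2s b  = 3s , silent
  read 3s b  = 0s , silent
  read 4s b  = 4s , says b

mealy-dropFirst : ∀ x y z → mealy dropFirst (pair (pair x y) z) ≡ pair y z
mealy-dropFirst []      y z = lemma (pair y z)
  where
  lemma : ∀ w → Mealy.translate dropFirst 4s w ≡ w
  lemma []      = refl
  lemma (b ∷ w) = cong (b ∷_) (lemma w)
mealy-dropFirst (b ∷ x) y z = mealy-dropFirst x y z

markSecond : Mealy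
markSecond = record
  { State = Fin 3 ; State-fin = finite-Fin ; first = 0s ; read = read ; finish = λ _ → silent }
  where
  read : Fin 3 → Bit → Fin 3 × Emission
  read 0s 1s = 1s , says 1s
  read 0s 0s = 2s , just 0s , just 1s
  read 1s b  = 0s , says b
  read 2s b  = 2s , says b

mealy-markSecond : ∀ x y → mealy markSecond (pair x y) ≡ pair x (1s ∷ y)
mealy-markSecond []      y = cong (λ y → 0s ∷ 1s ∷ y) (lemma y)
  where
  lemma : ∀ w → Mealy.translate markSecond 2s w ≡ w
  lemma []      = refl
  lemma (b ∷ w) = cong (b ∷_) (lemma w)
mealy-markSecond (b ∷ x) y = cong (λ u → 1s ∷ b ∷ u) (mealy-markSecond x y)

-- The comparison of a natural number with an integer is turned into a
-- comparison of natural numbers.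
signed : Word → Word → Word × Word
signed y []       = y , []
signed y (0s ∷ m) = y , m
signed y (1s ∷ m) = y ++ m , []

-- The separator of the pair is withheld until the sign is known. For a non-negative threshold it is
-- emitted before the magnitude; for a negative one the magnitude is tagged as a continuation of the
-- first component, and the separator comes last.
unsign : Mealy
unsign = record
  { State = Fin 5 ; State-fin = finite-Fin ; first = 0s ; read = read ; finish = finish }
  where
  read : Fin 5 → Bit → Fin 5 × Emission
  read 0s 1s = 1s , says 1s
  read 0s 0s = 2s , silent
  read 1s b  = 0s , says b
  read 2s 0s = 3s , says 0s
  read 2s 1s = 4s , silent
  read 3s b  = 3s , says b
  read 4s b  = 4s , just 1s , just b
  finish : Fin 5 → Emission
  finish 2s = says 0s
  finish 4s = says 0s
  finish _  = silent

mealy-unsign : ∀ y w → mealy unsign (pair y w) ≡ pair (proj₁ (signed y w)) (proj₂ (signed y w))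
mealy-unsign []      []       = refl
mealy-unsign []      (0s ∷ m) = cong (0s ∷_) (lemma m)
  where
  lemma : ∀ w → Mealy.translate unsign 3s w ≡ w
  lemma []      = refl
  lemma (b ∷ w) = cong (b ∷_) (lemma w)
mealy-unsign []      (1s ∷ m) = lemma m
  where
  lemma : ∀ w → Mealy.translate unsign 4s w ≡ pair w []
  lemma []      = refl
  lemma (b ∷ w) = cong (λ u → 1s ∷ b ∷ u) (lemma w)
mealy-unsign (b ∷ y) []       = cong (λ u → 1s ∷ b ∷ u) (mealy-unsign y [])
mealy-unsign (b ∷ y) (0s ∷ m) = cong (λ u → 1s ∷ b ∷ u) (mealy-unsign y (0s ∷ m))
mealy-unsign (b ∷ y) (1s ∷ m) = cong (λ u → 1s ∷ b ∷ u) (mealy-unsign y (1s ∷ m))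

-- Two additional bits make the length at least 2, so that its powers absorb arbitrary constants and
-- grow even on the empty word.
lengthen : Mealy
lengthen = record
  { State = ⊤ ; State-fin = finite-⊤ ; first = tt ; read = λ s b → tt , says b ; finish = λ _ → just 1s , just 1s }

mealy-lengthen : ∀ w → length (mealy lengthen w) ≡ 2 + length w
mealy-lengthen []      = refl
mealy-lengthen (_ ∷ w) = cong suc (mealy-lengthen w)

-- The empty word denotes 0, so this is the threshold of queries asking for at least one accepting
-- path.
silence : Mealy
silence = record
  { State = ⊤ ; State-fin = finite-⊤ ; first = tt ; read = λ s b → tt , silent ; finish = λ _ → silent }

mealy-silence : ∀ w → mealy silence w ≡ []
mealy-silence []      = refl
mealy-silence (_ ∷ w) = mealy-silence w

-- Guessing and testing words

words : ℕ → List Word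
words zero    = [ [] ]
words (suc n) = map (0s ∷_) (words n) ++ map (1s ∷_) (words n)

-- The input serves only as a clock: its letters are ignored, and its length fixes the length of the
-- guess.
guess : Transducer
guess = record
  { State = ⊤ ; State-fin = finite-⊤ ; first = tt
  ; read = λ _ _ → (tt , says 0s) ∷ (tt , says 1s) ∷ [] ; finish = λ _ → [ silent ] }

transduce-guess : ∀ w → Transducer.transduce guess tt w ≡ words (length w)
transduce-guess []      = refl
transduce-guess (_ ∷ w) rewrite transduce-guess w = cong (map (0s ∷_) (words (length w)) ++_) (++-identityʳ _)

anyOne : Word → Bool
anyOne []       = false
anyOne (0s ∷ w) = anyOne w
anyOne (1s ∷ w) = true

testOne : (Bool → Bool) → Transducer
testOne P = record
  { State = Bool ; State-fin = finite-Bool ; first = false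
  ; read = λ { s 0s → [ s , silent ] ; s 1s → [ true , silent ] }
  ; finish = λ s → if P s then [ silent ] else [] }

transduce-testOne : ∀ P w → Transducer.transduce (testOne P) false w ≡ (if P (anyOne w) then [ [] ] else [])
transduce-testOne P = lemma false
  where
  finished : ∀ s → map emitted (if P s then [ silent ] else []) ≡ (if P s then [ [] ] else [])
  finished s with P s
  ... | true  = refl
  ... | false = refl
  same : ∀ (ws : List Word) → map ([] ++_) ws ++ [] ≡ ws
  same ws = trans (++-identityʳ _) (map-id ws)
  lemma : ∀ s w → Transducer.transduce (testOne P) s w ≡ (if P (s ∨ anyOne w) then [ [] ] else [])
  lemma false []       = finished false
  lemma true  []       = finished true
  lemma false (0s ∷ w) = trans (same _) (lemma false w)
  lemma true  (0s ∷ w) = trans (same _) (lemma true w)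
  lemma false (1s ∷ w) = trans (same _) (lemma true w)
  lemma true  (1s ∷ w) = trans (same _) (lemma true w)

-- Combining machines

module _ {T N : NPTM} where
  ⟫-outputs : ∀ {x ys} → acceptedOutputs T x ≡ ys →
              acceptedOutputs (T ⟫ N) x ≡ concatMap (acceptedOutputs N) ys
  ⟫-outputs {x} e = trans (⟫-outputs′ T N x) (cong (concatMap (acceptedOutputs N)) e)

  ⟫-single : ∀ {x y zs} → acceptedOutputs T x ≡ [ y ] → acceptedOutputs N y ≡ zs →
             acceptedOutputs (T ⟫ N) x ≡ zs
  ⟫-single e e′ = trans (⟫-outputs e) (trans (++-identityʳ _) e′)

length-outputs : ∀ N x → length (acceptedOutputs N x) ≡ acc N x
length-outputs N x = length-map _ (NPTM.acceptingPaths N x)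

onFirst : NPTM → NPTM
onFirst N = mealyNPTM firstOf ⟫ N

onFirst-outputs : ∀ N x w → acceptedOutputs (onFirst N) (pair x w) ≡ acceptedOutputs N x
onFirst-outputs N x w = ⟫-single {mealyNPTM firstOf} {N}
  (trans (mealyNPTM-outputs firstOf (pair x w)) (cong [_] (mealy-firstOf x w))) refl

-- The input must survive the first machine. It does so inside a pair: x ↦ ⟨x,y⟩ ↦ ⟨⟨x,y⟩,z⟩ ↦
-- ⟨y,z⟩.
both : NPTM → NPTM → NPTM
both N₁ N₂ = graph N₁ ⟫ graph (onFirst N₂) ⟫ mealyNPTM dropFirst

both-outputs : ∀ N₁ N₂ {x y zs} → acceptedOutputs N₁ x ≡ [ y ] → acceptedOutputs N₂ x ≡ zs →
               acceptedOutputs (both N₁ N₂) x ≡ map (pair y) zs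
both-outputs N₁ N₂ {x} {y} {zs} e e′ = trans
  (⟫-outputs {graph N₁ ⟫ graph (onFirst N₂)} {mealyNPTM dropFirst}
    (⟫-single {graph N₁} {graph (onFirst N₂)} (trans (graph-outputs N₁ x) (cong (map (pair x)) e))
      (trans (graph-outputs (onFirst N₂) (pair x y)) (cong (map (pair (pair x y))) (trans (onFirst-outputs N₂ x y) e′)))))
  (trans (concatMap-map _ (pair (pair x y)) zs) (trans (concatMap-cong lemma zs) (concatMap-[] (pair y) zs)))
  where
  lemma : ∀ z → acceptedOutputs (mealyNPTM dropFirst) (pair (pair x y) z) ≡ [ pair y z ]
  lemma z = trans (mealyNPTM-outputs dropFirst _) (cong [_] (mealy-dropFirst x y z))

-- Makes a decision usable within a chain of compositions: the input itself is passed on, once for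
-- each accepting path of `N`.
filtering : NPTM → NPTM
filtering N = graph N ⟫ mealyNPTM firstOf

filtering-outputs : ∀ N z → acceptedOutputs (filtering N) z ≡ map (λ _ → z) (acceptedOutputs N z)
filtering-outputs N z = trans (⟫-outputs {graph N} {mealyNPTM firstOf} (graph-outputs N z))
  (trans (concatMap-map _ (pair z) ws) (trans (concatMap-cong lemma ws) (concatMap-[] _ ws)))
  where
  ws = acceptedOutputs N z
  lemma : ∀ w → acceptedOutputs (mealyNPTM firstOf) (pair z w) ≡ [ z ]
  lemma w = trans (mealyNPTM-outputs firstOf _) (cong [_] (mealy-firstOf z w))

-- Clocks

squares : ℕ → NPTM
squares zero    = mealyNPTM lengthen
squares (suc k) = squares k ⟫ squarer

squares-outputs : ∀ k x → ∃[ w ] (acceptedOutputs (squares k) x ≡ [ w ] × (2 + length x) ^ (2 ^ k) ≤ length w)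
squares-outputs zero    x = mealy lengthen x , mealyNPTM-outputs lengthen x ,
  ≤-reflexive (trans (*-identityʳ _) (sym (mealy-lengthen x)))
squares-outputs (suc k) x with squares-outputs k x
... | w , e , h with squarer-outputs w
... | u , e′ , h′ = u , ⟫-single {squares k} {squarer} e e′ , (begin
  (2 + length x) ^ (2 * 2 ^ k)  ≡⟨ cong ((2 + length x) ^_) (cong (2 ^ k +_) (+-identityʳ _)) ⟩
  (2 + length x) ^ (2 ^ k + 2 ^ k)  ≡⟨ ^-distribˡ-+-* (2 + length x) (2 ^ k) (2 ^ k) ⟩
  (2 + length x) ^ (2 ^ k) * (2 + length x) ^ (2 ^ k)  ≤⟨ *-mono-≤ h h ⟩
  length w * length w  ≤⟨ h′ ⟩
  length u  ∎)
  where open ≤-Reasoning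

n≤2^n : ∀ n → n ≤ 2 ^ n
n≤2^n zero    = z≤n
n≤2^n (suc n) = ≤-trans (+-mono-≤ (m^n>0 2 n) (n≤2^n n)) (≤-reflexive (cong (2 ^ n +_) (sym (+-identityʳ _))))

-- Induction along Horner's scheme. A coefficient satisfies a ≤ 2^a ≤ (2 + n)^a, so it is absorbed
-- by the exponent, and the factor 1 + n that remains costs one further power.
eval-power : ∀ p → ∃[ e ] ∀ n → eval p n ≤ (2 + n) ^ e
eval-power []      = 0 , λ n → z≤n
eval-power (a ∷ p) with eval-power p
... | e , h = suc (a + e) , λ n → begin
  a + n * eval p n  ≤⟨ +-mono-≤ (≤-trans (n≤2^n a) (^-monoˡ-≤ a (m≤m+n 2 n))) (*-monoʳ-≤ n (h n)) ⟩
  (2 + n) ^ a + n * (2 + n) ^ e  ≤⟨ +-mono-≤ (^-monoʳ-≤ (2 + n) (m≤m+n a e)) (*-monoʳ-≤ n (^-monoʳ-≤ (2 + n) (m≤n+m e a))) ⟩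
  (2 + n) ^ (a + e) + n * (2 + n) ^ (a + e)  ≤⟨ *-monoˡ-≤ ((2 + n) ^ (a + e)) (n≤1+n (suc n)) ⟩
  (2 + n) ^ suc (a + e)  ∎
  where open ≤-Reasoning

clock : ∀ p → ∃[ N ] ∀ x → ∃[ w ] (acceptedOutputs N x ≡ [ w ] × eval p (length x) ≤ length w)
clock p with eval-power p
-- Squaring `e` times gives the exponent `2 ^ e`, which is at least `e`; the excess is harmless, as
-- a clock may run too long.
... | e , h = squares e , λ x → let w , o , ≤w = squares-outputs e x in w , o ,
  ≤-trans (h (length x)) (≤-trans (^-monoʳ-≤ (2 + length x) (n≤2^n e)) ≤w)

-- Strictness leaves room for one more bit than the bound: a count can be as large as 2 to the
-- bound, and an output is coded with an additional leading 1.
guessing : ∀ p → ∃[ N ] ∀ x → ∃[ k ] (acceptedOutputs N x ≡ map (pair x) (words k) × eval p (length x) < k)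
guessing p with clock ((1 ∷ []) ⊕ p)
... | C , h = graph (C ⟫ transducerNPTM guess) , λ x → let w , o , ≤w = h x in length w ,
  trans (graph-outputs (C ⟫ transducerNPTM guess) x) (cong (map (pair x))
    (⟫-single {C} {transducerNPTM guess} o (trans (transducerNPTM-outputs guess w) (transduce-guess w)))) ,
  subst (_≤ length w) (eval-suc p (length x)) ≤w

-- Binary numbers

fromDigits-∷ʳ : ∀ (ds : List Bit) b → fromDigits (ds ++ [ b ]) ≡ toℕ b * 2 ^ length ds + fromDigits ds
fromDigits-∷ʳ []       b = cong (_+ 0) (sym (*-identityʳ (toℕ b)))
fromDigits-∷ʳ (d ∷ ds) b rewrite fromDigits-∷ʳ ds b =
  solve 4 (λ d b p v → d :+ (b :* p :+ v) :* con 2 := b :* (con 2 :* p) :+ (d :+ v :* con 2)) refl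
    (toℕ d) (toℕ b) (2 ^ length ds) (fromDigits ds)
  where open +-*-Solver

valueℕ-∷ : ∀ b w → valueℕ (b ∷ w) ≡ toℕ b * 2 ^ length w + valueℕ w
valueℕ-∷ b w rewrite unfold-reverse b w | fromDigits-∷ʳ (reverse w) b | length-reverse w = refl

valueℕ-0 : ∀ w → valueℕ (0s ∷ w) ≡ valueℕ w
valueℕ-0 = valueℕ-∷ 0s

valueℕ-1 : ∀ w → valueℕ (1s ∷ w) ≡ 2 ^ length w + valueℕ w
valueℕ-1 w = trans (valueℕ-∷ 1s w) (cong (_+ valueℕ w) (+-identityʳ _))

valueℕ-reverse : ∀ ds → valueℕ (reverse ds) ≡ fromDigits ds
valueℕ-reverse ds = cong fromDigits (reverse-involutive ds)

double : ∀ n → 2 ^ n + 2 ^ n ≡ 2 ^ suc n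
double n = cong (2 ^ n +_) (sym (+-identityʳ (2 ^ n)))

valueℕ-< : ∀ w → valueℕ w < 2 ^ length w
valueℕ-< []       = s≤s z≤n
valueℕ-< (0s ∷ w) rewrite valueℕ-0 w = ≤-trans (valueℕ-< w) (m≤m+n _ _)
valueℕ-< (1s ∷ w) rewrite valueℕ-1 w =
  ≤-trans (+-monoʳ-< (2 ^ length w) (valueℕ-< w)) (≤-reflexive (double (length w)))

flip : Bit → Bit
flip 0s = 1s
flip 1s = 0s

-- A word and its complement add up to 1...1, that is 2^k - 1. Hence 2^k - 1 - v is computed letter
-- by letter.
valueℕ-flip : ∀ w → suc (valueℕ w + valueℕ (map flip w)) ≡ 2 ^ length w
valueℕ-flip []       = refl
valueℕ-flip (0s ∷ w) rewrite valueℕ-0 w | valueℕ-1 (map flip w) | length-map flip w = begin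
  suc (valueℕ w + (2 ^ length w + valueℕ (map flip w)))  ≡⟨ solve 3 (λ v p f → con 1 :+ (v :+ (p :+ f)) := p :+ (con 1 :+ (v :+ f))) refl
          (valueℕ w) (2 ^ length w) (valueℕ (map flip w)) ⟩
  2 ^ length w + suc (valueℕ w + valueℕ (map flip w))  ≡⟨ cong (2 ^ length w +_) (valueℕ-flip w) ⟩
  2 ^ length w + 2 ^ length w  ≡⟨ double (length w) ⟩
  2 ^ suc (length w)  ∎
  where
  open ≡-Reasoning
  open +-*-Solver
valueℕ-flip (1s ∷ w) rewrite valueℕ-1 w | valueℕ-0 (map flip w) = begin
  suc (2 ^ length w + valueℕ w + valueℕ (map flip w))  ≡⟨ solve 3 (λ v p f → con 1 :+ (p :+ v :+ f) := p :+ (con 1 :+ (v :+ f))) refl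
          (valueℕ w) (2 ^ length w) (valueℕ (map flip w)) ⟩
  2 ^ length w + suc (valueℕ w + valueℕ (map flip w))  ≡⟨ cong (2 ^ length w +_) (valueℕ-flip w) ⟩
  2 ^ length w + 2 ^ length w  ≡⟨ double (length w) ⟩
  2 ^ suc (length w)  ∎
  where
  open ≡-Reasoning
  open +-*-Solver

valueℕ-injective : ∀ v w → length v ≡ length w → valueℕ v ≡ valueℕ w → v ≡ w
valueℕ-injective []       []       _ _ = refl
valueℕ-injective (0s ∷ v) (0s ∷ w) l e = cong (0s ∷_) (valueℕ-injective v w (suc-injective l)
  (trans (sym (valueℕ-0 v)) (trans e (valueℕ-0 w))))
valueℕ-injective (1s ∷ v) (1s ∷ w) l e = cong (1s ∷_) (valueℕ-injective v w (suc-injective l)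
  (+-cancelˡ-≡ (2 ^ length v) _ _ (trans (sym (valueℕ-1 v)) (trans e (trans (valueℕ-1 w)
    (cong (λ n → 2 ^ n + valueℕ w) (sym (suc-injective l))))))))
valueℕ-injective (0s ∷ v) (1s ∷ w) l e = contradiction (trans (sym (valueℕ-0 v)) (trans e (valueℕ-1 w)))
  (<⇒≢ (≤-trans (valueℕ-< v) (≤-trans (≤-reflexive (cong (2 ^_) (suc-injective l))) (m≤m+n _ _))))
valueℕ-injective (1s ∷ v) (0s ∷ w) l e = contradiction (trans (sym (valueℕ-0 w)) (trans (sym e) (valueℕ-1 v)))
  (<⇒≢ (≤-trans (valueℕ-< w) (≤-trans (≤-reflexive (cong (2 ^_) (sym (suc-injective l)))) (m≤m+n _ _))))

valueℕ-++ : ∀ v w → valueℕ (v ++ w) ≡ valueℕ v * 2 ^ length w + valueℕ w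
valueℕ-++ []       w = refl
valueℕ-++ (b ∷ v) w rewrite valueℕ-∷ b (v ++ w) | valueℕ-∷ b v | valueℕ-++ v w | length-++ v {w}
  | ^-distribˡ-+-* 2 (length v) (length w) =
  solve 5 (λ b p q v w → b :* (p :* q) :+ (v :* q :+ w) := (b :* p :+ v) :* q :+ w) refl
    (toℕ b) (2 ^ length v) (2 ^ length w) (valueℕ v) (valueℕ w)
  where open +-*-Solver

anyOne-value : ∀ w → if anyOne w then 0 < valueℕ w else valueℕ w ≡ 0
anyOne-value []       = refl
anyOne-value (0s ∷ w) rewrite valueℕ-0 w = anyOne-value w
anyOne-value (1s ∷ w) rewrite valueℕ-1 w = ≤-trans (m^n>0 2 (length w)) (m≤m+n _ _)

carry : Bool → ℕ
carry c = if c then 1 else 0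

minus-spec : ∀ a b c → toℕ a + 2 * carry (proj₂ (minus a b c)) ≡ toℕ b + carry c + toℕ (proj₁ (minus a b c))
minus-spec 0s 0s false = refl
minus-spec 0s 0s true  = refl
minus-spec 0s 1s false = refl
minus-spec 0s 1s true  = refl
minus-spec 1s 0s false = refl
minus-spec 1s 0s true  = refl
minus-spec 1s 1s false = refl
minus-spec 1s 1s true  = refl

-- The equation of the lowest digit is added to twice the equation of the remaining digits; the
-- borrow `c₁` between them then occurs on both sides and cancels.
digit-step : ∀ a b c {c₁ d} x y {z} p {c′} → a + 2 * c₁ ≡ b + c + d → x + p * c′ ≡ y + c₁ + z →
  a + x * 2 + 2 * p * c′ ≡ b + y * 2 + c + (d + z * 2)
digit-step a b c {c₁} {d} x y {z} p {c′} e f = +-cancelʳ-≡ (2 * c₁) _ _ (begin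
  a + x * 2 + 2 * p * c′ + 2 * c₁  ≡⟨ solve 5 (λ a x p c′ c₁ → a :+ x :* con 2 :+ con 2 :* p :* c′ :+ con 2 :* c₁
          := (a :+ con 2 :* c₁) :+ con 2 :* (x :+ p :* c′)) refl a x p c′ c₁ ⟩
  (a + 2 * c₁) + 2 * (x + p * c′)  ≡⟨ cong₂ (λ m n → m + 2 * n) e f ⟩
  (b + c + d) + 2 * (y + c₁ + z)  ≡⟨ solve 6 (λ b c d y c₁ z → (b :+ c :+ d) :+ con 2 :* (y :+ c₁ :+ z)
          := b :+ y :* con 2 :+ c :+ (d :+ z :* con 2) :+ con 2 :* c₁) refl b c d y c₁ z ⟩
  b + y * 2 + c + (d + z * 2) + 2 * c₁  ∎)
  where
  open ≡-Reasoning
  open +-*-Solver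

-- Free of subtraction, so that negative differences are covered as well: a final borrow is worth 2
-- to the number of digits.
subtract-spec : ∀ c as bs → let (c′ , ds) = subtract c as bs in
  fromDigits as + 2 ^ length ds * carry c′ ≡ fromDigits bs + carry c + fromDigits ds
subtract-spec false []       []       = refl
subtract-spec true  []       []       = refl
subtract-spec c     (a ∷ as) []       with subtract-spec (proj₂ (minus a 0s c)) as []
... | e = digit-step (toℕ a) 0 (carry c) {carry (proj₂ (minus a 0s c))} {toℕ (proj₁ (minus a 0s c))} (fromDigits as) 0
            (2 ^ length (proj₂ (subtract (proj₂ (minus a 0s c)) as [])))
            {carry (proj₁ (subtract (proj₂ (minus a 0s c)) as []))} (minus-spec a 0s c) e
subtract-spec c     []       (b ∷ bs) with subtract-spec (proj₂ (minus 0s b c)) [] bs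
... | e = digit-step 0 (toℕ b) (carry c) {carry (proj₂ (minus 0s b c))} {toℕ (proj₁ (minus 0s b c))} 0 (fromDigits bs)
            (2 ^ length (proj₂ (subtract (proj₂ (minus 0s b c)) [] bs)))
            {carry (proj₁ (subtract (proj₂ (minus 0s b c)) [] bs))} (minus-spec 0s b c) e
subtract-spec c     (a ∷ as) (b ∷ bs) with subtract-spec (proj₂ (minus a b c)) as bs
... | e = digit-step (toℕ a) (toℕ b) (carry c) {carry (proj₂ (minus a b c))} {toℕ (proj₁ (minus a b c))} (fromDigits as) (fromDigits bs)
            (2 ^ length (proj₂ (subtract (proj₂ (minus a b c)) as bs)))
            {carry (proj₁ (subtract (proj₂ (minus a b c)) as bs))} (minus-spec a b c) e

Difference : Word → Word → List Word → Set
Difference x y ws = (valueℕ x < valueℕ y × ws ≡ []) ⊎ ∃[ d ] (ws ≡ [ d ] × valueℕ x ≡ valueℕ y + valueℕ d)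

subtractor-spec : ∀ x y → Difference x y (acceptedOutputs subtractor (pair x y))
subtractor-spec x y = subst (Difference x y) (sym (subtractor-outputs x y))
  (lemma (subtract false (reverse x) (reverse y)) (subtract-spec false (reverse x) (reverse y)))
  where
  lemma : ∀ r → valueℕ x + 2 ^ length (proj₂ r) * carry (proj₁ r) ≡ valueℕ y + 0 + fromDigits (proj₂ r) →
          Difference x y (Subtraction.outcome r)
  lemma (false , ds) e = inj₂ (reverse ds , refl , (begin
    valueℕ x  ≡⟨ +-identityʳ _ ⟨
    valueℕ x + 0  ≡⟨ cong (valueℕ x +_) (*-zeroʳ (2 ^ length ds)) ⟨
    valueℕ x + 2 ^ length ds * 0  ≡⟨ e ⟩
    valueℕ y + 0 + fromDigits ds  ≡⟨ cong₂ _+_ (+-identityʳ _) (sym (valueℕ-reverse ds)) ⟩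
    valueℕ y + valueℕ (reverse ds)  ∎))
    where open ≡-Reasoning
  -- A borrow out stands for `2 ^ length ds`, which exceeds what the digits `ds` can represent; this
  -- forces `valueℕ x < valueℕ y`.
  lemma (true  , ds) e = inj₁ (+-cancelʳ-< (2 ^ length ds) _ _ (begin-strict
    valueℕ x + 2 ^ length ds  ≡⟨ cong (valueℕ x +_) (*-identityʳ _) ⟨
    valueℕ x + 2 ^ length ds * 1  ≡⟨ e ⟩
    valueℕ y + 0 + fromDigits ds  ≡⟨ cong₂ _+_ (+-identityʳ _) (sym (valueℕ-reverse ds)) ⟩
    valueℕ y + valueℕ (reverse ds)  <⟨ +-monoʳ-< (valueℕ y) (valueℕ-< (reverse ds)) ⟩
    valueℕ y + 2 ^ length (reverse ds) ≡⟨ cong (λ n → valueℕ y + 2 ^ n) (length-reverse ds) ⟩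
    valueℕ y + 2 ^ length ds  ∎) , refl)
    where open ≤-Reasoning

greaterThan equalTo : NPTM
greaterThan = subtractor ⟫ transducerNPTM (testOne id)
equalTo     = subtractor ⟫ transducerNPTM (testOne not)

testOne-outputs : ∀ P w → acceptedOutputs (transducerNPTM (testOne P)) w ≡ (if P (anyOne w) then [ [] ] else [])
testOne-outputs P w = trans (transducerNPTM-outputs (testOne P) w) (transduce-testOne P w)

greaterThan-outputs : ∀ x y → acceptedOutputs greaterThan (pair x y) ≡ (if does (valueℕ y <? valueℕ x) then [ [] ] else [])
greaterThan-outputs x y with subtractor-spec x y
... | inj₁ (x<y , e) rewrite dec-false (valueℕ y <? valueℕ x) (<⇒≯ x<y) =
  ⟫-outputs {subtractor} {transducerNPTM (testOne id)} e
... | inj₂ (d , e , v) = trans (⟫-single {subtractor} {transducerNPTM (testOne id)} e (testOne-outputs id d))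
  (lemma (anyOne d) (anyOne-value d))
  where
  lemma : ∀ t → (if t then 0 < valueℕ d else valueℕ d ≡ 0) →
          (if t then [ [] ] else []) ≡ (if does (valueℕ y <? valueℕ x) then [ [] ] else [])
  lemma true  h rewrite dec-true (valueℕ y <? valueℕ x)
    (≤-trans (≤-reflexive (+-comm 1 (valueℕ y))) (≤-trans (+-monoʳ-≤ (valueℕ y) h) (≤-reflexive (sym v)))) = refl
  lemma false h rewrite dec-false (valueℕ y <? valueℕ x)
    (≤⇒≯ (≤-reflexive (trans v (trans (cong (valueℕ y +_) h) (+-identityʳ _))))) = refl

equalTo-outputs : ∀ x y → acceptedOutputs equalTo (pair x y) ≡ (if does (valueℕ x ≟ valueℕ y) then [ [] ] else [])
equalTo-outputs x y with subtractor-spec x y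
... | inj₁ (x<y , e) rewrite dec-false (valueℕ x ≟ valueℕ y) (<⇒≢ x<y) =
  ⟫-outputs {subtractor} {transducerNPTM (testOne not)} e
... | inj₂ (d , e , v) = trans (⟫-single {subtractor} {transducerNPTM (testOne not)} e (testOne-outputs not d))
  (lemma (anyOne d) (anyOne-value d))
  where
  lemma : ∀ t → (if t then 0 < valueℕ d else valueℕ d ≡ 0) →
          (if not t then [ [] ] else []) ≡ (if does (valueℕ x ≟ valueℕ y) then [ [] ] else [])
  lemma true  h rewrite dec-false (valueℕ x ≟ valueℕ y)
    (λ x≡y → <⇒≢ h (sym (+-cancelˡ-≡ (valueℕ y) _ _ (trans (sym v) (trans x≡y (sym (+-identityʳ _))))))) = refl
  lemma false h rewrite dec-true (valueℕ x ≟ valueℕ y)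
    (trans v (trans (cong (valueℕ y +_) h) (+-identityʳ _))) = refl

-- Words of a given length

words-length : ∀ k → All (λ w → length w ≡ k) (words k)
words-length zero    = refl ∷ []
words-length (suc k) = ++⁺ (map⁺ (All.map (cong suc) (words-length k))) (map⁺ (All.map (cong suc) (words-length k)))

∈-words : ∀ w → w ∈ words (length w)
∈-words []       = here refl
∈-words (0s ∷ w) = ∈-++⁺ˡ (∈-map⁺ (0s ∷_) (∈-words w))
∈-words (1s ∷ w) = ∈-++⁺ʳ (map (0s ∷_) (words (length w))) (∈-map⁺ (1s ∷_) (∈-words w))

words-unique : ∀ k → Unique (words k)
words-unique zero    = [] ∷ []
words-unique (suc k) = Unique.++⁺ (Unique.map⁺ ∷-injectiveʳ (words-unique k)) (Unique.map⁺ ∷-injectiveʳ (words-unique k)) disjoint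
  where
  disjoint : ∀ {w} → w ∈ map (0s ∷_) (words k) × w ∈ map (1s ∷_) (words k) → ⊥
  disjoint (p , q) with ∈-map⁻ (0s ∷_) p | ∈-map⁻ (1s ∷_) q
  ... | _ , _ , refl | _ , _ , ()

-- Meaningful only for v < 2 ^ k.
word : ℕ → ℕ → Word
word zero    v = []
word (suc k) v with v <? 2 ^ k
... | yes _ = 0s ∷ word k v
... | no  _ = 1s ∷ word k (v ∸ 2 ^ k)

word-length : ∀ k v → length (word k v) ≡ k
word-length zero    v = refl
word-length (suc k) v with v <? 2 ^ k
... | yes _ = cong suc (word-length k v)
... | no  _ = cong suc (word-length k (v ∸ 2 ^ k))

valueℕ-word : ∀ k {v} → v < 2 ^ k → valueℕ (word k v) ≡ v
valueℕ-word zero    {zero} _ = refl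
valueℕ-word zero    {suc v} (s≤s ())
valueℕ-word (suc k) {v} h with v <? 2 ^ k
... | yes v< = trans (valueℕ-0 (word k v)) (valueℕ-word k v<)
... | no  v≮ = begin
  valueℕ (1s ∷ word k (v ∸ 2 ^ k))  ≡⟨ valueℕ-1 (word k (v ∸ 2 ^ k)) ⟩
  2 ^ length (word k (v ∸ 2 ^ k)) + valueℕ (word k (v ∸ 2 ^ k))
        ≡⟨ cong₂ (λ l n → 2 ^ l + n) (word-length k (v ∸ 2 ^ k)) (valueℕ-word k v∸<) ⟩
  2 ^ k + (v ∸ 2 ^ k)  ≡⟨ m+[n∸m]≡n (≮⇒≥ v≮) ⟩
  v  ∎
  where
  open ≡-Reasoning
  v∸< : v ∸ 2 ^ k < 2 ^ k
  v∸< = +-cancelˡ-< (2 ^ k) _ _ (≤-trans (≤-reflexive (cong suc (m+[n∸m]≡n (≮⇒≥ v≮)))) (≤-trans h (≤-reflexive (sym (double k)))))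

-- A number below 2^k has exactly one representation by k bits. This is where the unique accepting
-- path comes from: of all guesses, one survives.
select-value : ∀ k {v} (P : Word → Bool) → v < 2 ^ k →
  (∀ w → length w ≡ k → P w ≡ does (valueℕ w ≟ v)) → filterᵇ P (words k) ≡ [ word k v ]
select-value k {v} P v< spec = singleton (words k) (words-unique k) w∈ chosen others
  where
  w∈ : word k v ∈ words k
  w∈ = subst (λ l → word k v ∈ words l) (word-length k v) (∈-words (word k v))
  chosen : P (word k v) ≡ true
  chosen = trans (spec (word k v) (word-length k v)) (dec-true (_ ≟ v) (valueℕ-word k v<))
  others : ∀ {w} → w ∈ words k → word k v ≢ w → P w ≡ false
  others {w} w∈ w≢ = trans (spec w (All.lookup (words-length k) w∈)) (dec-false (valueℕ w ≟ v) λ e →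
    w≢ (valueℕ-injective (word k v) w (trans (word-length k v) (sym (All.lookup (words-length k) w∈))) (trans (valueℕ-word k v<) (sym e))))
  none : ∀ {ws} → All (λ w → P w ≡ false) ws → filterᵇ P ws ≡ []
  none []       = refl
  none (p ∷ ps) rewrite p = none ps
  singleton : ∀ ws {w} → Unique ws → w ∈ ws → P w ≡ true → (∀ {u} → u ∈ ws → w ≢ u → P u ≡ false) → filterᵇ P ws ≡ [ w ]
  singleton (w ∷ ws) (w∉ ∷ _) (here refl) t f rewrite t = cong (w ∷_) (none (All.tabulate (λ u∈ → f (there u∈) (All.lookup w∉ u∈))))
  singleton (u ∷ ws) (u∉ ∷ uniq) (there w∈) t f rewrite f (here refl) (λ { refl → All.lookup u∉ w∈ refl }) =
    singleton ws uniq w∈ t (λ u∈ → f (there u∈))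

-- Counting classes

open NPTM using (rej; Total; span; gap; tot; paths; bound)

true-iff : ∀ {b c} → (b ≡ true → c ≡ true) → (c ≡ true → b ≡ true) → b ≡ c
true-iff {true}  {c}     f g = sym (f refl)
true-iff {false} {true}  f g = g refl
true-iff {false} {false} f g = refl

does⁻ : ∀ {P : Set} (d : Dec P) → does d ≡ true → P
does⁻ (yes p) _ = p

+-cancel : ∀ a b → ℤ.+ (a + b) ℤ.- ℤ.+ a ≡ ℤ.+ b
+-cancel a b = trans (ℤ.m-n≡m⊖n (a + b) a) (trans (ℤ.⊖-≥ (m≤m+n a b)) (cong ℤ.+_ (m+n∸m≡n a b)))

-- The subtractor rejects exactly when the difference is negative, which `NonNegative h` excludes;
-- so the unique paths of the two machines combine to one accepting path.
UPSVₜ-difference : ∀ {f g h} → UPSVₜ f → UPSVₜ g → NonNegative h → (∀ x → h x ≡ f x ℤ.- g x) → UPSVₜ h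
UPSVₜ-difference {f} {g} {h} (M , f≡) (N , g≡) h≥0 h≡ = (both M N ⟫ subtractor) , λ x → result x (f≡ x) (g≡ x)
  where
  result : ∀ x → ∃[ v ] (acceptedOutputs M x ≡ [ v ] × f x ≡ ℤ.+ valueℕ v) →
           ∃[ w ] (acceptedOutputs N x ≡ [ w ] × g x ≡ ℤ.+ valueℕ w) →
           ∃[ u ] (acceptedOutputs (both M N ⟫ subtractor) x ≡ [ u ] × h x ≡ ℤ.+ valueℕ u)
  result x (v , ev , fv) (w , ew , gw) = difference (subtractor-spec v w)
    where
    h-value : h x ≡ ℤ.+ valueℕ v ℤ.- ℤ.+ valueℕ w
    h-value = trans (h≡ x) (cong₂ ℤ._-_ fv gw)
    difference : Difference v w (acceptedOutputs subtractor (pair v w)) →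
                 ∃[ u ] (acceptedOutputs (both M N ⟫ subtractor) x ≡ [ u ] × h x ≡ ℤ.+ valueℕ u)
    difference (inj₁ (v<w , _)) = contradiction (ℤ.drop‿+≤+ (ℤ.0≤i-j⇒j≤i (subst (0ℤ ℤ.≤_) h-value (h≥0 x)))) (<⇒≱ v<w)
    difference (inj₂ (d , e , v≡)) = d , ⟫-single {both M N} {subtractor} (both-outputs M N ev ew) e ,
      trans h-value (trans (cong (λ n → ℤ.+ n ℤ.- ℤ.+ valueℕ w) v≡) (+-cancel (valueℕ w) (valueℕ d)))

Total-split : ∀ N x → Total N x ≡ acc N x + rej N x
Total-split N x = length-filter-split _ (paths N x)

Total-positive : ∀ N x → ∃[ n ] Total N x ≡ suc n
Total-positive N x = acc (Leftmost.butLeftmost N) x , sym (Leftmost.butLeftmost-acc N x)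

TotP⊆♯P : TotP ⊆ ♯P
TotP⊆♯P (N , f≡) = Leftmost.butLeftmost N , λ x →
  trans (f≡ x) (cong (λ n → ℤ.+ n ℤ.- 1ℤ) (sym (Leftmost.butLeftmost-acc N x)))

-- A second accepting leaf below every accepting leaf gives a total of Total + acc.
TotP⇒♯P : TotP ⊆ UPSVₜ → ♯P ⊆ UPSVₜ
TotP⇒♯P H {f} (N , f≡) = UPSVₜ-difference (H (doubled , λ x → refl)) (H (N , λ x → refl))
  (λ x → subst (0ℤ ℤ.≤_) (sym (f≡ x)) (ℤ.+≤+ z≤n)) difference
  where
  open Extension N id (λ b → if b then [ true ] else []) using (extension-count) renaming (extension to doubled)
  total : ∀ x → Total doubled x ≡ Total N x + acc N x
  total x = begin
    Total doubled x  ≡⟨ cong length (filter-true (paths doubled x)) ⟨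
    length (filterᵇ (λ _ → true) (paths doubled x))
        ≡⟨ extension-count (λ _ → true) x ⟩
    2 * acc N x + 1 * rej N x  ≡⟨ solve 2 (λ a r → con 2 :* a :+ con 1 :* r := a :+ r :+ a) refl (acc N x) (rej N x) ⟩
    acc N x + rej N x + acc N x  ≡⟨ cong (_+ acc N x) (Total-split N x) ⟨
    Total N x + acc N x  ∎
    where
    open ≡-Reasoning
    open +-*-Solver
  difference : ∀ x → f x ≡ tot doubled x ℤ.- tot N x
  -- Both `tot` terms subtract 1 from a positive total. Writing that total as a successor lets these
  -- subtractions compute, after which they cancel.
  difference x rewrite f≡ x | total x with Total N x | Total-positive N x
  ... | .(suc n) | n , refl = sym (+-cancel n (acc N x))

rejecting : ∀ N → ♯P (λ x → ℤ.+ rej N x)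
rejecting N = extension , λ x → cong ℤ.+_ (sym (trans (extension-count id x) (+-identityʳ _)))
  where open Extension N not (λ _ → [])

♯P⇒GapP₊ : ♯P ⊆ UPSVₜ → GapP₊ ⊆ UPSVₜ
♯P⇒GapP₊ H {f} ((N , f≡) , f≥0) = UPSVₜ-difference (H (N , λ x → refl)) (H (rejecting N)) f≥0 f≡

♯P⊆GapP₊ : ♯P ⊆ GapP₊
♯P⊆GapP₊ {f} (N , f≡) = (extension , gap-≡) , λ x → subst (0ℤ ℤ.≤_) (sym (f≡ x)) (ℤ.+≤+ z≤n)
  where
  -- Every rejecting leaf is split into an accepting and a rejecting one.
  open Extension N (λ _ → true) (λ b → if b then [] else [ false ])
  gap-≡ : ∀ x → f x ≡ gap extension x
  gap-≡ x = begin
    f x  ≡⟨ f≡ x ⟩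
    ℤ.+ acc N x  ≡⟨ +-cancel (rej N x) (acc N x) ⟨
    ℤ.+ (rej N x + acc N x) ℤ.- ℤ.+ rej N x  ≡⟨ cong₂ (λ a r → ℤ.+ a ℤ.- ℤ.+ r)
      (trans (extension-count id x) (solve 2 (λ a r → con 1 :* a :+ con 1 :* r := r :+ a) refl (acc N x) (rej N x)))
      (trans (extension-count not x) (+-identityʳ _)) ⟨
    gap extension x  ∎
    where
    open ≡-Reasoning
    open +-*-Solver

♯P⊆SpanP : ♯P ⊆ SpanP
♯P⊆SpanP (N , f≡) = Binary.binaryNPTM N , λ x → trans (f≡ x) (cong ℤ.+_ (sym (Binary.binary-span N x)))

-- Threshold languages

+-<⁻ : ∀ {m n} → ℤ.+ m ℤ.< ℤ.+ n → m < n
+-<⁻ = ℤ.drop‿+<+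

-- For a threshold -m the inequality -m < y fails only if m and y are both 0, that is, if the
-- concatenation `y ++ m` has value 0. The case m = 0 is separate because a word with negative sign
-- may denote 0.
signed-< : ∀ y w → (valueℕ (proj₂ (signed y w)) < valueℕ (proj₁ (signed y w)) → valueℤ w ℤ.< ℤ.+ valueℕ y) ×
                   (valueℤ w ℤ.< ℤ.+ valueℕ y → valueℕ (proj₂ (signed y w)) < valueℕ (proj₁ (signed y w)))
signed-< y []       = ℤ.+<+ , +-<⁻
signed-< y (0s ∷ m) rewrite ℤ.+◃n≡+n (valueℕ m) = ℤ.+<+ , +-<⁻
signed-< y (1s ∷ m) rewrite valueℕ-++ y m with valueℕ m
... | suc n = (λ _ → ℤ.-<+) , λ _ → ≤-trans (s≤s z≤n) (m≤n+m (suc n) (valueℕ y * 2 ^ length m))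
... | zero rewrite +-identityʳ (valueℕ y * 2 ^ length m) =
  (λ h → ℤ.+<+ (positive (valueℕ y) h)) , λ h → *-mono-≤ (+-<⁻ h) (m^n>0 2 (length m))
  where
  positive : ∀ v → 0 < v * 2 ^ length m → 0 < v
  positive (suc v) _ = s≤s z≤n

PP⊆UP : ♯P ⊆ UPSVₜ → PP ⊆ UP
PP⊆UP H {L} (f , g , f∈ , (G , deterministic , g≡) , L⇔) with H f∈
... | F , f≡ = (λ x → ℤ.+ acc K x) , (K , λ x → refl) , λ x →
    (λ e → cong ℤ.+_ (trans (acc-K x) (cong (λ b → if b then 1 else 0) e))) ,
    (λ e → cong ℤ.+_ (trans (acc-K x) (cong (λ b → if b then 1 else 0) e)))
  where
  -- The path of an `FP` machine yields its value even if it rejects, but composition continues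
  -- accepting paths only; so every leaf is made accepting.
  open Extension G (λ _ → true) (λ _ → []) using (all-accepted) renaming (extension to G′)
  K : NPTM
  K = both F G′ ⟫ mealyNPTM unsign ⟫ greaterThan
  acc-K : ∀ x → acc K x ≡ (if L x then 1 else 0)
  acc-K x with f≡ x | g≡ x
  ... | y , ey , fy | w , ew , gw = trans (sym (length-outputs K x)) (trans (cong length outputs)
    (trans (lemma _) (cong (λ b → if b then 1 else 0) (true-iff
      (λ h → Equivalence.from (L⇔ x) (subst₂ ℤ._<_ (sym gw) (sym fy) (proj₁ (signed-< y w) (does⁻ (valueℕ v <? valueℕ u) h))))
      (λ h → dec-true (valueℕ v <? valueℕ u) (proj₂ (signed-< y w) (subst₂ ℤ._<_ gw fy (Equivalence.to (L⇔ x) h))))))))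
    where
    u = proj₁ (signed y w)
    v = proj₂ (signed y w)
    outputs : acceptedOutputs K x ≡ (if does (valueℕ v <? valueℕ u) then [ [] ] else [])
    outputs = ⟫-single {both F G′ ⟫ mealyNPTM unsign} {greaterThan}
      (⟫-single {both F G′} {mealyNPTM unsign} (both-outputs F G′ ey (trans (all-accepted (λ _ → refl) (λ _ → refl) x) ew))
        (trans (mealyNPTM-outputs unsign (pair y w)) (cong [_] (mealy-unsign y w))))
      (greaterThan-outputs u v)
    lemma : ∀ b → length (if b then [ [] ] else List.[] {A = Word}) ≡ (if b then 1 else 0)
    lemma true  = refl
    lemma false = refl

UP⊆PP : UP ⊆ PP
UP⊆PP {L} (f , f∈ , spec) = f , (valueℤ ∘ mealy silence) , f∈ , mealy-FP silence , λ x → mk⇔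
  (λ e → subst₂ ℤ._<_ (cong valueℤ (sym (mealy-silence x))) (sym (proj₁ (spec x) e)) (ℤ.+<+ (s≤s z≤n)))
  (λ h → positive x (subst (ℤ._< f x) (cong valueℤ (mealy-silence x)) h))
  where
  positive : ∀ x → 0ℤ ℤ.< f x → L x ≡ true
  positive x h with L x in eq
  ... | true  = refl
  ... | false = contradiction (+-<⁻ (subst (0ℤ ℤ.<_) (proj₂ (spec x) eq) h)) λ ()

threshold : NPTM → Mealy → Language
threshold M S x = does (valueℤ (mealy S x) ℤ.<? ℤ.+ acc M x)

threshold∈PP : ∀ M S → PP (threshold M S)
threshold∈PP M S = (λ x → ℤ.+ acc M x) , (valueℤ ∘ mealy S) , (M , λ x → refl) , mealy-FP S , λ x → mk⇔
  (does⁻ (valueℤ (mealy S x) ℤ.<? ℤ.+ acc M x)) (dec-true (valueℤ (mealy S x) ℤ.<? ℤ.+ acc M x))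

threshold-ℕ : ∀ M S {x m} → valueℤ (mealy S x) ≡ ℤ.+ m → threshold M S x ≡ does (m <? acc M x)
threshold-ℕ M S {x} e rewrite e = refl

module _ (H : PP ⊆ UP) where

  private
    decider : ∀ M S → Σ[ N ∈ NPTM ] ∀ x → acc N x ≡ (if threshold M S x then 1 else 0)
    decider M S with H (threshold∈PP M S)
    ... | f , (N , f≡) , spec = N , λ x → lemma x
      where
      lemma : ∀ x → acc N x ≡ (if threshold M S x then 1 else 0)
      lemma x with threshold M S x in eq
      ... | true  = ℤ.+-injective (trans (sym (f≡ x)) (proj₁ (spec x) eq))
      ... | false = ℤ.+-injective (trans (sym (f≡ x)) (proj₂ (spec x) eq))

  -- A `UP` machine has at most one accepting path, so candidates are kept or discarded but never
  -- duplicated.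
  select : NPTM → Mealy → NPTM
  select M S = filtering (proj₁ (decider M S))

  select-outputs : ∀ M S x → acceptedOutputs (select M S) x ≡ (if threshold M S x then [ x ] else [])
  select-outputs M S x = trans (filtering-outputs N x)
    (lemma (acceptedOutputs N x) (threshold M S x) (trans (length-outputs N x) (proj₂ (decider M S) x)))
    where
    N = proj₁ (decider M S)
    lemma : ∀ ws b → length ws ≡ (if b then 1 else 0) → map (λ _ → x) ws ≡ (if b then [ x ] else [])
    lemma []       false _ = refl
    lemma (_ ∷ []) true  _ = refl

  concatMap-select : ∀ (P : Word → Bool) (f : A → Word) xs →
    concatMap (λ z → if P z then [ z ] else []) (map f xs) ≡ map f (filterᵇ (P ∘ f) xs)
  concatMap-select P f []       = refl
  concatMap-select P f (x ∷ xs) with P (f x)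
  ... | true  = cong (f x ∷_) (concatMap-select P f xs)
  ... | false = concatMap-select P f xs

  ⟫-select : ∀ T M S {x} {f : A → Word} {xs} → acceptedOutputs T x ≡ map f xs →
    acceptedOutputs (T ⟫ select M S) x ≡ map f (filterᵇ (threshold M S ∘ f) xs)
  ⟫-select T M S {f = f} {xs} e = trans (⟫-outputs {T} {select M S} e)
    (trans (concatMap-cong (select-outputs M S) (map f xs)) (concatMap-select (threshold M S) f xs))

-- The value of acc is guessed and confirmed by two threshold queries, one for
-- acc and one for the complementary count.
module Guess (H : PP ⊆ UP) (N : NPTM) where
  N₂ : NPTM
  N₂ = Binary.binaryNPTM N

  W : NPTM
  W = proj₁ (guessing (bound N₂))

  above below : NPTM
  above = onFirst (OneMore.oneMore N)
  below = Complement.complement N₂ (Binary.binary N)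

  S K : NPTM
  S = W ⟫ select H above (secondOf id) ⟫ select H below (secondOf flip)
  K = S ⟫ mealyNPTM (secondOf id)

  module _ (x : Word) where
    k : ℕ
    k = proj₁ (proj₂ (guessing (bound N₂)) x)

    a : ℕ
    a = acc N x

    W-outputs : acceptedOutputs W x ≡ map (pair x) (words k)
    W-outputs = proj₁ (proj₂ (proj₂ (guessing (bound N₂)) x))

    bound<k : eval (bound N₂) (length x) < k
    bound<k = proj₂ (proj₂ (proj₂ (guessing (bound N₂)) x))

    below-acc : ∀ w → eval (bound N₂) (length x) ≤ length w → acc below (pair x w) + a ≡ 2 ^ length w
    below-acc w h = trans (cong (acc below (pair x w) +_) (sym (Binary.binary-acc N x)))
      (Complement.complement-acc N₂ (Binary.binary N) x w h)

    above-acc : ∀ w → acc above (pair x w) ≡ suc a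
    above-acc w = begin
      acc above (pair x w)  ≡⟨ length-outputs above (pair x w) ⟨
      length (acceptedOutputs above (pair x w))  ≡⟨ cong length (onFirst-outputs (OneMore.oneMore N) x w) ⟩
      length (acceptedOutputs (OneMore.oneMore N) x) ≡⟨ length-outputs (OneMore.oneMore N) x ⟩
      acc (OneMore.oneMore N) x  ≡⟨ OneMore.oneMore-acc N x ⟩
      suc a  ∎
      where open ≡-Reasoning

    -- The complementary counts with a clock of exactly the time bound show that `a` is at most 2 to
    -- that bound, and `k` is strictly larger. Only the length of the clock word matters; its value
    -- 0 is arbitrary.
    a< : a < 2 ^ k
    a< = ≤-trans (s≤s (≤-trans (m≤n+m a _) (≤-reflexive (trans (below-acc w (≤-reflexive (sym w-length))) (cong (2 ^_) w-length)))))
      (≤-trans (^-monoʳ-< 2 (s≤s (s≤s z≤n)) (n<1+n (eval (bound N₂) (length x)))) (^-monoʳ-≤ 2 bound<k))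
      where
      w = word (eval (bound N₂) (length x)) 0
      w-length : length w ≡ eval (bound N₂) (length x)
      w-length = word-length (eval (bound N₂) (length x)) 0

    P : Word → Bool
    P w = threshold above (secondOf id) (pair x w) ∧ threshold below (secondOf flip) (pair x w)

    P-above : ∀ w → threshold above (secondOf id) (pair x w) ≡ does (valueℕ w <? suc a)
    P-above w = trans (threshold-ℕ above (secondOf id) {pair x w} {valueℕ w} value) (cong (λ n → does (valueℕ w <? n)) (above-acc w))
      where
      value : valueℤ (mealy (secondOf id) (pair x w)) ≡ ℤ.+ valueℕ w
      value = trans (cong valueℤ (mealy-secondOf id x w)) (trans (ℤ.+◃n≡+n _) (cong (λ w → ℤ.+ valueℕ w) (map-id w)))

    P-below : ∀ w → threshold below (secondOf flip) (pair x w) ≡ does (valueℕ (map flip w) <? acc below (pair x w))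
    P-below w = threshold-ℕ below (secondOf flip) {pair x w} (trans (cong valueℤ (mealy-secondOf flip x w)) (ℤ.+◃n≡+n _))

    -- The first query says v ≤ a. For the second, m + a = 2^k = 1 + v + f, where f is the value of
    -- the complemented word; so f < m is equivalent to a ≤ v.
    P-spec : ∀ w → length w ≡ k → P w ≡ does (valueℕ w ≟ a)
    P-spec w l = trans (cong₂ _∧_ (P-above w) (P-below w)) (true-iff
      (λ h → let v<1+a , f<m = ∧-true h in dec-true (valueℕ w ≟ a) (≤-antisym (s≤s⁻¹ (does⁻ (valueℕ w <? suc a) v<1+a)) (lower (does⁻ (f <? m) f<m))))
      (λ h → let v≡a = does⁻ (valueℕ w ≟ a) h in cong₂ _∧_ (dec-true (valueℕ w <? suc a) (s≤s (≤-reflexive v≡a))) (dec-true (f <? m) (upper v≡a))))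
      where
      f = valueℕ (map flip w)
      m = acc below (pair x w)
      ∧-true : ∀ {b c} → b ∧ c ≡ true → b ≡ true × c ≡ true
      ∧-true {true} {true} _ = refl , refl
      total : m + a ≡ suc (valueℕ w + f)
      total = trans (below-acc w (≤-trans (≤-trans (n≤1+n _) bound<k) (≤-reflexive (sym l)))) (sym (valueℕ-flip w))
      lower : f < m → a ≤ valueℕ w
      lower f<m = +-cancelʳ-≤ (suc f) a (valueℕ w) (begin
        a + suc f  ≤⟨ +-monoʳ-≤ a f<m ⟩
        a + m  ≡⟨ trans (+-comm a m) total ⟩
        suc (valueℕ w + f)  ≡⟨ +-suc (valueℕ w) f ⟨
        valueℕ w + suc f  ∎)
        where open ≤-Reasoning
      upper : valueℕ w ≡ a → f < m
      upper v≡a = ≤-reflexive (+-cancelʳ-≡ a (suc f) m (trans (cong suc (trans (+-comm f a) (cong (_+ f) (sym v≡a)))) (sym total)))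

    filter-∧ : ∀ (Q R : Word → Bool) ws → filterᵇ R (filterᵇ Q ws) ≡ filterᵇ (λ w → Q w ∧ R w) ws
    filter-∧ Q R []       = refl
    filter-∧ Q R (w ∷ ws) with Q w
    ... | false = filter-∧ Q R ws
    ... | true with R w
    ...   | true  = cong (w ∷_) (filter-∧ Q R ws)
    ...   | false = filter-∧ Q R ws

    K-outputs : acceptedOutputs K x ≡ [ 0s ∷ word k a ]
    K-outputs = ⟫-single {S} {mealyNPTM (secondOf id)} selected
      (trans (mealyNPTM-outputs (secondOf id) (pair x (word k a))) (cong [_] (trans (mealy-secondOf id x (word k a)) (cong (0s ∷_) (map-id _)))))
      where
      selected : acceptedOutputs S x ≡ [ pair x (word k a) ]
      selected = trans (⟫-select H (W ⟫ select H above (secondOf id)) below (secondOf flip)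
          (⟫-select H W above (secondOf id) W-outputs))
        (cong (map (pair x)) (trans (filter-∧ _ _ (words k)) (select-value k P a< P-spec)))

    K-value : valueℕ (0s ∷ word k a) ≡ a
    K-value = trans (valueℕ-0 (word k a)) (valueℕ-word k a<)

♯P⊆UPSVₜ : PP ⊆ UP → ♯P ⊆ UPSVₜ
♯P⊆UPSVₜ H (N , f≡) = Guess.K H N , λ x → _ , Guess.K-outputs H N x ,
  trans (f≡ x) (cong ℤ.+_ (sym (Guess.K-value H N x)))

-- Distinct outputs

output-length : ∀ N x → All (λ y → length y ≤ eval (bound N) (length x)) (acceptedOutputs N x)
output-length N x = subst (All _) (Runs.leavesᵗ-outputs N x) (map⁺ (filter⁺ _ (Runs.leavesᵗ-length N x)))

-- Outputs that differ in leading zeros are distinct for the span although they denote the same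
-- number; the 1 in front makes the coding injective.
leading : Word → ℕ
leading w = valueℕ (1s ∷ w)

leading-≥ : ∀ w → 2 ^ length w ≤ leading w
leading-≥ w = ≤-trans (m≤m+n _ _) (≤-reflexive (sym (valueℕ-1 w)))

leading-injective : ∀ {v w} → leading v ≡ leading w → v ≡ w
leading-injective {v} {w} e = ∷-injectiveʳ (valueℕ-injective (1s ∷ v) (1s ∷ w) (cong suc lengths) e)
  where
  shorter : ∀ {v w} → leading v ≡ leading w → length v ≮ length w
  shorter {v} {w} e l = <⇒≢ (≤-trans (valueℕ-< (1s ∷ v)) (≤-trans (^-monoʳ-≤ 2 l) (leading-≥ w))) e
  lengths : length v ≡ length w
  lengths = ≤-antisym (≮⇒≥ (shorter {w} {v} (sym e))) (≮⇒≥ (shorter {v} {w} e))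

same-length : ∀ {xs ys : List ℕ} → Unique xs → Unique ys → (∀ {z} → z ∈ xs → z ∈ ys) → (∀ {z} → z ∈ ys → z ∈ xs) →
              length xs ≡ length ys
same-length u v f g = ↭-length (∼bag⇒↭ (unique∧set⇒bag u v (mk⇔ f g)))

-- The span is the number of the words w of a fixed length such that w denotes
-- the same number as 1y for some output y.
module Span (H : PP ⊆ UP) (N : NPTM) where
  W : NPTM
  W = proj₁ (guessing (bound N))

  -- Passes through ⟨⟨x,w⟩,y⟩, ⟨w,y⟩ and ⟨w,1y⟩ for each output y. It accepts as often as the
  -- matching output occurs; the query with threshold 0 reduces this to once.
  member : NPTM
  member = graph (onFirst N) ⟫ mealyNPTM dropFirst ⟫ mealyNPTM markSecond ⟫ equalTo

  K : NPTM
  K = W ⟫ select H member silence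

  module _ (x : Word) where
    k : ℕ
    k = proj₁ (proj₂ (guessing (bound N)) x)

    ys : List Word
    ys = acceptedOutputs N x

    W-outputs : acceptedOutputs W x ≡ map (pair x) (words k)
    W-outputs = proj₁ (proj₂ (proj₂ (guessing (bound N)) x))

    bound<k : eval (bound N) (length x) < k
    bound<k = proj₂ (proj₂ (proj₂ (guessing (bound N)) x))

    test : Word → Word → List Word
    test w y = if does (valueℕ w ≟ leading y) then [ [] ] else []

    member-outputs : ∀ w → acceptedOutputs member (pair x w) ≡ concatMap (test w) ys
    member-outputs w = trans (⟫-outputs {graph (onFirst N) ⟫ mealyNPTM dropFirst ⟫ mealyNPTM markSecond} {equalTo} (
        chain (graph (onFirst N) ⟫ mealyNPTM dropFirst) markSecond (λ y → pair w y) (λ y → pair w (1s ∷ y)) (mealy-markSecond w)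
        (chain (graph (onFirst N)) dropFirst (pair (pair x w)) (pair w) (mealy-dropFirst x w)
        (trans (graph-outputs (onFirst N) (pair x w)) (cong (map (pair (pair x w))) (onFirst-outputs N x w))))))
      (trans (concatMap-map _ (λ y → pair w (1s ∷ y)) ys) (concatMap-cong (λ y → equalTo-outputs w (1s ∷ y)) ys))
      where
      chain : ∀ T S (f g : Word → Word) → (∀ y → mealy S (f y) ≡ g y) →
              acceptedOutputs T (pair x w) ≡ map f ys → acceptedOutputs (T ⟫ mealyNPTM S) (pair x w) ≡ map g ys
      chain T S f g fg e = trans (⟫-outputs {T} {mealyNPTM S} e) (trans (concatMap-map _ f ys)
        (trans (concatMap-cong (λ y → trans (mealyNPTM-outputs S (f y)) (cong [_] (fg y))) ys) (concatMap-[] g ys)))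

    P : Word → Bool
    P w = threshold member silence (pair x w)

    P-value : ∀ w → P w ≡ does (0 <? length (concatMap (test w) ys))
    P-value w = trans (threshold-ℕ member silence {pair x w} (cong valueℤ (mealy-silence (pair x w))))
      (cong (λ n → does (0 <? n)) (trans (sym (length-outputs member (pair x w))) (cong length (member-outputs w))))

    found : ∀ w zs → 0 < length (concatMap (test w) zs) → ∃[ y ] (y ∈ zs × valueℕ w ≡ leading y)
    found w (z ∷ zs) h with does (valueℕ w ≟ leading z) in eq
    ... | true  = z , here refl , does⁻ (valueℕ w ≟ leading z) eq
    ... | false with found w zs h
    ...   | y , y∈ , e = y , there y∈ , e

    find : ∀ w {y zs} → y ∈ zs → valueℕ w ≡ leading y → 0 < length (concatMap (test w) zs)
    find w {y} {z ∷ zs} y∈ e with does (valueℕ w ≟ leading z) in eq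
    find w {y} {z ∷ zs} y∈          e | true  = s≤s z≤n
    find w {y} {z ∷ zs} (here refl) e | false = contradiction (trans (sym eq) (dec-true (valueℕ w ≟ leading z) e)) λ ()
    find w {y} {z ∷ zs} (there y∈)  e | false = find w y∈ e

    -- Both sides are compared as duplicate-free lists of numbers. Words are mapped by `leading`,
    -- which is injective without any assumption on lengths; for words of length `k` it exceeds
    -- `valueℕ` by `2 ^ k`, and this is the shift applied to the codes of the outputs.
    span-≡ : length (filterᵇ P (words k)) ≡ span N x
    span-≡ = begin
      length (filterᵇ P (words k))  ≡⟨ length-map leading (filterᵇ P (words k)) ⟨
      length (map leading (filterᵇ P (words k)))  ≡⟨ same-length
        (Unique.map⁺ leading-injective (Unique.filter⁺ (T? ∘ P) (words-unique k)))
        (Unique.map⁺ (λ e → leading-injective (+-cancelˡ-≡ (2 ^ k) _ _ e)) (deduplicate-! (≡-dec Fin._≟_) ys))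
        into-outputs from-outputs ⟩
      length (map (λ y → 2 ^ k + leading y) distinct) ≡⟨ length-map _ distinct ⟩
      span N x  ∎
      where
      open ≡-Reasoning
      distinct : List Word
      distinct = deduplicate (≡-dec Fin._≟_) ys
      leading-word : ∀ {w} → w ∈ words k → leading w ≡ 2 ^ k + valueℕ w
      leading-word {w} w∈ = trans (valueℕ-1 w) (cong (λ n → 2 ^ n + valueℕ w) (All.lookup (words-length k) w∈))
      into-outputs : ∀ {z} → z ∈ map leading (filterᵇ P (words k)) → z ∈ map (λ y → 2 ^ k + leading y) distinct
      into-outputs z∈ with ∈-map⁻ leading z∈
      ... | w , w∈f , refl with ∈-filter⁻ (T? ∘ P) {xs = words k} w∈f
      ... | w∈ , Pw with found w ys (does⁻ (0 <? _) (trans (sym (P-value w)) (Equivalence.to T-≡ Pw)))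
      ... | y , y∈ , e = subst (_∈ map (λ y → 2 ^ k + leading y) distinct) (sym (trans (leading-word w∈) (cong (2 ^ k +_) e)))
        (∈-map⁺ (λ y → 2 ^ k + leading y) (∈-deduplicate⁺ (≡-dec Fin._≟_) y∈))
      from-outputs : ∀ {z} → z ∈ map (λ y → 2 ^ k + leading y) distinct → z ∈ map leading (filterᵇ P (words k))
      from-outputs z∈ with ∈-map⁻ (λ y → 2 ^ k + leading y) z∈
      ... | y , y∈d , refl with ∈-deduplicate⁻ (≡-dec Fin._≟_) ys y∈d
      ... | y∈ = subst (_∈ map leading (filterᵇ P (words k))) (trans (leading-word w∈) (cong (2 ^ k +_) value))
        (∈-map⁺ leading (∈-filter⁺ (T? ∘ P) w∈ (Equivalence.from T-≡ (trans (P-value w) (dec-true (0 <? _) (find w y∈ value))))))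
        where
        v< : leading y < 2 ^ k
        -- The code of `y` has 1 + |y| bits, and `k` exceeds the bound on |y|; so a word of length
        -- `k` represents it.
        v< = ≤-trans (valueℕ-< (1s ∷ y)) (^-monoʳ-≤ 2 (≤-trans (s≤s (All.lookup (output-length N x) y∈)) bound<k))
        w = word k (leading y)
        value : valueℕ w ≡ leading y
        value = valueℕ-word k v<
        w∈ : w ∈ words k
        w∈ = subst (λ l → w ∈ words l) (word-length k (leading y)) (∈-words w)

    K-acc : acc K x ≡ span N x
    K-acc = begin
      acc K x  ≡⟨ length-outputs K x ⟨
      length (acceptedOutputs K x)  ≡⟨ cong length (⟫-select H W member silence
          W-outputs) ⟩
      length (map (pair x) (filterᵇ P (words k)))  ≡⟨ length-map (pair x) (filterᵇ P (words k)) ⟩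
      length (filterᵇ P (words k))  ≡⟨ span-≡ ⟩
      span N x  ∎
      where open ≡-Reasoning

SpanP⊆♯P : PP ⊆ UP → SpanP ⊆ ♯P
SpanP⊆♯P H (N , f≡) = Span.K H N , λ x → trans (f≡ x) (cong ℤ.+_ (sym (Span.K-acc H N x)))

-- The equivalences

proposition4p3 : ((TotP ⊆ UPSVₜ) ⇔ (♯P ⊆ UPSVₜ)) ×
    ((♯P ⊆ UPSVₜ) ⇔ (GapP₊ ⊆ UPSVₜ)) ×
    ((GapP₊ ⊆ UPSVₜ) ⇔ (SpanP ⊆ UPSVₜ)) ×
    ((SpanP ⊆ UPSVₜ) ⇔ (PP ≐ UP))
proposition4p3 =
  mk⇔ TotP⇒♯P ♯P⇒TotP , mk⇔ ♯P⇒GapP₊ GapP₊⇒♯P , mk⇔ GapP₊⇒SpanP SpanP⇒GapP₊ , mk⇔ SpanP⇒PP≐UP PP≐UP⇒SpanP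
  where
  ♯P⇒TotP : ♯P ⊆ UPSVₜ → TotP ⊆ UPSVₜ
  ♯P⇒TotP H h = H (TotP⊆♯P h)
  GapP₊⇒♯P : GapP₊ ⊆ UPSVₜ → ♯P ⊆ UPSVₜ
  GapP₊⇒♯P H h = H (♯P⊆GapP₊ h)
  SpanP⇒♯P : SpanP ⊆ UPSVₜ → ♯P ⊆ UPSVₜ
  SpanP⇒♯P H h = H (♯P⊆SpanP h)
  GapP₊⇒SpanP : GapP₊ ⊆ UPSVₜ → SpanP ⊆ UPSVₜ
  -- The hypothesis is used twice: it first gives `PP ⊆ UP`, which makes the span function a `♯P`
  -- function and hence a `GapP₊` function, and then it is applied to that function.
  GapP₊⇒SpanP H h = H (♯P⊆GapP₊ (SpanP⊆♯P (PP⊆UP (GapP₊⇒♯P H)) h))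
  SpanP⇒GapP₊ : SpanP ⊆ UPSVₜ → GapP₊ ⊆ UPSVₜ
  SpanP⇒GapP₊ H = ♯P⇒GapP₊ (SpanP⇒♯P H)
  SpanP⇒PP≐UP : SpanP ⊆ UPSVₜ → PP ≐ UP
  SpanP⇒PP≐UP H = PP⊆UP (SpanP⇒♯P H) , UP⊆PP
  PP≐UP⇒SpanP : PP ≐ UP → SpanP ⊆ UPSVₜ
  PP≐UP⇒SpanP (H , _) h = ♯P⊆UPSVₜ H (SpanP⊆♯P H h)
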